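{- Let $a\ge b\ge 12$ be integers with $3\mid b$. If the spider $S(a,b,2)$ is $e$-positive, then \[a\ge\begin{cases}3b+3,&\text{if } a\equiv 0\pmod 3,\\[3pt] \dfrac{b}{2}+\dfrac94+\dfrac{\sqrt{12b^2-180b+565}}{4},&\text{if } a\equiv1\pmod 3,\\[6pt] \dfrac b2+\dfrac13+\dfrac{\sqrt{27b^2-54b+112}}{6},&\text{if } a\equiv 2\pmod 3.\end{cases}\] -}

module Defs where

open import Level using (0ℓ)
open import Data.Bool using (if_then_else_)
open import Data.Fin using (Fin; zero; suc; toℕ; splitAt; join; _↑ˡ_; _↑ʳ_)
open import Data.Fin.Properties using (splitAt-↑ˡ; splitAt-↑ʳ; join-splitAt; all?; suc-injective) renaming (_≟_ to _≟ᶠ_)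
open import Data.Integer using (ℤ; 0ℤ; 1ℤ; +_)
import Data.Integer as ℤ
open import Data.List using (List; []; _∷_; length; lookup; filter; map; foldr; upTo; allFin; cartesianProductWith)
open import Data.List.Relation.Unary.All using (All)
open import Data.List.Relation.Unary.Linked using (Linked)
open import Data.List.Relation.Unary.Unique.Propositional using (Unique)
import Data.Nat as ℕ
open import Data.Nat using (ℕ; zero; suc; _+_; _∸_; _<_; _≤_; _≥_; _≤?_; NonZero)
open import Data.Nat.ListAction using (sum)
open import Data.Nat.Properties using (1+n≢n)
open import Data.Product using (Σ; ∃-syntax; _×_; _,_)
open import Data.Rational using (ℚ; 0ℚ)
import Data.Rational as ℚ
open import Data.Sum using (_⊎_; inj₁; inj₂)
open import Data.Vec using (Vec; []; _∷_; tabulate; count)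
import Data.Vec as Vec
open import Data.Vec.Properties using (≡-dec)
import Data.Vec.Relation.Unary.All as VecAll
open import Function.Bundles using (_↔_; mk↔ₛ′; Inverse)
open import Relation.Binary.Core using (Rel)
open import Relation.Binary.Definitions using (Symmetric; Irreflexive; Decidable)
open import Relation.Binary.Construct.Closure.Symmetric using (SymClosure; fwd; bwd; symmetric)
open import Relation.Binary.PropositionalEquality using (_≡_; _≢_; refl; sym; trans; cong)
open import Relation.Nullary using (¬_; Dec; yes; no; does)
open import Relation.Nullary.Decidable using (map′; ¬?; _×-dec_; _⊎-dec_; _→-dec_)

record Graph : Set₁ where
  field
    Vertex   : Set
    order    : ℕ
    vertex   : Fin order ↔ Vertex
    _~_      : Rel Vertex 0ℓ
    ~-sym    : Symmetric _~_
    ~-irrefl : Irreflexive _≡_ _~_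
    _~?_     : Decidable _~_

-- Leg i is a path with vertices on i 0, on i 1, …, numbered outwards from
-- the centre, so its length is the number of vertices other than the centre.
data SpiderVertex (legs : List ℕ) : Set where
  centre : SpiderVertex legs
  on     : (i : Fin (length legs)) → Fin (lookup legs i) → SpiderVertex legs

data Outward {legs : List ℕ} : Rel (SpiderVertex legs) 0ℓ where
  attach : ∀ {i j} → toℕ j ≡ 0 → Outward centre (on i j)
  extend : ∀ {i j k} → toℕ k ≡ suc (toℕ j) → Outward (on i j) (on i k)

toLegs : ∀ legs → Fin (sum legs) → Σ (Fin (length legs)) λ i → Fin (lookup legs i)
toLegs (l ∷ legs) x with splitAt l x
... | inj₁ j = zero , j
... | inj₂ y = let (i , j) = toLegs legs y in suc i , j

fromLegs : ∀ legs (i : Fin (length legs)) → Fin (lookup legs i) → Fin (sum legs)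
fromLegs (l ∷ legs) zero    j = j ↑ˡ sum legs
fromLegs (l ∷ legs) (suc i) j = l ↑ʳ fromLegs legs i j

to-from : ∀ legs i j → toLegs legs (fromLegs legs i j) ≡ (i , j)
to-from (l ∷ legs) zero j rewrite splitAt-↑ˡ l j (sum legs) = refl
to-from (l ∷ legs) (suc i) j
  rewrite splitAt-↑ʳ l (sum legs) (fromLegs legs i j) | to-from legs i j = refl

from-to : ∀ legs x → (let (i , j) = toLegs legs x in fromLegs legs i j) ≡ x
from-to (l ∷ legs) x with splitAt l x in eq
... | inj₁ j = trans (cong (join l (sum legs)) (sym eq)) (join-splitAt l (sum legs) x)
... | inj₂ y = trans (cong (l ↑ʳ_) (from-to legs y))
                 (trans (cong (join l (sum legs)) (sym eq)) (join-splitAt l (sum legs) x))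

outward? : ∀ {legs} → Decidable (Outward {legs})
outward? centre   centre   = no λ ()
outward? centre   (on i j) = map′ attach (λ { (attach p) → p }) (toℕ j ℕ.≟ 0)
outward? (on i j) centre   = no λ ()
outward? (on i j) (on i′ k) with i ≟ᶠ i′
... | yes refl = map′ extend (λ { (extend p) → p }) (toℕ k ℕ.≟ suc (toℕ j))
... | no i≢i′  = no λ { (extend _) → i≢i′ refl }

outward-irrefl : ∀ {legs} (u : SpiderVertex legs) → ¬ Outward u u
outward-irrefl (on i j) (extend p) = 1+n≢n (sym p)

spiderVertex : ∀ legs → Fin (suc (sum legs)) ↔ SpiderVertex legs
spiderVertex legs = mk↔ₛ′ to from to∘from from∘to
  where
  to : Fin (suc (sum legs)) → SpiderVertex legs
  to zero    = centre
  to (suc x) = let (i , j) = toLegs legs x in on i j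

  from : SpiderVertex legs → Fin (suc (sum legs))
  from centre   = zero
  from (on i j) = suc (fromLegs legs i j)

  to∘from : ∀ v → to (from v) ≡ v
  to∘from centre   = refl
  to∘from (on i j) = cong (λ (i , j) → on i j) (to-from legs i j)

  from∘to : ∀ x → from (to x) ≡ x
  from∘to zero    = refl
  from∘to (suc x) = cong suc (from-to legs x)

spider : List ℕ → Graph
spider legs = record
  { Vertex   = SpiderVertex legs
  ; order    = suc (sum legs)
  ; vertex   = spiderVertex legs
  ; _~_      = SymClosure Outward
  ; ~-sym    = symmetric Outward
  ; ~-irrefl = λ { {u} refl (fwd p) → outward-irrefl u p
                 ; {u} refl (bwd p) → outward-irrefl u p }
  ; _~?_     = λ u v → map′ (λ { (inj₁ p) → fwd p ; (inj₂ p) → bwd p })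
                            (λ { (fwd p) → inj₁ p ; (bwd p) → inj₂ p })
                            (outward? u v ⊎-dec outward? v u)
  }

-- f N (α₁ ∷ … ∷ α_N ∷ []) is the coefficient of x₁^α₁ ⋯ x_N^α_N.  Every
-- monomial in the infinitely many variables has this form for large N, and
-- for the series below the coefficient is unchanged by appending zeros to α.
PowerSeries : Set
PowerSeries = (N : ℕ) → Vec ℕ N → ℤ

infix 4 _≐_
_≐_ : Rel PowerSeries 0ℓ
f ≐ g = ∀ N α → f N α ≡ g N α

Σℤ : List ℤ → ℤ
Σℤ = foldr ℤ._+_ 0ℤ

-- All (β , γ) with β + γ = α.
splittings : ∀ {N} → Vec ℕ N → List (Vec ℕ N × Vec ℕ N)
splittings []      = ([] , []) ∷ []
splittings (n ∷ α) =
  cartesianProductWith (λ m (β , γ) → m ∷ β , (n ∸ m) ∷ γ) (upTo (suc n)) (splittings α)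

infixl 7 _⊛_
_⊛_ : PowerSeries → PowerSeries → PowerSeries
(f ⊛ g) N α = Σℤ (map (λ (β , γ) → f N β ℤ.* g N γ) (splittings α))

𝟙 : PowerSeries
𝟙 N α = if does (Vec.sum α ℕ.≟ 0) then 1ℤ else 0ℤ

-- The sum of all squarefree monomials of degree k.
e : ℕ → PowerSeries
e k N α = if does (VecAll.all? (_≤? 1) α ×-dec (Vec.sum α ℕ.≟ k)) then 1ℤ else 0ℤ

record Partition : Set where
  field
    parts      : List ℕ
    decreasing : Linked _≥_ parts
    positive   : All (0 <_) parts
open Partition public

eᵖ : Partition → PowerSeries
eᵖ lam = foldr (λ k f → e k ⊛ f) 𝟙 (parts lam)

record EExpansion (f : PowerSeries) : Set where
  field
    support  : List Partition
    distinct : Unique (map parts support)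
    coeff    : Partition → ℤ
    expands  : f ≐ λ N α → Σℤ (map (λ lam → coeff lam ℤ.* eᵖ lam N α) support)
open EExpansion public

-- The eᵖ are linearly independent, so the coefficients are determined by f.
EPositive : PowerSeries → Set
EPositive f = ∃[ E ] All (λ lam → 0ℤ ℤ.≤ coeff {f} E lam) (support E)

-- A colouring assigns to each index of a vertex one of the colours 1, …, N.
allColourings : ∀ N n → List (Vec (Fin N) n)
allColourings N zero    = [] ∷ []
allColourings N (suc n) = cartesianProductWith _∷_ (allFin N) (allColourings N n)

module _ (G : Graph) where
  open Graph G

  private
    v : Fin order → Vertex
    v = Inverse.to vertex

  Proper : ∀ {N} → Vec (Fin N) order → Set
  Proper κ = ∀ i j → v i ~ v j → Vec.lookup κ i ≢ Vec.lookup κ j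

  proper? : ∀ {N} (κ : Vec (Fin N) order) → Dec (Proper κ)
  proper? κ = all? λ i → all? λ j →
    (v i ~? v j) →-dec ¬? (Vec.lookup κ i ≟ᶠ Vec.lookup κ j)

  -- The exponent vector of the product of x_κ(v) over all vertices v.
  content : ∀ {N} → Vec (Fin N) order → Vec ℕ N
  content κ = tabulate λ c → count (_≟ᶠ c) κ

  -- A colouring whose monomial is x₁^α₁ ⋯ x_N^α_N uses no colour above N, so
  -- N colours suffice for computing this coefficient.
  X : PowerSeries
  X N α = + length (filter (λ κ → proper? κ ×-dec ≡-dec ℕ._≟_ (content κ) α)
                           (allColourings N order))

-- Real numbers as lower Dedekind cuts: r is represented by {q ∈ ℚ ∣ q < r},
-- and r ≥ s is inclusion of the cut of s in that of r.

ℝ : Set₁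
ℝ = ℚ → Set

infix  4 _≥ᴿ_
infixl 6 _+ᴿ_
infixl 7 _÷_
infix  8 √_ ‵_

‵_ : ℤ → ℝ
(‵ z) q = q ℚ.< z ℚ./ 1

_+ᴿ_ : ℝ → ℝ → ℝ
(r +ᴿ s) q = ∃[ t ] ∃[ u ] r t × s u × q ≡ t ℚ.+ u

_÷_ : ℝ → (n : ℕ) .{{_ : NonZero n}} → ℝ
(r ÷ n) q = r (q ℚ.* (+ n ℚ./ 1))

-- The square root of a nonnegative integer (a negative argument would give 0).
√_ : ℤ → ℝ
(√ d) q = q ℚ.< 0ℚ ⊎ q ℚ.* q ℚ.< d ℚ./ 1

_≥ᴿ_ : ℝ → ℝ → Set
r ≥ᴿ s = ∀ q → s q → r q

{-# OPTIONS --safe #-}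
module Submission where

-- Let r₀, …, r₃ be the roots of T⁴ − T + 9σ, which lie in a quadratic extension
-- of ℤ[[σ]]/(σ⁷), so that e₁ = e₂ = 0, e₃ = 1 and e₄ = 9σ at (r₀, …, r₃).  The
-- degree n part of an e-positive series takes there a value whose coefficients
-- as a polynomial in σ are nonnegative.  For the chromatic symmetric function of
-- S(a,b,2) this value is Σ_c r_c W_a(c) W_b(c) W_2(c), where W_l(c) sums over the
-- colourings of a leg of length l attached to a vertex of colour c.  Since
-- W_{l+1}(c) = P (l+1) − r_c W_l(c), where P m belongs to the path with m
-- vertices, it equals
--   P (a+b+3) − P (a+1) P (b+2) − P (a+2) P (b+1),
-- and the coefficients of P m are explicit.  The coefficient of σʲ turns out to be
-- negative for j = 3 if 3 ∣ a and a ≤ 2b+3, for j = 6 if 3 ∣ a and 2b+6 ≤ a ≤ 3b,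
-- and for j = 4 if a ≡ 1 (mod 3) and a ≤ 2b−11; if a ≡ 2 (mod 3), then for j = 2
-- its sign is that of the quadratic polynomial in a whose larger root is the
-- asserted bound.

open import Defs
open import Algebra using (CommutativeRing)
import Algebra.Solver.Ring as RingSolver
open import Algebra.Solver.Ring.AlmostCommutativeRing using (fromCommutativeRing; _-Raw-AlmostCommutative⟶_)
import Algebra.Solver.Ring.NaturalCoefficients.Default as NatSolver
open import Data.Bool using (if_then_else_; true; false)
open import Data.Empty using (⊥)
open import Data.Fin using (Fin; zero; suc; toℕ) renaming (_≟_ to _≟ᶠ_)
open import Data.Integer using (ℤ; +_; 0ℤ; 1ℤ; -1ℤ)
import Data.Integer as ℤ
import Data.Integer.Properties as ℤₚ
import Data.Integer.Tactic.RingSolver as ℤ-Tactic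
open import Data.List as List using (List; []; _∷_; filter; length; upTo; applyUpTo; allFin; cartesianProductWith)
import Data.List.Properties as Listₚ
open import Data.List.Relation.Unary.All using (All; []; _∷_)
import Data.Maybe as Maybe
open import Data.Nat using (ℕ; zero; suc; _∸_; z≤n; s≤s)
import Data.Nat as ℕ
open import Data.Nat.ListAction using (sum)
import Data.Nat.Properties as ℕₚ
import Data.Nat.Tactic.RingSolver as ℕ-Tactic
open import Data.Product using (_×_; _,_; proj₁; proj₂; ∃-syntax)
import Data.Rational as ℚ
import Data.Rational.Properties as ℚₚ
import Data.Rational.Unnormalised.Properties as ℚᵘₚ
open import Data.Sum using (inj₁; inj₂)
open import Data.Unit using (⊤; tt)
open import Data.Vec as Vec using (Vec; []; _∷_; tabulate; count; lookup; _++_)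
open import Data.Vec.Properties using (≡-dec; lookup-++ˡ; lookup-++ʳ)
import Data.Vec.Relation.Unary.All as VecAll
open import Function using (_∘_; id)
open import Function.Bundles using (Inverse; _⇔_; mk⇔)
open import Function.Construct.Composition using (_⇔-∘_)
open import Level using (0ℓ)
open import Relation.Binary.Consequences using (dec⇒weaklyDec)
open import Relation.Binary.Construct.Closure.Symmetric using (fwd; bwd)
open import Relation.Binary.PropositionalEquality using (_≡_; _≢_; refl; sym; trans; cong; cong₂; subst; subst₂)
import Relation.Binary.PropositionalEquality as ≡
open import Relation.Nullary using (¬_; Dec; does; yes)
open import Relation.Nullary.Decidable using (_×-dec_; ¬?; does-⇔)

-- Truncated power series and quadratic extensions

-- Setting e₁ = e₂ = 0 with four variables kills every product that has a part other than 3 or 4,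
-- and the powers of σ count the parts 4. Being a value at elements of a ring, it can be computed
-- from the power series itself, whatever e-expansion is given.
--
-- Modulo σ the polynomial is T (T³ - 1). Its roots 0 and 1 are simple and lift to series, but the
-- other two reduce to primitive cube roots of unity; hence the quadratic extension. The derivative
-- at 1 is 3, so lifting that root divides by 3. For T = 1 + 3δ the polynomial becomes 9 (δ + 6δ² +
-- 12δ³ + 9δ⁴ + σ), which has an integral root δ; this is the origin of the 9.
--
-- In degree a + b + 3 only products e₃ˡ e₄ʲ with 3l + 4j = a + b + 3 occur. As 3 divides b, this
-- forces j ≡ a (mod 3), and so only j = 0, 3, 6, ... or 1, 4, ... or 2, 5, ... carry information in
-- the three cases. The largest exponent used is 6, hence the truncation.

Series : Set
Series = ℕ → ℤ

module SeriesLaws where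
  open import Data.Integer using (_+_; _*_)
  open ≡.≡-Reasoning

  infixl 7 _·_
  infixl 6 _⊹_

  _⊹_ : Series → Series → Series
  (f ⊹ g) n = f n + g n

  -- The Cauchy product, by peeling off the constant term of f.
  _·_ : Series → Series → Series
  (f · g) zero    = f 0 * g 0
  (f · g) (suc n) = f 0 * g (suc n) + (f ∘ suc · g) n

  const : ℤ → Series
  const c zero    = c
  const c (suc n) = 0ℤ

  ·-cong : ∀ n {f f′ g g′ : Series} → (∀ k → k ℕ.≤ n → f k ≡ f′ k) → (∀ k → k ℕ.≤ n → g k ≡ g′ k) →
           (f · g) n ≡ (f′ · g′) n
  ·-cong zero    p q = cong₂ _*_ (p 0 z≤n) (q 0 z≤n)
  ·-cong (suc n) p q = cong₂ _+_ (cong₂ _*_ (p 0 z≤n) (q (suc n) ℕₚ.≤-refl))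
    (·-cong n (λ k k≤n → p (suc k) (s≤s k≤n)) (λ k k≤n → q k (ℕₚ.m≤n⇒m≤1+n k≤n)))

  -- The mirror image of the definition of `_·_`, which recurses on the first factor only; `·-comm`
  -- needs both forms.
  ·-sucʳ : ∀ n f g → (f · g) (suc n) ≡ (f · g ∘ suc) n + f (suc n) * g 0
  ·-sucʳ zero    f g = refl
  ·-sucʳ (suc n) f g = trans (cong (λ z → f 0 * g (suc (suc n)) + z) (·-sucʳ n (f ∘ suc) g))
    (sym (ℤₚ.+-assoc (f 0 * g (suc (suc n))) ((f ∘ suc · g ∘ suc) n) (f (suc (suc n)) * g 0)))

  ·-comm : ∀ n f g → (f · g) n ≡ (g · f) n
  ·-comm zero    f g = ℤₚ.*-comm (f 0) (g 0)
  ·-comm (suc n) f g = begin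
    f 0 * g (suc n) + (f ∘ suc · g) n ≡⟨ cong₂ _+_ (ℤₚ.*-comm (f 0) (g (suc n))) (·-comm n (f ∘ suc) g) ⟩
    g (suc n) * f 0 + (g · f ∘ suc) n ≡⟨ ℤₚ.+-comm (g (suc n) * f 0) ((g · f ∘ suc) n) ⟩
    (g · f ∘ suc) n + g (suc n) * f 0 ≡⟨ ·-sucʳ n g f ⟨
    (g · f) (suc n)                   ∎

  ·-distribʳ : ∀ n h f g → ((f ⊹ g) · h) n ≡ (f · h) n + (g · h) n
  ·-distribʳ zero    h f g = ℤₚ.*-distribʳ-+ (h 0) (f 0) (g 0)
  ·-distribʳ (suc n) h f g = trans
    (cong (λ z → (f 0 + g 0) * h (suc n) + z) (·-distribʳ n h (f ∘ suc) (g ∘ suc)))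
    (rearrange (f 0) (g 0) (h (suc n)) ((f ∘ suc · h) n) ((g ∘ suc · h) n))
    where
    rearrange : ∀ a b c x y → (a + b) * c + (x + y) ≡ (a * c + x) + (b * c + y)
    rearrange = ℤ-Tactic.solve-∀

  ·-distribˡ : ∀ n h f g → (h · (f ⊹ g)) n ≡ (h · f) n + (h · g) n
  ·-distribˡ n h f g = begin
    (h · (f ⊹ g)) n       ≡⟨ ·-comm n h (f ⊹ g) ⟩
    ((f ⊹ g) · h) n       ≡⟨ ·-distribʳ n h f g ⟩
    (f · h) n + (g · h) n ≡⟨ cong₂ _+_ (·-comm n f h) (·-comm n g h) ⟩
    (h · f) n + (h · g) n ∎

  ·-scale : ∀ n c f g → ((λ k → c * f k) · g) n ≡ c * (f · g) n
  ·-scale zero    c f g = ℤₚ.*-assoc c (f 0) (g 0)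
  ·-scale (suc n) c f g = trans
    (cong₂ _+_ (ℤₚ.*-assoc c (f 0) (g (suc n))) (·-scale n c (f ∘ suc) g))
    (sym (ℤₚ.*-distribˡ-+ c (f 0 * g (suc n)) ((f ∘ suc · g) n)))

  ·-assoc : ∀ n f g h → ((f · g) · h) n ≡ (f · (g · h)) n
  ·-assoc zero    f g h = ℤₚ.*-assoc (f 0) (g 0) (h 0)
  ·-assoc (suc n) f g h = begin
    f 0 * g 0 * h (suc n) + (((λ k → f 0 * g (suc k)) ⊹ (f ∘ suc · g)) · h) n
      ≡⟨ cong (λ z → f 0 * g 0 * h (suc n) + z) (·-distribʳ n h (λ k → f 0 * g (suc k)) (f ∘ suc · g)) ⟩
    f 0 * g 0 * h (suc n) + (((λ k → f 0 * g (suc k)) · h) n + ((f ∘ suc · g) · h) n)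
      ≡⟨ cong (λ z → f 0 * g 0 * h (suc n) + z) (cong₂ _+_ (·-scale n (f 0) (g ∘ suc) h) (·-assoc n (f ∘ suc) g h)) ⟩
    f 0 * g 0 * h (suc n) + (f 0 * (g ∘ suc · h) n + (f ∘ suc · (g · h)) n)
      ≡⟨ rearrange (f 0) (g 0) (h (suc n)) ((g ∘ suc · h) n) ((f ∘ suc · (g · h)) n) ⟩
    f 0 * (g 0 * h (suc n) + (g ∘ suc · h) n) + (f ∘ suc · (g · h)) n ∎
    where
    rearrange : ∀ a b c x y → a * b * c + (a * x + y) ≡ a * (b * c + x) + y
    rearrange = ℤ-Tactic.solve-∀

  zero-· : ∀ n {f} g → (∀ k → f k ≡ 0ℤ) → (f · g) n ≡ 0ℤ
  zero-· zero    g f≡0 = cong (λ z → z * g 0) (f≡0 0)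
  zero-· (suc n) g f≡0 = cong₂ _+_ (cong (λ z → z * g (suc n)) (f≡0 0)) (zero-· n g (λ k → f≡0 (suc k)))

  const-· : ∀ n c g → (const c · g) n ≡ c * g n
  const-· zero    c g = refl
  const-· (suc n) c g = trans (cong (λ z → c * g (suc n) + z) (zero-· n g (λ _ → refl))) (ℤₚ.+-identityʳ _)

open SeriesLaws

-- ℤ[[σ]] modulo σ^(d+1): equality only inspects the coefficients up to σ^d.
seriesRing : ℕ → CommutativeRing 0ℓ 0ℓ
seriesRing d = record
  { Carrier = Series
  ; _≈_ = λ f g → ∀ k → k ℕ.≤ d → f k ≡ g k
  ; _+_ = _⊹_
  ; _*_ = _·_
  ; -_ = λ f k → ℤ.- f k
  ; 0# = λ _ → 0ℤ
  ; 1# = const 1ℤ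
  ; isCommutativeRing = record
    { isRing = record
      { +-isAbelianGroup = record
        { isGroup = record
          { isMonoid = record
            { isSemigroup = record
              { isMagma = record
                { isEquivalence = record
                  { refl = λ _ _ → refl
                  ; sym = λ p k k≤d → sym (p k k≤d)
                  ; trans = λ p q k k≤d → trans (p k k≤d) (q k k≤d) }
                ; ∙-cong = λ p q k k≤d → cong₂ ℤ._+_ (p k k≤d) (q k k≤d) }
              ; assoc = λ f g h k _ → ℤₚ.+-assoc (f k) (g k) (h k) }
            ; identity = (λ f k _ → ℤₚ.+-identityˡ (f k)) , (λ f k _ → ℤₚ.+-identityʳ (f k)) }
          ; inverse = (λ f k _ → ℤₚ.+-inverseˡ (f k)) , (λ f k _ → ℤₚ.+-inverseʳ (f k))
          ; ⁻¹-cong = λ p k k≤d → cong ℤ.-_ (p k k≤d) }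
        ; comm = λ f g k _ → ℤₚ.+-comm (f k) (g k) }
      ; *-cong = λ p q k k≤d → ·-cong k (λ i i≤k → p i (ℕₚ.≤-trans i≤k k≤d)) (λ i i≤k → q i (ℕₚ.≤-trans i≤k k≤d))
      ; *-assoc = λ f g h k _ → ·-assoc k f g h
      ; *-identity = (λ f k _ → identityˡ f k) , (λ f k _ → trans (·-comm k f (const 1ℤ)) (identityˡ f k))
      ; distrib = (λ h f g k _ → ·-distribˡ k h f g) , (λ h f g k _ → ·-distribʳ k h f g) }
    ; *-comm = λ f g k _ → ·-comm k f g }
  }
  where
  identityˡ : ∀ f k → (const 1ℤ · f) k ≡ f k
  identityˡ f k = trans (const-· k 1ℤ f) (ℤₚ.*-identityˡ (f k))

ℤ⟶_ : CommutativeRing 0ℓ 0ℓ → Set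
ℤ⟶ R = ℤ.+-*-rawRing -Raw-AlmostCommutative⟶ fromCommutativeRing R

const-homo : ∀ d → ℤ⟶ seriesRing d
const-homo d = record
  { ⟦_⟧ = const
  ; +-homo = λ { a b zero _ → refl ; a b (suc k) _ → refl }
  ; *-homo = λ { a b zero _ → refl ; a b (suc k) _ → sym (trans (const-· (suc k) a (const b)) (ℤₚ.*-zeroʳ a)) }
  ; -‿homo = λ { a zero _ → refl ; a (suc k) _ → refl }
  ; 0-homo = λ { zero _ → refl ; (suc k) _ → refl }
  ; 1-homo = λ _ _ → refl
  }

-- A[τ] / (τ² − p τ − q), with (a , b) standing for a + b τ.
module Quadratic (A : CommutativeRing 0ℓ 0ℓ) (p q : CommutativeRing.Carrier A) where
  open CommutativeRing A
  open NatSolver commutativeSemiring using (solve; _:=_; _:+_; _:*_; con)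

  quadraticRing : CommutativeRing 0ℓ 0ℓ
  quadraticRing = record
    { Carrier = Carrier × Carrier
    ; _≈_ = λ (a , b) (c , d) → a ≈ c × b ≈ d
    ; _+_ = λ (a , b) (c , d) → a + c , b + d
    ; _*_ = λ (a , b) (c , d) → a * c + q * (b * d) , a * d + b * c + p * (b * d)
    ; -_ = λ (a , b) → - a , - b
    ; 0# = 0# , 0#
    ; 1# = 1# , 0#
    ; isCommutativeRing = record
      { isRing = record
        { +-isAbelianGroup = record
          { isGroup = record
            { isMonoid = record
              { isSemigroup = record
                { isMagma = record
                  { isEquivalence = record
                    { refl = refl′ , refl′
                    ; sym = λ (x , y) → sym′ x , sym′ y
                    ; trans = λ (x , y) (z , w) → trans′ x z , trans′ y w }
                  ; ∙-cong = λ (x , y) (z , w) → +-cong x z , +-cong y w }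
                ; assoc = λ (a , b) (c , d) (e , f) → +-assoc a c e , +-assoc b d f }
              ; identity = (λ (a , b) → +-identityˡ a , +-identityˡ b) , (λ (a , b) → +-identityʳ a , +-identityʳ b) }
            ; inverse = (λ (a , b) → -‿inverseˡ a , -‿inverseˡ b) , (λ (a , b) → -‿inverseʳ a , -‿inverseʳ b)
            ; ⁻¹-cong = λ (x , y) → -‿cong x , -‿cong y }
          ; comm = λ (a , b) (c , d) → +-comm a c , +-comm b d }
        ; *-cong = λ (x , y) (z , w) →
            +-cong (*-cong x z) (*-congˡ (*-cong y w)) ,
            +-cong (+-cong (*-cong x w) (*-cong y z)) (*-congˡ (*-cong y w))
        ; *-assoc = λ (a , b) (c , d) (e , f) →
            solve 8 (λ p q a b c d e f →
              (a :* c :+ q :* (b :* d)) :* e :+ q :* ((a :* d :+ b :* c :+ p :* (b :* d)) :* f) :=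
              a :* (c :* e :+ q :* (d :* f)) :+ q :* (b :* (c :* f :+ d :* e :+ p :* (d :* f)))) refl′ p q a b c d e f ,
            solve 8 (λ p q a b c d e f →
              (a :* c :+ q :* (b :* d)) :* f :+ (a :* d :+ b :* c :+ p :* (b :* d)) :* e
                :+ p :* ((a :* d :+ b :* c :+ p :* (b :* d)) :* f) :=
              a :* (c :* f :+ d :* e :+ p :* (d :* f)) :+ b :* (c :* e :+ q :* (d :* f))
                :+ p :* (b :* (c :* f :+ d :* e :+ p :* (d :* f)))) refl′ p q a b c d e f
        ; *-identity =
            (λ (a , b) → solve 3 (λ q a b → con 1 :* a :+ q :* (con 0 :* b) := a) refl′ q a b ,
                         solve 3 (λ p a b → con 1 :* b :+ con 0 :* a :+ p :* (con 0 :* b) := b) refl′ p a b) ,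
            (λ (a , b) → solve 3 (λ q a b → a :* con 1 :+ q :* (b :* con 0) := a) refl′ q a b ,
                         solve 3 (λ p a b → a :* con 0 :+ b :* con 1 :+ p :* (b :* con 0) := b) refl′ p a b)
        ; distrib =
            (λ (a , b) (c , d) (e , f) →
              solve 7 (λ q a b c d e f → a :* (c :+ e) :+ q :* (b :* (d :+ f)) :=
                a :* c :+ q :* (b :* d) :+ (a :* e :+ q :* (b :* f))) refl′ q a b c d e f ,
              solve 7 (λ p a b c d e f → a :* (d :+ f) :+ b :* (c :+ e) :+ p :* (b :* (d :+ f)) :=
                a :* d :+ b :* c :+ p :* (b :* d) :+ (a :* f :+ b :* e :+ p :* (b :* f))) refl′ p a b c d e f) ,
            (λ (a , b) (c , d) (e , f) →
              solve 7 (λ q a b c d e f → (c :+ e) :* a :+ q :* ((d :+ f) :* b) :=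
                c :* a :+ q :* (d :* b) :+ (e :* a :+ q :* (f :* b))) refl′ q a b c d e f ,
              solve 7 (λ p a b c d e f → (c :+ e) :* b :+ (d :+ f) :* a :+ p :* ((d :+ f) :* b) :=
                c :* b :+ d :* a :+ p :* (d :* b) :+ (e :* b :+ f :* a :+ p :* (f :* b))) refl′ p a b c d e f) }
      ; *-comm = λ (a , b) (c , d) →
          solve 5 (λ q a b c d → a :* c :+ q :* (b :* d) := c :* a :+ q :* (d :* b)) refl′ q a b c d ,
          solve 5 (λ p a b c d → a :* d :+ b :* c :+ p :* (b :* d) := c :* b :+ d :* a :+ p :* (d :* b)) refl′ p a b c d }
    }
    where
    open CommutativeRing A renaming (refl to refl′; sym to sym′; trans to trans′) using ()

  embed-homo : ℤ⟶ A → ℤ⟶ quadraticRing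
  embed-homo φ = record
    { ⟦_⟧ = λ c → ⟦ c ⟧ , 0#
    ; +-homo = λ a b → +-homo a b , S.sym (+-identityˡ 0#)
    ; *-homo = λ a b →
        S.trans (*-homo a b) (solve 3 (λ q a b → a :* b := a :* b :+ q :* (con 0 :* con 0)) S.refl q ⟦ a ⟧ ⟦ b ⟧) ,
        solve 3 (λ p a b → con 0 := a :* con 0 :+ con 0 :* b :+ p :* (con 0 :* con 0)) S.refl p ⟦ a ⟧ ⟦ b ⟧
    ; -‿homo = λ a → -‿homo a , S.trans (S.sym (-‿inverseʳ 0#)) (+-identityˡ (- 0#))
    ; 0-homo = 0-homo , S.refl
    ; 1-homo = 1-homo , S.refl
    }
    where
    open _-Raw-AlmostCommutative⟶_ φ
    module S = CommutativeRing A

-- Evaluation of symmetric functions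

Σℤ-++ : ∀ xs ys → Σℤ (xs List.++ ys) ≡ Σℤ xs ℤ.+ Σℤ ys
Σℤ-++ []       ys = sym (ℤₚ.+-identityˡ _)
Σℤ-++ (x ∷ xs) ys = trans (cong (λ z → x ℤ.+ z) (Σℤ-++ xs ys)) (sym (ℤₚ.+-assoc x (Σℤ xs) (Σℤ ys)))

Σℤ-map-≡0 : ∀ {A : Set} {h : A → ℤ} xs → (∀ x → h x ≡ 0ℤ) → Σℤ (List.map h xs) ≡ 0ℤ
Σℤ-map-≡0 []       h≡0 = refl
Σℤ-map-≡0 (x ∷ xs) h≡0 = cong₂ ℤ._+_ (h≡0 x) (Σℤ-map-≡0 xs h≡0)

Coefficients : ℕ → Set
Coefficients N = Vec ℕ N → ℤ

slice : ∀ {N} → ℕ → Coefficients (suc N) → Coefficients N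
slice m g α = g (m ∷ α)

convolve : ∀ {N} → Coefficients N → Coefficients N → Coefficients N
convolve f g α = Σℤ (List.map (λ (β , γ) → f β ℤ.* g γ) (splittings α))

convolveRow : ∀ {N} → Coefficients (suc N) → Coefficients (suc N) → ℕ → List (Vec ℕ N × Vec ℕ N) → ℕ → ℤ
convolveRow f g n ss i = Σℤ (List.map (λ (β , γ) → f (i ∷ β) ℤ.* g ((n ∸ i) ∷ γ)) ss)

convolve-row : ∀ {N} (f g : Coefficients (suc N)) n (is : List ℕ) (ss : List (Vec ℕ N × Vec ℕ N)) →
  Σℤ (List.map (λ (β , γ) → f β ℤ.* g γ)
    (cartesianProductWith (λ m (β , γ) → m ∷ β , (n ∸ m) ∷ γ) is ss)) ≡
  Σℤ (List.map (convolveRow f g n ss) is)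
convolve-row f g n []       ss = refl
convolve-row {N} f g n (i ∷ is) ss = begin
  Σℤ (List.map h (List.map k ss List.++ rest))             ≡⟨ cong Σℤ (Listₚ.map-++ h (List.map k ss) rest) ⟩
  Σℤ (List.map h (List.map k ss) List.++ List.map h rest)  ≡⟨ Σℤ-++ (List.map h (List.map k ss)) _ ⟩
  Σℤ (List.map h (List.map k ss)) ℤ.+ Σℤ (List.map h rest)
    ≡⟨ cong₂ ℤ._+_ (cong Σℤ (sym (Listₚ.map-∘ ss))) (convolve-row f g n is ss) ⟩
  Σℤ (List.map (h ∘ k) ss) ℤ.+ Σℤ (List.map (convolveRow f g n ss) is)        ∎
  where
  open ≡.≡-Reasoning
  h : Vec ℕ (suc N) × Vec ℕ (suc N) → ℤ
  h (β , γ) = f β ℤ.* g γ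
  k : Vec ℕ N × Vec ℕ N → Vec ℕ (suc N) × Vec ℕ (suc N)
  k (β , γ) = i ∷ β , (n ∸ i) ∷ γ
  rest = cartesianProductWith (λ m (β , γ) → m ∷ β , (n ∸ m) ∷ γ) is ss

e⊛-zero : ∀ {N} k (g : Coefficients (suc N)) (α : Vec ℕ N) →
  convolve (e k (suc N)) g (0 ∷ α) ≡ convolve (e k N) (slice 0 g) α
e⊛-zero {N} k g α = trans (convolve-row (e k (suc N)) g 0 (upTo 1) (splittings α)) (ℤₚ.+-identityʳ _)

Σℤ-applyUpTo-≡0 : ∀ {h : ℕ → ℤ} n (f : ℕ → ℕ) → (∀ i → h (f i) ≡ 0ℤ) → Σℤ (List.map h (applyUpTo f n)) ≡ 0ℤ
Σℤ-applyUpTo-≡0 zero    f p = refl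
Σℤ-applyUpTo-≡0 (suc n) f p = cong₂ ℤ._+_ (p 0) (Σℤ-applyUpTo-≡0 n (f ∘ suc) (p ∘ suc))

e0-suc : ∀ {N} i (β : Vec ℕ N) → e 0 (suc N) (suc i ∷ β) ≡ 0ℤ
e0-suc i β with does (VecAll.all? (ℕ._≤? 1) (suc i ∷ β))
... | true  = refl
... | false = refl

e0⊛-suc : ∀ {N} m (g : Coefficients (suc N)) (α : Vec ℕ N) →
  convolve (e 0 (suc N)) g (suc m ∷ α) ≡ convolve (e 0 N) (slice (suc m) g) α
e0⊛-suc {N} m g α = trans (convolve-row (e 0 (suc N)) g (suc m) (upTo (suc (suc m))) (splittings α))
  (trans (cong (λ z → convolve (e 0 N) (slice (suc m) g) α ℤ.+ z)
    (Σℤ-applyUpTo-≡0 {convolveRow (e 0 (suc N)) g (suc m) (splittings α)} (suc m) suc λ i → Σℤ-map-≡0 (splittings α) λ (β , γ) →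
      cong (λ z → z ℤ.* g ((m ∸ i) ∷ γ)) (e0-suc i β)))
    (ℤₚ.+-identityʳ _))

-- This is eₖ₊₁(x, ...) = eₖ₊₁(...) + x eₖ(...) inside a product: only the exponents 0 and 1 of the
-- first variable survive in the first factor, so the last m of the m + 2 rows of the convolution
-- vanish.
e⊛-suc : ∀ {N} k m (g : Coefficients (suc N)) (α : Vec ℕ N) →
  convolve (e (suc k) (suc N)) g (suc m ∷ α) ≡
  convolve (e (suc k) N) (slice (suc m) g) α ℤ.+ convolve (e k N) (slice m g) α
e⊛-suc {N} k m g α = trans (convolve-row (e (suc k) (suc N)) g (suc m) (upTo (suc (suc m))) (splittings α))
  (cong (λ z → convolve (e (suc k) N) (slice (suc m) g) α ℤ.+ z)
    (trans (cong (λ z → convolve (e k N) (slice m g) α ℤ.+ z)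
      (Σℤ-applyUpTo-≡0 {convolveRow (e (suc k) (suc N)) g (suc m) (splittings α)} m (λ i → suc (suc i)) λ i → Σℤ-map-≡0 (splittings α) λ (β , γ) → refl))
      (ℤₚ.+-identityʳ _)))

length-filter-× : ∀ {A : Set} {P Q : A → Set} (P? : ∀ x → Dec (P x)) (Q? : ∀ x → Dec (Q x)) x xs →
  + length (filter (λ x → P? x ×-dec Q? x) (x ∷ xs)) ≡
  (if does (P? x) then (if does (Q? x) then 1ℤ else 0ℤ) else 0ℤ) ℤ.+ + length (filter (λ x → P? x ×-dec Q? x) xs)
length-filter-× P? Q? x xs with does (P? x) | does (Q? x)
... | true  | true  = refl
... | true  | false = refl
... | false | _     = refl

module Evaluation (R : CommutativeRing 0ℓ 0ℓ) (φ : ℤ⟶ R) where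
  open CommutativeRing R hiding (zero) renaming (refl to ≈-refl; sym to ≈-sym; trans to ≈-trans)
  open _-Raw-AlmostCommutative⟶_ φ renaming (⟦_⟧ to ι) public
  open import Relation.Binary.Reasoning.Setoid setoid
  ι-≟ : ∀ a b → Maybe.Maybe (ι a ≈ ι b)
  ι-≟ a b = Maybe.map (λ a≡b → reflexive (cong ι a≡b)) (dec⇒weaklyDec ℤₚ._≟_ a b)

  open RingSolver ℤ.+-*-rawRing (fromCommutativeRing R) φ ι-≟
    using (solve; _:=_; _:+_; _:*_; _:-_; :-_; con; Polynomial) public

  -- The terms containing the first variable, divided by it: a series is its `slice 0` plus the
  -- first variable times its `bump`.
  bump : ∀ {N} → Coefficients (suc N) → Coefficients (suc N)
  bump f α = f (suc (Vec.head α) ∷ Vec.tail α)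

  -- The value at rs of the part of degree n of the series with coefficients f.
  ev : ∀ {N} → Vec Carrier N → ℕ → Coefficients N → Carrier
  ev []       zero    f = ι (f [])
  ev []       (suc n) f = 0#
  ev (r ∷ rs) zero    f = ev rs zero (slice 0 f)
  ev (r ∷ rs) (suc n) f = ev rs (suc n) (slice 0 f) + r * ev (r ∷ rs) n (bump f)

  ev-cong : ∀ {N} (rs : Vec Carrier N) n {f g} → (∀ α → f α ≡ g α) → ev rs n f ≈ ev rs n g
  ev-cong []       zero    p = reflexive (cong ι (p []))
  ev-cong []       (suc n) p = ≈-refl
  ev-cong (r ∷ rs) zero    p = ev-cong rs zero λ α → p (0 ∷ α)
  ev-cong (r ∷ rs) (suc n) p = +-cong (ev-cong rs (suc n) λ α → p (0 ∷ α))
    (*-congˡ (ev-cong (r ∷ rs) n λ α → p _))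

  ev-0 : ∀ {N} (rs : Vec Carrier N) n → ev rs n (λ _ → 0ℤ) ≈ 0#
  ev-0 []       zero    = 0-homo
  ev-0 []       (suc n) = ≈-refl
  ev-0 (r ∷ rs) zero    = ev-0 rs zero
  ev-0 (r ∷ rs) (suc n) = ≈-trans (+-cong (ev-0 rs (suc n)) (*-congˡ (ev-0 (r ∷ rs) n)))
    (≈-trans (+-identityˡ _) (zeroʳ r))

  ev-+ : ∀ {N} (rs : Vec Carrier N) n f g → ev rs n (λ α → f α ℤ.+ g α) ≈ ev rs n f + ev rs n g
  ev-+ []       zero    f g = +-homo (f []) (g [])
  ev-+ []       (suc n) f g = ≈-sym (+-identityˡ 0#)
  ev-+ (r ∷ rs) zero    f g = ev-+ rs zero (slice 0 f) (slice 0 g)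
  ev-+ (r ∷ rs) (suc n) f g = ≈-trans
    (+-cong (ev-+ rs (suc n) (slice 0 f) (slice 0 g)) (*-congˡ (ev-+ (r ∷ rs) n (bump f) (bump g))))
    (solve 5 (λ r a b c d → (a :+ b) :+ r :* (c :+ d) := (a :+ r :* c) :+ (b :+ r :* d)) ≈-refl r _ _ _ _)

  ev-* : ∀ {N} (rs : Vec Carrier N) n c f → ev rs n (λ α → c ℤ.* f α) ≈ ι c * ev rs n f
  ev-* []       zero    c f = *-homo c (f [])
  ev-* []       (suc n) c f = ≈-sym (zeroʳ (ι c))
  ev-* (r ∷ rs) zero    c f = ev-* rs zero c (slice 0 f)
  ev-* (r ∷ rs) (suc n) c f = ≈-trans
    (+-cong (ev-* rs (suc n) c (slice 0 f)) (*-congˡ (ev-* (r ∷ rs) n c (bump f))))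
    (solve 4 (λ r c a b → c :* a :+ r :* (c :* b) := c :* (a :+ r :* b)) ≈-refl r (ι c) _ _)

  -- A shift of the degree by k, as caused by multiplication with eₖ. The recursion gives 0 below
  -- degree k, where `n ∸ k` would wrongly give `F 0`.
  delay : ℕ → (ℕ → Carrier) → ℕ → Carrier
  delay zero    F n       = F n
  delay (suc k) F zero    = 0#
  delay (suc k) F (suc n) = delay k F n

  -- The recursion of `ev` in the degree survives a shift. `F 0 ≈ G 0` is used where `suc n` equals
  -- k, since there the shifted recursion has just reached degree 0.
  delay-step : ∀ k r {F G H} → F 0 ≈ G 0 → (∀ m → F (suc m) ≈ G (suc m) + r * H m) →
    ∀ n → delay k F (suc n) ≈ delay k G (suc n) + r * delay k H n
  delay-step zero          r F0 Fs n       = Fs n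
  delay-step (suc zero)    r F0 Fs zero    = ≈-trans F0 (≈-sym (≈-trans (+-congˡ (zeroʳ r)) (+-identityʳ _)))
  delay-step (suc (suc k)) r F0 Fs zero    = ≈-sym (≈-trans (+-congˡ (zeroʳ r)) (+-identityʳ _))
  delay-step (suc k)       r F0 Fs (suc n) = delay-step k r F0 Fs n

  delay-0 : ∀ k {F G} → F 0 ≈ G 0 → delay k F 0 ≈ delay k G 0
  delay-0 zero    F0 = F0
  delay-0 (suc k) F0 = ≈-refl

  elementary : ∀ {N} → Vec Carrier N → ℕ → Carrier
  elementary []       zero    = 1#
  elementary []       (suc k) = 0#
  elementary (r ∷ rs) zero    = 1#
  elementary (r ∷ rs) (suc k) = elementary rs (suc k) + r * elementary rs k

  elementary-0 : ∀ {N} (rs : Vec Carrier N) → elementary rs 0 ≡ 1#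
  elementary-0 []       = refl
  elementary-0 (r ∷ rs) = refl

  -- The product with a series in which the first variable does not occur.
  convolveTail : ∀ {N} → Coefficients N → Coefficients (suc N) → Coefficients (suc N)
  convolveTail f g α = convolve f (slice (Vec.head α) g) (Vec.tail α)

  raise : ∀ {N} → Coefficients (suc N) → Coefficients (suc N)
  raise f (zero  ∷ α) = 0ℤ
  raise f (suc m ∷ α) = f (m ∷ α)

  ev-raise : ∀ {N} r (rs : Vec Carrier N) n f →
    ev (r ∷ rs) n (raise f) ≈ r * delay 1 (λ m → ev (r ∷ rs) m f) n
  ev-raise r rs zero    f = ≈-trans (ev-0 rs zero) (≈-sym (zeroʳ r))
  ev-raise r rs (suc n) f = ≈-trans (+-cong (ev-0 rs (suc n)) (*-congˡ (ev-cong (r ∷ rs) n {g = f} λ { (m ∷ α) → refl })))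
    (+-identityˡ _)

  ev-convolveTail : ∀ {N} r (rs : Vec Carrier N) f k c →
    (∀ n g → ev rs n (convolve f g) ≈ c * delay k (λ m → ev rs m g) n) →
    ∀ n g → ev (r ∷ rs) n (convolveTail f g) ≈ c * delay k (λ m → ev (r ∷ rs) m g) n
  ev-convolveTail r rs f k c p zero    g = ≈-trans (p zero (slice 0 g)) (*-congˡ (delay-0 k ≈-refl))
  ev-convolveTail r rs f k c p (suc n) g = begin
    ev rs (suc n) (convolve f (slice 0 g)) + r * ev (r ∷ rs) n (convolveTail f (bump g))
      ≈⟨ +-cong (p (suc n) (slice 0 g)) (*-congˡ (ev-convolveTail r rs f k c p n (bump g))) ⟩
    c * delay k (λ m → ev rs m (slice 0 g)) (suc n) + r * (c * delay k (λ m → ev (r ∷ rs) m (bump g)) n)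
      ≈⟨ solve 4 (λ c r a b → c :* a :+ r :* (c :* b) := c :* (a :+ r :* b)) ≈-refl c r _ _ ⟩
    c * (delay k (λ m → ev rs m (slice 0 g)) (suc n) + r * delay k (λ m → ev (r ∷ rs) m (bump g)) n)
      ≈⟨ *-congˡ (≈-sym (delay-step k r ≈-refl (λ m → ≈-refl) n)) ⟩
    c * delay k (λ m → ev (r ∷ rs) m g) (suc n) ∎

  -- Multiplicativity of the evaluation for products with one eₖ, which is all that `eᵖ` is built
  -- from. The induction on the variables splits eₖ according to whether the first variable occurs,
  -- which is also the recursion of `elementary`.
  ev-e⊛ : ∀ {N} (rs : Vec Carrier N) k n (g : Coefficients N) →
    ev rs n (convolve (e k N) g) ≈ elementary rs k * delay k (λ m → ev rs m g) n
  ev-e⊛ [] zero    zero    g = ≈-trans (reflexive (cong ι (trans (ℤₚ.+-identityʳ _) (ℤₚ.*-identityˡ (g []))))) (≈-sym (*-identityˡ _))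
  ev-e⊛ [] (suc k) zero    g = ≈-trans 0-homo (≈-sym (zeroˡ _))
  ev-e⊛ [] zero    (suc n) g = ≈-sym (zeroʳ _)
  ev-e⊛ [] (suc k) (suc n) g = ≈-sym (zeroˡ _)
  ev-e⊛ {suc N} (r ∷ rs) zero n g = begin
    ev (r ∷ rs) n (convolve (e 0 (suc N)) g)
      ≈⟨ ev-cong (r ∷ rs) n (λ { (zero ∷ α) → e⊛-zero 0 g α ; (suc m ∷ α) → e0⊛-suc m g α }) ⟩
    ev (r ∷ rs) n (convolveTail (e 0 N) g)
      ≈⟨ ev-convolveTail r rs (e 0 N) 0 _ (ev-e⊛ rs 0) n g ⟩
    elementary rs 0 * ev (r ∷ rs) n g
      ≈⟨ *-congʳ (reflexive (elementary-0 rs)) ⟩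
    1# * ev (r ∷ rs) n g ∎
  ev-e⊛ {suc N} (r ∷ rs) (suc k) n g = begin
    ev (r ∷ rs) n (convolve (e (suc k) (suc N)) g)
      ≈⟨ ev-cong (r ∷ rs) n (λ { (zero ∷ α) → trans (e⊛-zero (suc k) g α) (sym (ℤₚ.+-identityʳ _)) ; (suc m ∷ α) → e⊛-suc k m g α }) ⟩
    ev (r ∷ rs) n (λ α → convolveTail (e (suc k) N) g α ℤ.+ raise (convolveTail (e k N) g) α)
      ≈⟨ ev-+ (r ∷ rs) n (convolveTail (e (suc k) N) g) (raise (convolveTail (e k N) g)) ⟩
    ev (r ∷ rs) n (convolveTail (e (suc k) N) g) + ev (r ∷ rs) n (raise (convolveTail (e k N) g))
      ≈⟨ +-cong (ev-convolveTail r rs (e (suc k) N) (suc k) _ (ev-e⊛ rs (suc k)) n g)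
                (≈-trans (ev-raise r rs n (convolveTail (e k N) g))
                  (*-congˡ (delayed n))) ⟩
    elementary rs (suc k) * D n + r * (elementary rs k * D n)
      ≈⟨ solve 4 (λ r a b d → a :* d :+ r :* (b :* d) := (a :+ r :* b) :* d) ≈-refl r _ _ _ ⟩
    elementary (r ∷ rs) (suc k) * D n ∎
    where
    D = delay (suc k) (λ m → ev (r ∷ rs) m g)
    delayed : ∀ n → delay 1 (λ m → ev (r ∷ rs) m (convolveTail (e k N) g)) n ≈ elementary rs k * D n
    delayed zero    = ≈-sym (zeroʳ _)
    delayed (suc n) = ev-convolveTail r rs (e k N) k _ (ev-e⊛ rs k) n g

  -- Abstract nonnegativity in a ring without an order. These closure properties carry it from the
  -- values of the eₖ to that of every e-positive series.
  record IsPositiveCone (P : Carrier → Set) : Set where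
    field
      resp : ∀ {x y} → x ≈ y → P x → P y
      +-closed : ∀ {x y} → P x → P y → P (x + y)
      *-closed : ∀ {x y} → P x → P y → P (x * y)
      ι-closed : ∀ {c} → 0ℤ ℤ.≤ c → P (ι c)

    0-closed : P 0#
    0-closed = resp 0-homo (ι-closed (ℤ.+≤+ z≤n))

    1-closed : P 1#
    1-closed = resp 1-homo (ι-closed (ℤ.+≤+ z≤n))

  module _ {P : Carrier → Set} (cone : IsPositiveCone P) where
    open IsPositiveCone cone

    delay-closed : ∀ k {F} n → (∀ m → P (F m)) → P (delay k F n)
    delay-closed zero    n       p = p n
    delay-closed (suc k) zero    p = 0-closed
    delay-closed (suc k) (suc n) p = delay-closed k n p

    ev-𝟙-closed : ∀ {N} (rs : Vec Carrier N) n → P (ev rs n (𝟙 N))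
    ev-𝟙-closed []       zero    = ι-closed (ℤ.+≤+ z≤n)
    ev-𝟙-closed []       (suc n) = 0-closed
    ev-𝟙-closed (r ∷ rs) zero    = ev-𝟙-closed rs zero
    ev-𝟙-closed (r ∷ rs) (suc n) = resp
      (≈-sym (≈-trans (+-congˡ (≈-trans (*-congˡ (ev-0 (r ∷ rs) n)) (zeroʳ r))) (+-identityʳ _)))
      (ev-𝟙-closed rs (suc n))

    module _ {N} (rs : Vec Carrier N) (elementary-closed : ∀ k → P (elementary rs k)) where

      ev-e⊛s-closed : ∀ ks n → P (ev rs n (List.foldr (λ k f → e k ⊛ f) 𝟙 ks N))
      ev-e⊛s-closed []       n = ev-𝟙-closed rs n
      ev-e⊛s-closed (k ∷ ks) n = resp (≈-sym (ev-e⊛ rs k n _))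
        (*-closed (elementary-closed k) (delay-closed k n (ev-e⊛s-closed ks)))

      ev-combination-closed : ∀ (c : Partition → ℤ) L → All (λ lam → 0ℤ ℤ.≤ c lam) L → ∀ n →
        P (ev rs n (λ α → Σℤ (List.map (λ lam → c lam ℤ.* eᵖ lam N α) L)))
      ev-combination-closed c []        []          n = resp (≈-sym (ev-0 rs n)) 0-closed
      ev-combination-closed c (lam ∷ L) (c≥0 ∷ all) n = resp (≈-sym (≈-trans
          (ev-+ rs n (λ α → c lam ℤ.* eᵖ lam N α) (λ α → Σℤ (List.map (λ lam → c lam ℤ.* eᵖ lam N α) L)))
          (+-congʳ (ev-* rs n (c lam) (eᵖ lam N)))))
        (+-closed (*-closed (ι-closed c≥0) (ev-e⊛s-closed (parts lam) n)) (ev-combination-closed c L all n))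

      ev-EPositive-closed : ∀ f → EPositive f → ∀ n → P (ev rs n (f N))
      ev-EPositive-closed f (E , all) n = resp (≈-sym (ev-cong rs n (expands E N)))
        (ev-combination-closed (coeff E) (support E) all n)

  Σ[_] : {A : Set} → List A → (A → Carrier) → Carrier
  Σ[ xs ] F = List.foldr (λ x s → F x + s) 0# xs

  Σ-cong : ∀ {A : Set} (xs : List A) {F G : A → Carrier} → (∀ x → F x ≈ G x) → Σ[ xs ] F ≈ Σ[ xs ] G
  Σ-cong []       p = ≈-refl
  Σ-cong (x ∷ xs) p = +-cong (p x) (Σ-cong xs p)

  Σ-++ : ∀ {A : Set} (xs ys : List A) {F : A → Carrier} → Σ[ xs List.++ ys ] F ≈ Σ[ xs ] F + Σ[ ys ] F
  Σ-++ []       ys = ≈-sym (+-identityˡ _)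
  Σ-++ (x ∷ xs) ys = ≈-trans (+-congˡ (Σ-++ xs ys)) (≈-sym (+-assoc _ _ _))

  Σ-map : ∀ {A B : Set} (h : A → B) xs {F : B → Carrier} → Σ[ List.map h xs ] F ≈ Σ[ xs ] (F ∘ h)
  Σ-map h []       = ≈-refl
  Σ-map h (x ∷ xs) = +-congˡ (Σ-map h xs)

  Σ-*ˡ : ∀ {A : Set} c (xs : List A) {F : A → Carrier} → Σ[ xs ] (λ x → c * F x) ≈ c * Σ[ xs ] F
  Σ-*ˡ c []       = ≈-sym (zeroʳ c)
  Σ-*ˡ c (x ∷ xs) = ≈-trans (+-congˡ (Σ-*ˡ c xs)) (≈-sym (distribˡ _ _ _))

  Σ-*ʳ : ∀ {A : Set} c (xs : List A) {F : A → Carrier} → Σ[ xs ] (λ x → F x * c) ≈ Σ[ xs ] F * c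
  Σ-*ʳ c []       = ≈-sym (zeroˡ c)
  Σ-*ʳ c (x ∷ xs) = ≈-trans (+-congˡ (Σ-*ʳ c xs)) (≈-sym (distribʳ _ _ _))

  Σ-cartesianProductWith : ∀ {A B C : Set} (h : A → B → C) xs ys {F : C → Carrier} →
    Σ[ cartesianProductWith h xs ys ] F ≈ Σ[ xs ] (λ x → Σ[ ys ] (λ y → F (h x y)))
  Σ-cartesianProductWith h []       ys = ≈-refl
  Σ-cartesianProductWith h (x ∷ xs) ys = ≈-trans (Σ-++ (List.map (h x) ys) _)
    (+-cong (Σ-map (h x) ys) (Σ-cartesianProductWith h xs ys))

  monomial : ∀ {N} → Vec Carrier N → Vec ℕ N → Carrier
  monomial []       []          = 1#
  monomial (r ∷ rs) (zero ∷ β)  = monomial rs β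
  monomial (r ∷ rs) (suc m ∷ β) = r * monomial (r ∷ rs) (m ∷ β)

  indicator : ∀ {N} → Vec ℕ N → Coefficients N
  indicator β α = if does (≡-dec ℕ._≟_ β α) then 1ℤ else 0ℤ

  ev-indicator : ∀ {N} (rs : Vec Carrier N) β → ev rs (Vec.sum β) (indicator β) ≈ monomial rs β
  ev-indicator []       []         = 1-homo
  -- `ev` branches on the degree, which is stuck until the sum is exposed. In positive degree the
  -- additional summand is 0, because the indicator of an exponent vector starting with 0 has no
  -- term containing the first variable.
  ev-indicator (r ∷ rs) (zero ∷ β) with Vec.sum β in eq
  ... | zero  = subst (λ n → ev rs n (indicator β) ≈ monomial rs β) eq (ev-indicator rs β)
  ... | suc n = ≈-trans (+-cong (subst (λ n → ev rs n (indicator β) ≈ monomial rs β) eq (ev-indicator rs β))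
                                (≈-trans (*-congˡ (ev-0 (r ∷ rs) n)) (zeroʳ r)))
                        (+-identityʳ _)
  ev-indicator (r ∷ rs) (suc m ∷ β) = ≈-trans
    (+-cong (ev-0 rs (suc (m ℕ.+ Vec.sum β)))
            (*-congˡ (≈-trans (ev-cong (r ∷ rs) (m ℕ.+ Vec.sum β) {g = indicator (m ∷ β)} λ { (k ∷ α) → refl })
                              (ev-indicator (r ∷ rs) (m ∷ β)))))
    (+-identityˡ _)

  -- This is the form to which `count (_≟ᶠ c)` unfolds when a vertex of colour d is added.
  increment : ∀ {N} → Fin N → (Fin N → ℕ) → Fin N → ℕ
  increment d h c = (if does (d ≟ᶠ c) then suc else id) (h c)

  monomial-increment : ∀ {N} (rs : Vec Carrier N) d h →
    monomial rs (tabulate (increment d h)) ≈ lookup rs d * monomial rs (tabulate h)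
  monomial-increment (r ∷ rs) zero    h = ≈-refl
  monomial-increment (r ∷ rs) (suc d) h = go (h zero)
    where
    go : ∀ m → monomial (r ∷ rs) (m ∷ tabulate (increment d (h ∘ suc))) ≈
               lookup rs d * monomial (r ∷ rs) (m ∷ tabulate (h ∘ suc))
    go zero    = monomial-increment rs d (h ∘ suc)
    go (suc m) = ≈-trans (*-congˡ (go m)) (solve 3 (λ a b c → a :* (b :* c) := b :* (a :* c)) ≈-refl _ _ _)

  sum-increment : ∀ {N} (d : Fin N) h → Vec.sum (tabulate (increment d h)) ≡ suc (Vec.sum (tabulate h))
  sum-increment zero    h = refl
  sum-increment (suc d) h = trans (cong (h zero ℕ.+_) (sum-increment d (h ∘ suc))) (ℕₚ.+-suc (h zero) _)

  weight : ∀ {N n} → Vec Carrier N → Vec (Fin N) n → Carrier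
  weight rs []      = 1#
  weight rs (d ∷ κ) = lookup rs d * weight rs κ

  -- Definitionally `content G`, but for colourings of any length, so that induction on the
  -- colouring is possible.
  contents : ∀ {N n} → Vec (Fin N) n → Vec ℕ N
  contents κ = tabulate λ c → count (_≟ᶠ c) κ

  monomial-contents : ∀ {N n} (rs : Vec Carrier N) (κ : Vec (Fin N) n) → monomial rs (contents κ) ≈ weight rs κ
  monomial-contents rs []      = go rs
    where
    go : ∀ {N} (rs : Vec Carrier N) → monomial rs (tabulate λ _ → 0) ≈ 1#
    go []       = ≈-refl
    go (r ∷ rs) = go rs
  monomial-contents rs (d ∷ κ) = ≈-trans (monomial-increment rs d (λ c → count (_≟ᶠ c) κ))
    (*-congˡ (monomial-contents rs κ))

  sum-contents : ∀ {N n} (κ : Vec (Fin N) n) → Vec.sum (contents κ) ≡ n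
  sum-contents {N} []      = go N
    where
    go : ∀ N → Vec.sum (tabulate {n = N} λ _ → 0) ≡ 0
    go zero    = refl
    go (suc N) = go N
  sum-contents (d ∷ κ) = trans (sum-increment d (λ c → count (_≟ᶠ c) κ)) (cong suc (sum-contents κ))

  module _ (G : Graph) where
    open Graph G

    -- The counts are linear in the list of colourings, which is peeled off one by one. A proper
    -- colouring contributes the indicator of its content; the entries of the content add up to
    -- `order`, so its monomial has exactly the degree evaluated.
    ev-X : ∀ {N} (rs : Vec Carrier N) →
      ev rs order (X G N) ≈ Σ[ allColourings N order ] (λ κ → if does (proper? G κ) then weight rs κ else 0#)
    ev-X {N} rs = go (allColourings N order)
      where
      count-proper : List (Vec (Fin N) order) → Coefficients N
      count-proper κs α = + length (filter (λ κ → proper? G κ ×-dec ≡-dec ℕ._≟_ (content G κ) α) κs)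

      go : ∀ κs → ev rs order (count-proper κs) ≈ Σ[ κs ] (λ κ → if does (proper? G κ) then weight rs κ else 0#)
      go []       = ev-0 rs order
      go (κ ∷ κs) = ≈-trans
        (≈-trans (ev-cong rs order (λ α → length-filter-× (proper? G) (λ κ → ≡-dec ℕ._≟_ (content G κ) α) κ κs))
                 (ev-+ rs order (λ α → if does (proper? G κ) then indicator (contents κ) α else 0ℤ) (count-proper κs)))
        (+-cong head (go κs))
        where
        head : ev rs order (λ α → if does (proper? G κ) then indicator (contents κ) α else 0ℤ) ≈
               (if does (proper? G κ) then weight rs κ else 0#)
        head with does (proper? G κ)
        ... | false = ev-0 rs order
        ... | true  = ≈-trans (reflexive (cong (λ n → ev rs n (indicator (contents κ))) (sym (sum-contents κ))))
                        (≈-trans (ev-indicator rs (contents κ)) (monomial-contents rs κ))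

-- Colourings of spiders

-- Properness on a leg coloured by κ, listed outwards, together with the edge to a vertex of colour
-- c.
Alternating : ∀ {N l} → Fin N → Vec (Fin N) l → Set
Alternating c []      = ⊤
Alternating c (d ∷ κ) = c ≢ d × Alternating d κ

alternating? : ∀ {N l} c (κ : Vec (Fin N) l) → Dec (Alternating c κ)
alternating? c []      = yes tt
alternating? c (d ∷ κ) = ¬? (c ≟ᶠ d) ×-dec alternating? d κ

Alternating-first : ∀ {N l} c (κ : Vec (Fin N) l) → Alternating c κ → ∀ j → toℕ j ≡ 0 → c ≢ lookup κ j
Alternating-first c (d ∷ κ) (c≢d , _) zero _ = c≢d

Alternating-next : ∀ {N l} c (κ : Vec (Fin N) l) → Alternating c κ →
  ∀ j k → toℕ k ≡ suc (toℕ j) → lookup κ j ≢ lookup κ k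
Alternating-next c (d ∷ κ) (_ , alt) zero    (suc k) eq = Alternating-first d κ alt k (ℕₚ.suc-injective eq)
Alternating-next c (d ∷ κ) (_ , alt) (suc j) (suc k) eq = Alternating-next d κ alt j k (ℕₚ.suc-injective eq)

mkAlternating : ∀ {N l} c (κ : Vec (Fin N) l) → (∀ j → toℕ j ≡ 0 → c ≢ lookup κ j) →
  (∀ j k → toℕ k ≡ suc (toℕ j) → lookup κ j ≢ lookup κ k) → Alternating c κ
mkAlternating c []      first next = tt
mkAlternating c (d ∷ κ) first next = first zero refl ,
  mkAlternating d κ (λ j eq → next zero (suc j) (cong suc eq)) (λ j k eq → next (suc j) (suc k) (cong suc eq))

concatLegs : ∀ {A : Set} legs → (∀ i → Vec A (List.lookup legs i)) → Vec A (sum legs)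
concatLegs []         κs = []
concatLegs (l ∷ legs) κs = κs zero ++ concatLegs legs (κs ∘ suc)

lookup-concatLegs : ∀ {A : Set} legs (κs : ∀ i → Vec A (List.lookup legs i)) i j →
  lookup (concatLegs legs κs) (fromLegs legs i j) ≡ lookup (κs i) j
lookup-concatLegs (l ∷ legs) κs zero    j = lookup-++ˡ (κs zero) (concatLegs legs (κs ∘ suc)) j
lookup-concatLegs (l ∷ legs) κs (suc i) j = trans
  (lookup-++ʳ (κs zero) (concatLegs legs (κs ∘ suc)) (fromLegs legs i j)) (lookup-concatLegs legs (κs ∘ suc) i j)

module _ {N} legs (c : Fin N) (κs : ∀ i → Vec (Fin N) (List.lookup legs i)) where
  open Inverse (spiderVertex legs) using (to; from; strictlyInverseˡ)

  private
    κ : Vec (Fin N) (suc (sum legs))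
    κ = c ∷ concatLegs legs κs

    colour : SpiderVertex legs → Fin N
    colour centre   = c
    colour (on i j) = lookup (κs i) j

    lookup-κ : ∀ x → lookup κ x ≡ colour (to x)
    lookup-κ zero    = refl
    lookup-κ (suc x) = trans (cong (lookup (concatLegs legs κs)) (sym (from-to legs x))) (lookup-concatLegs legs κs _ _)

    lookup-κ-from : ∀ u → lookup κ (from u) ≡ colour u
    lookup-κ-from u = trans (lookup-κ (from u)) (cong colour (strictlyInverseˡ u))

    proper⇒outward : Proper (spider legs) κ → ∀ {u w} → Outward u w → colour u ≢ colour w
    proper⇒outward proper {u} {w} u→w eq = proper (from u) (from w)
      (fwd (subst (λ x → Outward x (to (from w))) (sym (strictlyInverseˡ u)) (subst (Outward u) (sym (strictlyInverseˡ w)) u→w)))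
      (trans (lookup-κ-from u) (trans eq (sym (lookup-κ-from w))))

    alternating⇒outward : (∀ i → Alternating c (κs i)) → ∀ {u w} → Outward u w → colour u ≢ colour w
    alternating⇒outward alt (attach {i} {j} eq)     = Alternating-first c (κs i) (alt i) j eq
    alternating⇒outward alt (extend {i} {j} {k} eq) = Alternating-next c (κs i) (alt i) j k eq

  proper⇔alternating : Proper (spider legs) κ ⇔ (∀ i → Alternating c (κs i))
  proper⇔alternating = mk⇔
    (λ proper i → mkAlternating c (κs i) (λ j eq → proper⇒outward proper (attach eq))
                                         (λ j k eq → proper⇒outward proper (extend {j = j} {k} eq)))
    (λ alt x y → λ
      { (fwd x→y) eq → alternating⇒outward alt x→y (trans (sym (lookup-κ x)) (trans eq (lookup-κ y)))
      ; (bwd y→x) eq → alternating⇒outward alt y→x (trans (sym (lookup-κ y)) (trans (sym eq) (lookup-κ x))) })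

module Colourings (R : CommutativeRing 0ℓ 0ℓ) (φ : ℤ⟶ R) {N} (rs : Vec (CommutativeRing.Carrier R) N) where
  open CommutativeRing R hiding (zero) renaming (refl to ≈-refl; sym to ≈-sym; trans to ≈-trans)
  open Evaluation R φ
  open import Relation.Binary.Reasoning.Setoid setoid

  Σ-++-colourings : ∀ m n (F : Vec (Fin N) (m ℕ.+ n) → Carrier) →
    Σ[ allColourings N (m ℕ.+ n) ] F ≈ Σ[ allColourings N m ] (λ κ → Σ[ allColourings N n ] (λ κ′ → F (κ ++ κ′)))
  Σ-++-colourings zero    n F = ≈-sym (+-identityʳ _)
  Σ-++-colourings (suc m) n F = begin
    Σ[ allColourings N (suc m ℕ.+ n) ] F
      ≈⟨ Σ-cartesianProductWith _∷_ (allFin N) (allColourings N (m ℕ.+ n)) ⟩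
    Σ[ allFin N ] (λ d → Σ[ allColourings N (m ℕ.+ n) ] (λ κ → F (d ∷ κ)))
      ≈⟨ Σ-cong (allFin N) (λ d → Σ-++-colourings m n (F ∘ (d ∷_))) ⟩
    Σ[ allFin N ] (λ d → Σ[ allColourings N m ] (λ κ → Σ[ allColourings N n ] (λ κ′ → F (d ∷ κ ++ κ′))))
      ≈⟨ Σ-cartesianProductWith _∷_ (allFin N) (allColourings N m) ⟨
    Σ[ allColourings N (suc m) ] (λ κ → Σ[ allColourings N n ] (λ κ′ → F (κ ++ κ′))) ∎

  weight-++ : ∀ {m n} (κ : Vec (Fin N) m) (κ′ : Vec (Fin N) n) → weight rs (κ ++ κ′) ≈ weight rs κ * weight rs κ′
  weight-++ []      κ′ = ≈-sym (*-identityˡ _)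
  weight-++ (d ∷ κ) κ′ = ≈-trans (*-congˡ (weight-++ κ κ′)) (≈-sym (*-assoc _ _ _))

  legWeight : ∀ {l} → Fin N → Vec (Fin N) l → Carrier
  legWeight c κ = if does (alternating? c κ) then weight rs κ else 0#

  legSum : ℕ → Fin N → Carrier
  legSum l c = Σ[ allColourings N l ] (legWeight c)

  legSum-zero : ∀ c → legSum 0 c ≈ 1#
  legSum-zero c = +-identityʳ 1#

  legSum-suc : ∀ l c →
    legSum (suc l) c ≈ Σ[ allFin N ] (λ d → (if does (c ≟ᶠ d) then 0# else lookup rs d) * legSum l d)
  legSum-suc l c = ≈-trans (Σ-cartesianProductWith _∷_ (allFin N) (allColourings N l))
    (Σ-cong (allFin N) λ d → ≈-trans (Σ-cong (allColourings N l) (step d)) (Σ-*ˡ _ (allColourings N l)))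
    where
    step : ∀ d κ → legWeight c (d ∷ κ) ≈ (if does (c ≟ᶠ d) then 0# else lookup rs d) * legWeight d κ
    step d κ with does (c ≟ᶠ d) | does (alternating? d κ)
    ... | true  | _     = ≈-sym (zeroˡ _)
    ... | false | true  = ≈-refl
    ... | false | false = ≈-sym (zeroʳ _)

  module _ (l₁ l₂ l₃ : ℕ) where
    private
      legs : List ℕ
      legs = l₁ ∷ l₂ ∷ l₃ ∷ []

      three : Vec (Fin N) l₁ → Vec (Fin N) l₂ → Vec (Fin N) l₃ → ∀ i → Vec (Fin N) (List.lookup legs i)
      three κ₁ κ₂ κ₃ zero             = κ₁
      three κ₁ κ₂ κ₃ (suc zero)       = κ₂
      three κ₁ κ₂ κ₃ (suc (suc zero)) = κ₃

      term : Vec (Fin N) (suc (sum legs)) → Carrier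
      term κ = if does (proper? (spider legs) κ) then weight rs κ else 0#

      alternating³? : ∀ (c : Fin N) (κ₁ : Vec (Fin N) l₁) (κ₂ : Vec (Fin N) l₂) (κ₃ : Vec (Fin N) l₃) → Dec (Alternating c κ₁ × Alternating c κ₂ × Alternating c κ₃)
      alternating³? c κ₁ κ₂ κ₃ = alternating? c κ₁ ×-dec alternating? c κ₂ ×-dec alternating? c κ₃

      proper⇔alternating³ : ∀ (c : Fin N) (κ₁ : Vec (Fin N) l₁) (κ₂ : Vec (Fin N) l₂) (κ₃ : Vec (Fin N) l₃) → Proper (spider legs) (c ∷ κ₁ ++ κ₂ ++ κ₃ ++ []) ⇔
        (Alternating c κ₁ × Alternating c κ₂ × Alternating c κ₃)
      proper⇔alternating³ c κ₁ κ₂ κ₃ =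
        mk⇔ (λ alt → alt zero , alt (suc zero) , alt (suc (suc zero)))
            (λ { (x , y , z) zero → x ; (x , y , z) (suc zero) → y ; (x , y , z) (suc (suc zero)) → z })
        ⇔-∘ proper⇔alternating legs c (three κ₁ κ₂ κ₃)

      weight-factors : ∀ (c : Fin N) (κ₁ : Vec (Fin N) l₁) (κ₂ : Vec (Fin N) l₂) (κ₃ : Vec (Fin N) l₃) →
        (if does (alternating³? c κ₁ κ₂ κ₃) then weight rs (c ∷ κ₁ ++ κ₂ ++ κ₃ ++ []) else 0#) ≈
        lookup rs c * (legWeight c κ₁ * (legWeight c κ₂ * legWeight c κ₃))
      weight-factors c κ₁ κ₂ κ₃
        with does (alternating? c κ₁) | does (alternating? c κ₂) | does (alternating? c κ₃)
      ... | true  | true  | true  = *-congˡ (≈-trans (weight-++ κ₁ _) (*-congˡ (≈-trans (weight-++ κ₂ _) (*-congˡ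
                                      (≈-trans (weight-++ κ₃ []) (*-identityʳ _))))))
      ... | true  | true  | false = ≈-sym (≈-trans (*-congˡ (≈-trans (*-congˡ (zeroʳ _)) (zeroʳ _))) (zeroʳ _))
      ... | true  | false | _     = ≈-sym (≈-trans (*-congˡ (≈-trans (*-congˡ (zeroˡ _)) (zeroʳ _))) (zeroʳ _))
      ... | false | _     | _     = ≈-sym (≈-trans (*-congˡ (zeroˡ _)) (zeroʳ _))

      term-factors : ∀ (c : Fin N) (κ₁ : Vec (Fin N) l₁) (κ₂ : Vec (Fin N) l₂) (κ₃ : Vec (Fin N) l₃) → term (c ∷ κ₁ ++ κ₂ ++ κ₃ ++ []) ≈
        lookup rs c * (legWeight c κ₁ * (legWeight c κ₂ * legWeight c κ₃))
      term-factors c κ₁ κ₂ κ₃ = ≈-trans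
        (reflexive (cong (λ b → if b then weight rs (c ∷ κ₁ ++ κ₂ ++ κ₃ ++ []) else 0#)
          (does-⇔ (proper⇔alternating³ c κ₁ κ₂ κ₃)
            (proper? (spider legs) (c ∷ κ₁ ++ κ₂ ++ κ₃ ++ [])) (alternating³? c κ₁ κ₂ κ₃))))
        (weight-factors c κ₁ κ₂ κ₃)

    ev-X-spider : ev rs (suc (sum legs)) (X (spider legs) N) ≈
      Σ[ allFin N ] (λ c → lookup rs c * (legSum l₁ c * (legSum l₂ c * legSum l₃ c)))
    ev-X-spider = begin
      ev rs (suc (sum legs)) (X (spider legs) N)
        ≈⟨ ev-X (spider legs) rs ⟩
      Σ[ allColourings N (suc (sum legs)) ] term
        ≈⟨ Σ-cartesianProductWith _∷_ (allFin N) (allColourings N (sum legs)) ⟩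
      Σ[ allFin N ] (λ c → Σ[ allColourings N (sum legs) ] (λ κ → term (c ∷ κ)))
        ≈⟨ Σ-cong (allFin N) factor ⟩
      Σ[ allFin N ] (λ c → lookup rs c * (legSum l₁ c * (legSum l₂ c * legSum l₃ c))) ∎
      where
      factor : ∀ c → Σ[ allColourings N (sum legs) ] (λ κ → term (c ∷ κ)) ≈
                     lookup rs c * (legSum l₁ c * (legSum l₂ c * legSum l₃ c))
      factor c = begin
        Σ[ allColourings N (sum legs) ] (λ κ → term (c ∷ κ))
          ≈⟨ Σ-++-colourings l₁ _ _ ⟩
        Σ[ allColourings N l₁ ] (λ κ₁ → Σ[ allColourings N (l₂ ℕ.+ (l₃ ℕ.+ 0)) ] (λ κ → term (c ∷ κ₁ ++ κ)))
          ≈⟨ Σ-cong (allColourings N l₁) (λ κ₁ → Σ-++-colourings l₂ _ _) ⟩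
        Σ[ allColourings N l₁ ] (λ κ₁ → Σ[ allColourings N l₂ ] (λ κ₂ →
          Σ[ allColourings N (l₃ ℕ.+ 0) ] (λ κ → term (c ∷ κ₁ ++ κ₂ ++ κ))))
          -- `sum legs` ends in `+ 0`, so the third leg is followed by the colouring of nothing, of
          -- which there is exactly one.
          ≈⟨ Σ-cong (allColourings N l₁) (λ κ₁ → Σ-cong (allColourings N l₂) (λ κ₂ → ≈-trans (Σ-++-colourings l₃ 0 _)
               (Σ-cong (allColourings N l₃) (λ κ₃ → ≈-trans (+-identityʳ _) (term-factors c κ₁ κ₂ κ₃))))) ⟩
        Σ[ allColourings N l₁ ] (λ κ₁ → Σ[ allColourings N l₂ ] (λ κ₂ → Σ[ allColourings N l₃ ] (λ κ₃ →
          lookup rs c * (legWeight c κ₁ * (legWeight c κ₂ * legWeight c κ₃)))))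
          -- The distributive law, applied from the innermost sum outwards.
          ≈⟨ Σ-cong (allColourings N l₁) (λ κ₁ → ≈-trans (Σ-cong (allColourings N l₂) (λ κ₂ →
               ≈-trans (Σ-*ˡ _ (allColourings N l₃)) (*-congˡ (≈-trans (Σ-*ˡ _ (allColourings N l₃)) (*-congˡ (Σ-*ˡ _ (allColourings N l₃)))))))
               (≈-trans (Σ-*ˡ _ (allColourings N l₂)) (*-congˡ (≈-trans (Σ-*ˡ _ (allColourings N l₂)) (*-congˡ (Σ-*ʳ _ (allColourings N l₂))))))) ⟩
        Σ[ allColourings N l₁ ] (λ κ₁ → lookup rs c * (legWeight c κ₁ * (legSum l₂ c * legSum l₃ c)))
          ≈⟨ ≈-trans (Σ-*ˡ _ (allColourings N l₁)) (*-congˡ (Σ-*ʳ _ (allColourings N l₁))) ⟩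
        lookup rs c * (legSum l₁ c * (legSum l₂ c * legSum l₃ c)) ∎

-- Paths and spiders evaluated in four variables

module FourVariables (R : CommutativeRing 0ℓ 0ℓ) (φ : ℤ⟶ R) (r₀ r₁ r₂ r₃ : CommutativeRing.Carrier R) where
  open CommutativeRing R hiding (zero) renaming (refl to ≈-refl; sym to ≈-sym; trans to ≈-trans)
  open Evaluation R φ
  open import Relation.Binary.Reasoning.Setoid setoid

  private module NS = NatSolver commutativeSemiring

  rs : Vec Carrier 4
  rs = r₀ ∷ r₁ ∷ r₂ ∷ r₃ ∷ []

  open Colourings R φ rs

  r : Fin 4 → Carrier
  r = lookup rs

  Σ₄ : (Fin 4 → Carrier) → Carrier
  Σ₄ F = F zero + F (suc zero) + F (suc (suc zero)) + F (suc (suc (suc zero)))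

  Σ₄-allFin : ∀ F → Σ[ allFin 4 ] F ≈ Σ₄ F
  Σ₄-allFin F = NS.solve 4 (λ a b c d →
    a NS.:+ (b NS.:+ (c NS.:+ (d NS.:+ NS.con 0))) NS.:= a NS.:+ b NS.:+ c NS.:+ d) ≈-refl
    (F zero) (F (suc zero)) (F (suc (suc zero))) (F (suc (suc (suc zero))))

  Σ₄-cong : ∀ {F G} → (∀ c → F c ≈ G c) → Σ₄ F ≈ Σ₄ G
  Σ₄-cong p = +-cong (+-cong (+-cong (p _) (p _)) (p _)) (p _)

  -- The value at rs of the chromatic symmetric function of the path with m vertices.
  path : ℕ → Carrier
  path zero    = 1#
  path (suc l) = Σ₄ λ c → r c * legSum l c

  -- The first vertex of the leg may have any colour but c. Allowing c as well gives a free path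
  -- with `suc l` vertices, and the term that has to be taken away is `r c * legSum l c`.
  legSum-recurrence : ∀ l c → legSum (suc l) c ≈ path (suc l) - r c * legSum l c
  legSum-recurrence l c = begin
    legSum (suc l) c                                          ≈⟨ legSum-suc l c ⟩
    Σ[ allFin 4 ] others                                      ≈⟨ Σ₄-allFin others ⟩
    Σ₄ others                                                 ≈⟨ solve 2 (λ x y → x := x :+ y :- y) ≈-refl _ _ ⟩
    Σ₄ others + r c * legSum l c - r c * legSum l c           ≈⟨ +-congʳ (complete c (legSum l)) ⟩
    path (suc l) - r c * legSum l c                           ∎
    where
    others : Fin 4 → Carrier
    others d = (if does (c ≟ᶠ d) then 0# else r d) * legSum l d

    complete : ∀ c (W : Fin 4 → Carrier) →
      Σ₄ (λ d → (if does (c ≟ᶠ d) then 0# else r d) * W d) + r c * W c ≈ Σ₄ (λ d → r d * W d)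
    complete zero W = NS.solve 8 (λ a b c d w x y z →
      NS.con 0 NS.:* w NS.:+ b NS.:* x NS.:+ c NS.:* y NS.:+ d NS.:* z NS.:+ a NS.:* w NS.:=
      a NS.:* w NS.:+ b NS.:* x NS.:+ c NS.:* y NS.:+ d NS.:* z) ≈-refl r₀ r₁ r₂ r₃ _ _ _ _
    complete (suc zero) W = NS.solve 8 (λ a b c d w x y z →
      a NS.:* w NS.:+ NS.con 0 NS.:* x NS.:+ c NS.:* y NS.:+ d NS.:* z NS.:+ b NS.:* x NS.:=
      a NS.:* w NS.:+ b NS.:* x NS.:+ c NS.:* y NS.:+ d NS.:* z) ≈-refl r₀ r₁ r₂ r₃ _ _ _ _
    complete (suc (suc zero)) W = NS.solve 8 (λ a b c d w x y z →
      a NS.:* w NS.:+ b NS.:* x NS.:+ NS.con 0 NS.:* y NS.:+ d NS.:* z NS.:+ c NS.:* y NS.:=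
      a NS.:* w NS.:+ b NS.:* x NS.:+ c NS.:* y NS.:+ d NS.:* z) ≈-refl r₀ r₁ r₂ r₃ _ _ _ _
    complete (suc (suc (suc zero))) W = NS.solve 8 (λ a b c d w x y z →
      a NS.:* w NS.:+ b NS.:* x NS.:+ c NS.:* y NS.:+ NS.con 0 NS.:* z NS.:+ d NS.:* z NS.:=
      a NS.:* w NS.:+ b NS.:* x NS.:+ c NS.:* y NS.:+ d NS.:* z) ≈-refl r₀ r₁ r₂ r₃ _ _ _ _

  e₁ e₂ e₃ e₄ : Carrier
  e₁ = r₀ + r₁ + r₂ + r₃
  e₂ = r₀ * r₁ + r₀ * r₂ + r₀ * r₃ + r₁ * r₂ + r₁ * r₃ + r₂ * r₃
  e₃ = r₀ * r₁ * r₂ + r₀ * r₁ * r₃ + r₀ * r₂ * r₃ + r₁ * r₂ * r₃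
  e₄ = r₀ * r₁ * r₂ * r₃

  -- On the left stand the power sums p₁ A - p₂ B + p₃ C and the sum of the -r⁴ w. Newton's
  -- identities rewrite the former, and r⁴ = e₁ r³ - e₂ r² + e₃ r - e₄ the latter. All that is to
  -- vanish is collected behind the factors `e₁` and `e₂`.
  nested-power-sums : ∀ w₀ w₁ w₂ w₃ A B C →
      r₀ * (A - r₀ * (B - r₀ * (C - r₀ * w₀))) + r₁ * (A - r₁ * (B - r₁ * (C - r₁ * w₁)))
    + r₂ * (A - r₂ * (B - r₂ * (C - r₂ * w₂))) + r₃ * (A - r₃ * (B - r₃ * (C - r₃ * w₃))) ≈
      ι (+ 3) * e₃ * C - e₃ * (r₀ * w₀ + r₁ * w₁ + r₂ * w₂ + r₃ * w₃) + e₄ * (w₀ + w₁ + w₂ + w₃)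
    + e₁ * (A - e₁ * B + (e₁ * e₁ - ι (+ 3) * e₂) * C - (r₀ * r₀ * r₀ * w₀ + r₁ * r₁ * r₁ * w₁ + r₂ * r₂ * r₂ * w₂ + r₃ * r₃ * r₃ * w₃))
    + e₂ * (ι (+ 2) * B + (r₀ * r₀ * w₀ + r₁ * r₁ * w₁ + r₂ * r₂ * w₂ + r₃ * r₃ * w₃))
  nested-power-sums w₀ w₁ w₂ w₃ A B C = solve 11 (λ r₀ r₁ r₂ r₃ w₀ w₁ w₂ w₃ A B C →
      let e₁ = r₀ :+ r₁ :+ r₂ :+ r₃
          e₂ = r₀ :* r₁ :+ r₀ :* r₂ :+ r₀ :* r₃ :+ r₁ :* r₂ :+ r₁ :* r₃ :+ r₂ :* r₃
          e₃ = r₀ :* r₁ :* r₂ :+ r₀ :* r₁ :* r₃ :+ r₀ :* r₂ :* r₃ :+ r₁ :* r₂ :* r₃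
          e₄ = r₀ :* r₁ :* r₂ :* r₃
      in
      r₀ :* (A :- r₀ :* (B :- r₀ :* (C :- r₀ :* w₀))) :+ r₁ :* (A :- r₁ :* (B :- r₁ :* (C :- r₁ :* w₁)))
    :+ r₂ :* (A :- r₂ :* (B :- r₂ :* (C :- r₂ :* w₂))) :+ r₃ :* (A :- r₃ :* (B :- r₃ :* (C :- r₃ :* w₃))) :=
      con (+ 3) :* e₃ :* C :- e₃ :* (r₀ :* w₀ :+ r₁ :* w₁ :+ r₂ :* w₂ :+ r₃ :* w₃) :+ e₄ :* (w₀ :+ w₁ :+ w₂ :+ w₃)
    :+ e₁ :* (A :- e₁ :* B :+ (e₁ :* e₁ :- con (+ 3) :* e₂) :* C :- (r₀ :* r₀ :* r₀ :* w₀ :+ r₁ :* r₁ :* r₁ :* w₁ :+ r₂ :* r₂ :* r₂ :* w₂ :+ r₃ :* r₃ :* r₃ :* w₃))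
    :+ e₂ :* (con (+ 2) :* B :+ (r₀ :* r₀ :* w₀ :+ r₁ :* r₁ :* w₁ :+ r₂ :* r₂ :* w₂ :+ r₃ :* r₃ :* w₃)))
    ≈-refl r₀ r₁ r₂ r₃ w₀ w₁ w₂ w₃ A B C

  path-+4-unreduced : ∀ l → path (4 ℕ.+ l) ≈
      ι (+ 3) * e₃ * path (1 ℕ.+ l) - e₃ * path (1 ℕ.+ l) + e₄ * Σ₄ (legSum l)
    + e₁ * (path (3 ℕ.+ l) - e₁ * path (2 ℕ.+ l) + (e₁ * e₁ - ι (+ 3) * e₂) * path (1 ℕ.+ l)
             - Σ₄ (λ c → r c * r c * r c * legSum l c))
    + e₂ * (ι (+ 2) * path (2 ℕ.+ l) + Σ₄ (λ c → r c * r c * legSum l c))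
  path-+4-unreduced l = ≈-trans (Σ₄-cong λ c → *-congˡ {r c} (unroll c)) (nested-power-sums _ _ _ _ _ _ _)
    where
    unroll : ∀ c → legSum (3 ℕ.+ l) c ≈ path (3 ℕ.+ l) - r c * (path (2 ℕ.+ l) - r c * (path (1 ℕ.+ l) - r c * legSum l c))
    unroll c = ≈-trans (legSum-recurrence (2 ℕ.+ l) c) (+-congˡ (-‿cong (*-congˡ
      (≈-trans (legSum-recurrence (1 ℕ.+ l) c) (+-congˡ (-‿cong (*-congˡ (legSum-recurrence l c))))))))

  -- By `legSum-recurrence` both sides equal `path (suc a) * path (suc b)` minus the sum of
  -- `r c * r c * legSum a c * legSum b c`, which is symmetric in the two legs.
  shift-leg : ∀ a b → Σ₄ (λ c → r c * (legSum a c * legSum (suc b) c)) ≈ Σ₄ (λ c → r c * (legSum (suc a) c * legSum b c))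
  shift-leg a b = begin
    Σ₄ (λ c → r c * (legSum a c * legSum (suc b) c))
      ≈⟨ Σ₄-cong (λ c → *-congˡ {r c} (*-congˡ {legSum a c} (legSum-recurrence b c))) ⟩
    Σ₄ (λ c → r c * (legSum a c * (path (suc b) - r c * legSum b c)))
      ≈⟨ swap r₀ r₁ r₂ r₃ _ _ _ _ _ _ _ _ ⟩
    Σ₄ (λ c → r c * ((path (suc a) - r c * legSum a c) * legSum b c))
      ≈⟨ Σ₄-cong (λ c → *-congˡ {r c} (*-congʳ {legSum b c} (≈-sym (legSum-recurrence a c)))) ⟩
    Σ₄ (λ c → r c * (legSum (suc a) c * legSum b c)) ∎
    where
    swap : ∀ r₀ r₁ r₂ r₃ w₀ w₁ w₂ w₃ x₀ x₁ x₂ x₃ →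
      let P = r₀ * w₀ + r₁ * w₁ + r₂ * w₂ + r₃ * w₃
          Q = r₀ * x₀ + r₁ * x₁ + r₂ * x₂ + r₃ * x₃
      in r₀ * (w₀ * (Q - r₀ * x₀)) + r₁ * (w₁ * (Q - r₁ * x₁)) + r₂ * (w₂ * (Q - r₂ * x₂)) + r₃ * (w₃ * (Q - r₃ * x₃)) ≈
         r₀ * ((P - r₀ * w₀) * x₀) + r₁ * ((P - r₁ * w₁) * x₁) + r₂ * ((P - r₂ * w₂) * x₂) + r₃ * ((P - r₃ * w₃) * x₃)
    swap = solve 12 (λ r₀ r₁ r₂ r₃ w₀ w₁ w₂ w₃ x₀ x₁ x₂ x₃ →
      let P = r₀ :* w₀ :+ r₁ :* w₁ :+ r₂ :* w₂ :+ r₃ :* w₃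
          Q = r₀ :* x₀ :+ r₁ :* x₁ :+ r₂ :* x₂ :+ r₃ :* x₃
      in r₀ :* (w₀ :* (Q :- r₀ :* x₀)) :+ r₁ :* (w₁ :* (Q :- r₁ :* x₁)) :+ r₂ :* (w₂ :* (Q :- r₂ :* x₂)) :+ r₃ :* (w₃ :* (Q :- r₃ :* x₃)) :=
         r₀ :* ((P :- r₀ :* w₀) :* x₀) :+ r₁ :* ((P :- r₁ :* w₁) :* x₁) :+ r₂ :* ((P :- r₂ :* w₂) :* x₂) :+ r₃ :* ((P :- r₃ :* w₃) :* x₃))
      ≈-refl

  -- Two legs at a common centre form a path. Moving vertices from one leg to the other by
  -- `shift-leg` until it is empty proves this by algebra, without renumbering the vertices of the
  -- colourings.
  two-legs : ∀ a b → Σ₄ (λ c → r c * (legSum a c * legSum b c)) ≈ path (suc (a ℕ.+ b))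
  two-legs a zero    = ≈-trans (Σ₄-cong λ c → *-congˡ {r c} (≈-trans (*-congˡ (legSum-zero c)) (*-identityʳ (legSum a c))))
    (reflexive (cong (λ n → path (suc n)) (sym (ℕₚ.+-identityʳ a))))
  two-legs a (suc b) = ≈-trans (shift-leg a b) (≈-trans (two-legs (suc a) b)
    (reflexive (cong (λ n → path (suc n)) (sym (ℕₚ.+-suc a b)))))

  path-1 : path 1 ≈ e₁
  path-1 = Σ₄-cong λ c → ≈-trans (*-congˡ (legSum-zero c)) (*-identityʳ (r c))

  module _ (e₁≈0 : e₁ ≈ 0#) (e₂≈0 : e₂ ≈ 0#) (e₃≈1 : e₃ ≈ 1#) where

    path-1≈0 : path 1 ≈ 0#
    path-1≈0 = ≈-trans path-1 e₁≈0

    legSum-1 : ∀ c → legSum 1 c ≈ - r c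
    legSum-1 c = ≈-trans (legSum-recurrence 0 c) (≈-trans (+-cong path-1≈0 (-‿cong (≈-trans (*-congˡ (legSum-zero c)) (*-identityʳ _))))
      (+-identityˡ _))

    path-2≈0 : path 2 ≈ 0#
    path-2≈0 = begin
      path 2                   ≈⟨ Σ₄-cong (λ c → *-congˡ {r c} (legSum-1 c)) ⟩
      Σ₄ (λ c → r c * - r c)
        ≈⟨ solve 4 (λ r₀ r₁ r₂ r₃ →
             let e₁ = r₀ :+ r₁ :+ r₂ :+ r₃
                 e₂ = r₀ :* r₁ :+ r₀ :* r₂ :+ r₀ :* r₃ :+ r₁ :* r₂ :+ r₁ :* r₃ :+ r₂ :* r₃
             in r₀ :* :- r₀ :+ r₁ :* :- r₁ :+ r₂ :* :- r₂ :+ r₃ :* :- r₃ := :- e₁ :* e₁ :+ con (+ 2) :* e₂) ≈-refl r₀ r₁ r₂ r₃ ⟩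
      - e₁ * e₁ + ι (+ 2) * e₂ ≈⟨ +-cong (≈-trans (*-congˡ e₁≈0) (zeroʳ _)) (≈-trans (*-congˡ e₂≈0) (zeroʳ _)) ⟩
      0# + 0#                  ≈⟨ +-identityˡ 0# ⟩
      0#                       ∎

    legSum-2 : ∀ c → legSum 2 c ≈ r c * r c
    legSum-2 c = begin
      legSum 2 c                 ≈⟨ legSum-recurrence 1 c ⟩
      path 2 - r c * legSum 1 c  ≈⟨ +-cong path-2≈0 (-‿cong (*-congˡ (legSum-1 c))) ⟩
      0# - r c * - r c           ≈⟨ +-identityˡ _ ⟩
      - (r c * - r c)            ≈⟨ solve 1 (λ x → :- (x :* :- x) := x :* x) ≈-refl (r c) ⟩
      r c * r c                  ∎

    path-3 : path 3 ≈ ι (+ 3)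
    path-3 = begin
      path 3 ≈⟨ Σ₄-cong (λ c → *-congˡ {r c} (legSum-2 c)) ⟩
      Σ₄ (λ c → r c * (r c * r c))
        ≈⟨ solve 4 (λ r₀ r₁ r₂ r₃ →
             let e₁ = r₀ :+ r₁ :+ r₂ :+ r₃
                 e₂ = r₀ :* r₁ :+ r₀ :* r₂ :+ r₀ :* r₃ :+ r₁ :* r₂ :+ r₁ :* r₃ :+ r₂ :* r₃
                 e₃ = r₀ :* r₁ :* r₂ :+ r₀ :* r₁ :* r₃ :+ r₀ :* r₂ :* r₃ :+ r₁ :* r₂ :* r₃
             in r₀ :* (r₀ :* r₀) :+ r₁ :* (r₁ :* r₁) :+ r₂ :* (r₂ :* r₂) :+ r₃ :* (r₃ :* r₃) :=
                con (+ 3) :* e₃ :+ (e₁ :* e₁ :- con (+ 3) :* e₂) :* e₁) ≈-refl r₀ r₁ r₂ r₃ ⟩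
      ι (+ 3) * e₃ + (e₁ * e₁ - ι (+ 3) * e₂) * e₁ ≈⟨ +-cong (*-congˡ e₃≈1) (≈-trans (*-congˡ e₁≈0) (zeroʳ _)) ⟩
      ι (+ 3) * 1# + 0#                            ≈⟨ ≈-trans (+-identityʳ _) (*-identityʳ _) ⟩
      ι (+ 3)                                      ∎

    path-+4 : ∀ l → path (4 ℕ.+ l) ≈ ι (+ 2) * path (1 ℕ.+ l) + e₄ * Σ₄ (legSum l)
    path-+4 l = begin
      path (4 ℕ.+ l) ≈⟨ path-+4-unreduced l ⟩
      ι (+ 3) * e₃ * path (1 ℕ.+ l) - e₃ * path (1 ℕ.+ l) + e₄ * Σ₄ (legSum l) + e₁ * _ + e₂ * _
        ≈⟨ +-cong (+-cong (+-congʳ (+-cong (*-congʳ (*-congˡ e₃≈1)) (-‿cong (*-congʳ e₃≈1))))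
             (≈-trans (*-congʳ e₁≈0) (zeroˡ _))) (≈-trans (*-congʳ e₂≈0) (zeroˡ _)) ⟩
      ι (+ 3) * 1# * path (1 ℕ.+ l) - 1# * path (1 ℕ.+ l) + e₄ * Σ₄ (legSum l) + 0# + 0#
        ≈⟨ ≈-trans (+-identityʳ _) (≈-trans (+-identityʳ _) (+-congʳ (+-cong (*-congʳ (*-identityʳ _)) (-‿cong (*-identityˡ _))))) ⟩
      ι (+ 3) * path (1 ℕ.+ l) - path (1 ℕ.+ l) + e₄ * Σ₄ (legSum l)
        ≈⟨ solve 2 (λ P x → con (+ 3) :* P :- P :+ x := con (+ 2) :* P :+ x) ≈-refl _ _ ⟩
      ι (+ 2) * path (1 ℕ.+ l) + e₄ * Σ₄ (legSum l) ∎

    path-4 : path 4 ≈ ι (+ 4) * e₄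
    path-4 = begin
      path 4 ≈⟨ path-+4 0 ⟩
      ι (+ 2) * path 1 + e₄ * Σ₄ (legSum 0)
        ≈⟨ +-cong (≈-trans (*-congˡ path-1≈0) (zeroʳ _)) (*-congˡ (Σ₄-cong λ c → ≈-trans (legSum-zero c) (≈-sym 1-homo))) ⟩
      0# + e₄ * (ι (+ 1) + ι (+ 1) + ι (+ 1) + ι (+ 1))  ≈⟨ +-identityˡ _ ⟩
      e₄ * (ι (+ 1) + ι (+ 1) + ι (+ 1) + ι (+ 1))
        ≈⟨ solve 1 (λ x → x :* (con (+ 1) :+ con (+ 1) :+ con (+ 1) :+ con (+ 1)) := con (+ 4) :* x) ≈-refl e₄ ⟩
      ι (+ 4) * e₄ ∎

    -- The sum of the leg sums left over in `path-+4` is by `legSum-recurrence` four copies of a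
    -- path minus one, whence the 3. This closes the recurrence on paths; it starts at 5 vertices,
    -- so `path-4` is computed separately.
    path-+5 : ∀ l → path (5 ℕ.+ l) ≈ ι (+ 2) * path (2 ℕ.+ l) + ι (+ 3) * e₄ * path (1 ℕ.+ l)
    path-+5 l = ≈-trans (path-+4 (suc l)) (+-congˡ (≈-trans (*-congˡ (Σ₄-cong (legSum-recurrence l)))
      (collect r₀ r₁ r₂ r₃ _ _ _ _ e₄)))
      where
      collect : ∀ r₀ r₁ r₂ r₃ w₀ w₁ w₂ w₃ e →
        let P = r₀ * w₀ + r₁ * w₁ + r₂ * w₂ + r₃ * w₃ in
        e * ((P - r₀ * w₀) + (P - r₁ * w₁) + (P - r₂ * w₂) + (P - r₃ * w₃)) ≈ ι (+ 3) * e * P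
      collect = solve 9 (λ r₀ r₁ r₂ r₃ w₀ w₁ w₂ w₃ e →
        let P = r₀ :* w₀ :+ r₁ :* w₁ :+ r₂ :* w₂ :+ r₃ :* w₃ in
        e :* ((P :- r₀ :* w₀) :+ (P :- r₁ :* w₁) :+ (P :- r₂ :* w₂) :+ (P :- r₃ :* w₃)) := con (+ 3) :* e :* P) ≈-refl

    -- Because `legSum 2 c` is the square of `r c`, each long leg can absorb one factor `r c`, and
    -- the recurrence turns this into a path minus a longer leg. Expanding leaves two legs forming a
    -- path, the two mixed products, and a multiple of `e₁`.
    ev-X-spider-2 : ∀ a b → ev rs (suc (sum (a ∷ b ∷ 2 ∷ []))) (X (spider (a ∷ b ∷ 2 ∷ [])) 4) ≈
      path (3 ℕ.+ (a ℕ.+ b)) - path (1 ℕ.+ a) * path (2 ℕ.+ b) - path (2 ℕ.+ a) * path (1 ℕ.+ b)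
    ev-X-spider-2 a b = begin
      ev rs (suc (sum (a ∷ b ∷ 2 ∷ []))) (X (spider (a ∷ b ∷ 2 ∷ [])) 4)
        ≈⟨ ≈-trans (ev-X-spider a b 2) (Σ₄-allFin λ c → r c * (legSum a c * (legSum b c * legSum 2 c))) ⟩
      Σ₄ (λ c → r c * (legSum a c * (legSum b c * legSum 2 c)))
        ≈⟨ Σ₄-cong (λ c → ≈-trans (*-congˡ (*-congˡ (*-congˡ (legSum-2 c))))
             (solve 3 (λ x A B → x :* (A :* (B :* (x :* x))) := x :* ((x :* A) :* (x :* B))) ≈-refl (r c) (legSum a c) (legSum b c))) ⟩
      Σ₄ (λ c → r c * ((r c * legSum a c) * (r c * legSum b c)))
        ≈⟨ Σ₄-cong (λ c → *-congˡ {r c} (*-cong (solved a c) (solved b c))) ⟩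
      Σ₄ (λ c → r c * ((path (1 ℕ.+ a) - legSum (1 ℕ.+ a) c) * (path (1 ℕ.+ b) - legSum (1 ℕ.+ b) c)))
        ≈⟨ expand r₀ r₁ r₂ r₃ _ _ _ _ _ _ _ _ _ _ ⟩
      Σ₄ (λ c → r c * (legSum (1 ℕ.+ a) c * legSum (1 ℕ.+ b) c)) - path (1 ℕ.+ a) * path (2 ℕ.+ b)
        - path (2 ℕ.+ a) * path (1 ℕ.+ b) + e₁ * (path (1 ℕ.+ a) * path (1 ℕ.+ b))
        ≈⟨ +-cong (+-congʳ (+-congʳ (≈-trans (two-legs (1 ℕ.+ a) (1 ℕ.+ b))
             (reflexive (cong (λ n → path (2 ℕ.+ n)) (ℕₚ.+-suc a b))))))
             (≈-trans (*-congʳ e₁≈0) (zeroˡ _)) ⟩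
      path (3 ℕ.+ (a ℕ.+ b)) - path (1 ℕ.+ a) * path (2 ℕ.+ b) - path (2 ℕ.+ a) * path (1 ℕ.+ b) + 0#
        ≈⟨ +-identityʳ _ ⟩
      path (3 ℕ.+ (a ℕ.+ b)) - path (1 ℕ.+ a) * path (2 ℕ.+ b) - path (2 ℕ.+ a) * path (1 ℕ.+ b) ∎
      where
      solved : ∀ l c → r c * legSum l c ≈ path (suc l) - legSum (suc l) c
      solved l c = ≈-trans (solve 2 (λ P x → x := P :- (P :- x)) ≈-refl (path (suc l)) (r c * legSum l c))
        (+-congˡ (-‿cong (≈-sym (legSum-recurrence l c))))

      expand : ∀ r₀ r₁ r₂ r₃ w₀ w₁ w₂ w₃ x₀ x₁ x₂ x₃ P Q →
        r₀ * ((P - w₀) * (Q - x₀)) + r₁ * ((P - w₁) * (Q - x₁)) + r₂ * ((P - w₂) * (Q - x₂)) + r₃ * ((P - w₃) * (Q - x₃)) ≈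
        r₀ * (w₀ * x₀) + r₁ * (w₁ * x₁) + r₂ * (w₂ * x₂) + r₃ * (w₃ * x₃)
          - P * (r₀ * x₀ + r₁ * x₁ + r₂ * x₂ + r₃ * x₃) - (r₀ * w₀ + r₁ * w₁ + r₂ * w₂ + r₃ * w₃) * Q
          + (r₀ + r₁ + r₂ + r₃) * (P * Q)
      expand = solve 14 (λ r₀ r₁ r₂ r₃ w₀ w₁ w₂ w₃ x₀ x₁ x₂ x₃ P Q →
        r₀ :* ((P :- w₀) :* (Q :- x₀)) :+ r₁ :* ((P :- w₁) :* (Q :- x₁)) :+ r₂ :* ((P :- w₂) :* (Q :- x₂)) :+ r₃ :* ((P :- w₃) :* (Q :- x₃)) :=
        r₀ :* (w₀ :* x₀) :+ r₁ :* (w₁ :* x₁) :+ r₂ :* (w₂ :* x₂) :+ r₃ :* (w₃ :* x₃)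
          :- P :* (r₀ :* x₀ :+ r₁ :* x₁ :+ r₂ :* x₂ :+ r₃ :* x₃) :- (r₀ :* w₀ :+ r₁ :* w₁ :+ r₂ :* w₂ :+ r₃ :* w₃) :* Q
          :+ (r₀ :+ r₁ :+ r₂ :+ r₃) :* (P :* Q)) ≈-refl

  elementary-rs : ∀ {P : Carrier → Set} → IsPositiveCone P → P e₁ → P e₂ → P e₃ → P e₄ → ∀ k → P (elementary rs k)
  elementary-rs cone p₁ p₂ p₃ p₄ = λ
    { 0 → 1-closed
    ; 1 → resp (NS.solve 4 (λ a b c d →
        a NS.:+ b NS.:+ c NS.:+ d NS.:= elementaryₚ (a ∷ b ∷ c ∷ d ∷ []) 1) ≈-refl r₀ r₁ r₂ r₃) p₁
    ; 2 → resp (NS.solve 4 (λ a b c d →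
        a NS.:* b NS.:+ a NS.:* c NS.:+ a NS.:* d NS.:+ b NS.:* c NS.:+ b NS.:* d NS.:+ c NS.:* d
          NS.:= elementaryₚ (a ∷ b ∷ c ∷ d ∷ []) 2) ≈-refl r₀ r₁ r₂ r₃) p₂
    ; 3 → resp (NS.solve 4 (λ a b c d →
        a NS.:* b NS.:* c NS.:+ a NS.:* b NS.:* d NS.:+ a NS.:* c NS.:* d NS.:+ b NS.:* c NS.:* d
          NS.:= elementaryₚ (a ∷ b ∷ c ∷ d ∷ []) 3) ≈-refl r₀ r₁ r₂ r₃) p₃
    ; 4 → resp (NS.solve 4 (λ a b c d →
        a NS.:* b NS.:* c NS.:* d NS.:= elementaryₚ (a ∷ b ∷ c ∷ d ∷ []) 4) ≈-refl r₀ r₁ r₂ r₃) p₄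
    ; (suc (suc (suc (suc (suc k))))) → resp (NS.solve 4 (λ a b c d →
        NS.con 0 NS.:= elementaryₚ (a ∷ b ∷ c ∷ d ∷ []) (5 ℕ.+ k)) ≈-refl r₀ r₁ r₂ r₃) 0-closed
    }
    where
    open IsPositiveCone cone
    -- A syntactic copy of `elementary` for the solver; on four variables it unfolds to an
    -- expression equal to 0 even when k ≥ 5 is symbolic.
    elementaryₚ : ∀ {n N} → Vec (NS.Polynomial n) N → ℕ → NS.Polynomial n
    elementaryₚ []       zero    = NS.con 1
    elementaryₚ []       (suc k) = NS.con 0
    elementaryₚ (r ∷ rs) zero    = NS.con 1
    elementaryₚ (r ∷ rs) (suc k) = elementaryₚ rs (suc k) NS.:+ r NS.:* elementaryₚ rs k

-- Coefficients of paths

-- If g and h are two roots of T⁴ − e₃ T + e₄, the other two are the roots of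
-- T² − p T − q for the p and q below, whatever g and h are.
module FourRoots (A : CommutativeRing 0ℓ 0ℓ) (φ : ℤ⟶ A) (g h : CommutativeRing.Carrier A) where
  open CommutativeRing A hiding (zero) renaming (refl to ≈-refl; sym to ≈-sym; trans to ≈-trans)
  open Evaluation A φ using (ι; 0-homo; 1-homo; solve; _:=_; _:+_; _:*_; _:-_; :-_; con; Polynomial)

  -- Forced by e₁ = e₂ = 0: p is the sum of the two missing roots and - q their product. These roots
  -- are then τ and p - τ.
  p q : Carrier
  p = - (g + h)
  q = g * h - (g + h) * (g + h)

  open Quadratic A p q
  module Q = CommutativeRing quadraticRing

  embed : Carrier → Q.Carrier
  embed f = f , 0#

  embed-* : ∀ x y → embed x Q.* embed y Q.≈ embed (x * y)
  embed-* x y =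
    NatSolver.solve commutativeSemiring 3 (λ q x y → x N.:* y N.:+ q N.:* (N.con 0 N.:* N.con 0) N.:= x N.:* y) ≈-refl q x y ,
    NatSolver.solve commutativeSemiring 3 (λ p x y → x N.:* N.con 0 N.:+ N.con 0 N.:* y N.:+ p N.:* (N.con 0 N.:* N.con 0) N.:= N.con 0) ≈-refl p x y
    where module N = NatSolver commutativeSemiring

  open Evaluation quadraticRing (embed-homo φ) using (elementary; IsPositiveCone; ev-EPositive-closed) public
  open FourVariables quadraticRing (embed-homo φ) (g , ι 0ℤ) (h , ι 0ℤ) (ι 0ℤ , ι 1ℤ) (p , ι -1ℤ) public

  private
    Pair : Set
    Pair = Polynomial 2 × Polynomial 2

    -- The arithmetic of the extension on pairs of solver polynomials, so that an identity in the
    -- extension becomes two identities over `A`.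
    module Symbolic (g h : Polynomial 2) where
      infixl 6 _⊕_
      infixl 7 _⊗_
      pₚ qₚ : Polynomial 2
      pₚ = :- (g :+ h)
      qₚ = g :* h :- (g :+ h) :* (g :+ h)
      _⊕_ _⊗_ : Pair → Pair → Pair
      (a , b) ⊕ (c , d) = a :+ c , b :+ d
      (a , b) ⊗ (c , d) = a :* c :+ qₚ :* (b :* d) , a :* d :+ b :* c :+ pₚ :* (b :* d)
      r₀ r₁ r₂ r₃ E₁ E₂ E₃ E₄ : Pair
      r₀ = g , con 0ℤ
      r₁ = h , con 0ℤ
      r₂ = con 0ℤ , con 1ℤ
      r₃ = pₚ , con -1ℤ
      E₁ = r₀ ⊕ r₁ ⊕ r₂ ⊕ r₃
      E₂ = r₀ ⊗ r₁ ⊕ r₀ ⊗ r₂ ⊕ r₀ ⊗ r₃ ⊕ r₁ ⊗ r₂ ⊕ r₁ ⊗ r₃ ⊕ r₂ ⊗ r₃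
      E₃ = r₀ ⊗ r₁ ⊗ r₂ ⊕ r₀ ⊗ r₁ ⊗ r₃ ⊕ r₀ ⊗ r₂ ⊗ r₃ ⊕ r₁ ⊗ r₂ ⊗ r₃
      E₄ = r₀ ⊗ r₁ ⊗ r₂ ⊗ r₃

  e₁≈0 : e₁ Q.≈ Q.0#
  e₁≈0 = ≈-trans (solve 2 (λ g h → proj₁ (Symbolic.E₁ g h) := con 0ℤ) ≈-refl g h) 0-homo ,
         ≈-trans (solve 2 (λ g h → proj₂ (Symbolic.E₁ g h) := con 0ℤ) ≈-refl g h) 0-homo

  e₂≈0 : e₂ Q.≈ Q.0#
  e₂≈0 = ≈-trans (solve 2 (λ g h → proj₁ (Symbolic.E₂ g h) := con 0ℤ) ≈-refl g h) 0-homo ,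
         ≈-trans (solve 2 (λ g h → proj₂ (Symbolic.E₂ g h) := con 0ℤ) ≈-refl g h) 0-homo

  -- Together with `e₄≈` this reduces the requirements on the roots to two equations between g and h
  -- alone. For the concrete truncated series below, these are decided by evaluating seven
  -- coefficients.
  e₃≈ : e₃ Q.≈ embed ((g + h) * ((g + h) * (g + h) - (g * h + g * h)))
  e₃≈ = solve 2 (λ g h → proj₁ (Symbolic.E₃ g h) := (g :+ h) :* ((g :+ h) :* (g :+ h) :- (g :* h :+ g :* h))) ≈-refl g h ,
        ≈-trans (solve 2 (λ g h → proj₂ (Symbolic.E₃ g h) := con 0ℤ) ≈-refl g h) 0-homo

  e₄≈ : e₄ Q.≈ embed (g * h * ((g + h) * (g + h) - g * h))
  e₄≈ = solve 2 (λ g h → proj₁ (Symbolic.E₄ g h) := g :* h :* ((g :+ h) :* (g :+ h) :- g :* h)) ≈-refl g h ,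
        ≈-trans (solve 2 (λ g h → proj₂ (Symbolic.E₄ g h) := con 0ℤ) ≈-refl g h) 0-homo

module PathCoefficients where
  fromList : List ℤ → Series
  fromList []       _       = 0ℤ
  fromList (c ∷ cs) zero    = c
  fromList (c ∷ cs) (suc k) = fromList cs k

  -- The roots of T⁴ − T + 9σ that reduce to 1 and 0 modulo σ, up to σ⁶.  The
  -- factor 9 makes the first of them integral.
  root₁ root₀ : Series
  root₁ = fromList (+ 1 ∷ ℤ.- + 3 ∷ ℤ.- + 18 ∷ ℤ.- + 180 ∷ ℤ.- + 2187 ∷ ℤ.- + 29484 ∷ ℤ.- + 424116 ∷ [])
  root₀ = fromList (+ 0 ∷ + 9 ∷ + 0 ∷ + 0 ∷ + 6561 ∷ [])

  module A = CommutativeRing (seriesRing 6)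
  open FourRoots (seriesRing 6) (const-homo 6) root₁ root₀

  upTo6 : ∀ {P : ℕ → Set} → P 0 → P 1 → P 2 → P 3 → P 4 → P 5 → P 6 → ∀ k → k ℕ.≤ 6 → P k
  upTo6 p₀ p₁ p₂ p₃ p₄ p₅ p₆ 0 _ = p₀
  upTo6 p₀ p₁ p₂ p₃ p₄ p₅ p₆ 1 _ = p₁
  upTo6 p₀ p₁ p₂ p₃ p₄ p₅ p₆ 2 _ = p₂
  upTo6 p₀ p₁ p₂ p₃ p₄ p₅ p₆ 3 _ = p₃
  upTo6 p₀ p₁ p₂ p₃ p₄ p₅ p₆ 4 _ = p₄
  upTo6 p₀ p₁ p₂ p₃ p₄ p₅ p₆ 5 _ = p₅
  upTo6 p₀ p₁ p₂ p₃ p₄ p₅ p₆ 6 _ = p₆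
  upTo6 p₀ p₁ p₂ p₃ p₄ p₅ p₆ (suc (suc (suc (suc (suc (suc (suc k))))))) (s≤s (s≤s (s≤s (s≤s (s≤s (s≤s ()))))))

  _×σ : ℤ → Series
  (c ×σ) zero    = 0ℤ
  (c ×σ) (suc k) = const c k

  e₃≈1 : e₃ Q.≈ Q.1#
  e₃≈1 = Q.trans e₃≈ (upTo6 refl refl refl refl refl refl refl , A.refl)

  e₄≈9σ : e₄ Q.≈ embed ((+ 9) ×σ)
  e₄≈9σ = Q.trans e₄≈ (upTo6 refl refl refl refl refl refl refl , A.refl)

  -- 9ᵏ times the coefficient of e₃ˡ e₄ᵏ, 3 l + 4 k = m, in the chromatic
  -- symmetric function of the path with m vertices.
  pathCoeff : ℕ → ℕ → ℕ
  pathCoeff 0 zero    = 1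
  pathCoeff 3 zero    = 3
  pathCoeff 4 1       = 36
  pathCoeff (suc (suc (suc (suc (suc m))))) zero    = 2 ℕ.* pathCoeff (suc (suc m)) zero
  pathCoeff (suc (suc (suc (suc (suc m))))) (suc k) = 2 ℕ.* pathCoeff (suc (suc m)) (suc k) ℕ.+ 27 ℕ.* pathCoeff (suc m) k
  pathCoeff _ _ = 0

  toSeries : (ℕ → ℕ) → Series
  toSeries f k = + f k

  ×σ-· : ∀ c f k → ((c ×σ) · f) (suc k) ≡ c ℤ.* f k
  ×σ-· c f k = trans (ℤₚ.+-identityˡ _) (const-· k c f)

  -- The recursion of `pathCoeff` is `path-+5` read off at each power of σ, with 27σ = 3 · 9σ. In
  -- particular no path has a component at τ.
  path≈ : ∀ m → path m Q.≈ embed (toSeries (pathCoeff m))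
  path≈ 0 = upTo6 refl refl refl refl refl refl refl , A.refl
  path≈ 1 = Q.trans (path-1≈0 e₁≈0 e₂≈0 e₃≈1) (upTo6 refl refl refl refl refl refl refl , A.refl)
  path≈ 2 = Q.trans (path-2≈0 e₁≈0 e₂≈0 e₃≈1) (upTo6 refl refl refl refl refl refl refl , A.refl)
  path≈ 3 = Q.trans (path-3 e₁≈0 e₂≈0 e₃≈1) (upTo6 refl refl refl refl refl refl refl , A.refl)
  path≈ 4 = Q.trans (path-4 e₁≈0 e₂≈0 e₃≈1) (Q.trans (Q.*-congˡ {embed (const (+ 4))} e₄≈9σ) (Q.trans (embed-* (const (+ 4)) ((+ 9) ×σ))
    (upTo6 refl refl refl refl refl refl refl , A.refl)))
  path≈ (suc (suc (suc (suc (suc m))))) = begin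
    path (5 ℕ.+ m)
      ≈⟨ path-+5 e₁≈0 e₂≈0 e₃≈1 m ⟩
    embed (const (+ 2)) Q.* path (2 ℕ.+ m) Q.+ embed (const (+ 3)) Q.* e₄ Q.* path (1 ℕ.+ m)
      ≈⟨ Q.+-cong (Q.*-congˡ {embed (const (+ 2))} (path≈ (suc (suc m))))
                  (Q.*-cong (Q.*-congˡ {embed (const (+ 3))} e₄≈9σ) (path≈ (suc m))) ⟩
    embed (const (+ 2)) Q.* embed (toSeries (pathCoeff (2 ℕ.+ m)))
      Q.+ embed (const (+ 3)) Q.* embed ((+ 9) ×σ) Q.* embed (toSeries (pathCoeff (1 ℕ.+ m)))
      ≈⟨ Q.+-cong (embed-* (const (+ 2)) (toSeries (pathCoeff (2 ℕ.+ m))))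
                  (Q.trans (Q.*-congʳ {embed (toSeries (pathCoeff (1 ℕ.+ m)))} (embed-* (const (+ 3)) ((+ 9) ×σ)))
                           (embed-* (const (+ 3) · (+ 9) ×σ) (toSeries (pathCoeff (1 ℕ.+ m))))) ⟩
    embed (const (+ 2) · toSeries (pathCoeff (2 ℕ.+ m))) Q.+ embed ((const (+ 3) · (+ 9) ×σ) · toSeries (pathCoeff (1 ℕ.+ m)))
      ≈⟨ (λ k _ → coefficient k) , A.+-identityˡ A.0# ⟩
    embed (toSeries (pathCoeff (5 ℕ.+ m))) ∎
    where
    open import Relation.Binary.Reasoning.Setoid Q.setoid
    27σ : ∀ k → (const (+ 3) · (+ 9) ×σ) k ≡ ((+ 27) ×σ) k
    27σ zero          = refl
    27σ (suc zero)    = refl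
    27σ (suc (suc k)) = trans (const-· (suc (suc k)) (+ 3) ((+ 9) ×σ)) (ℤₚ.*-zeroʳ (+ 3))
    coefficient : ∀ k → (const (+ 2) · toSeries (pathCoeff (2 ℕ.+ m))) k
                    ℤ.+ ((const (+ 3) · (+ 9) ×σ) · toSeries (pathCoeff (1 ℕ.+ m))) k ≡ + pathCoeff (5 ℕ.+ m) k
    coefficient k = trans
      (cong₂ ℤ._+_ (trans (const-· k (+ 2) (toSeries (pathCoeff (2 ℕ.+ m)))) (sym (ℤₚ.pos-* 2 (pathCoeff (2 ℕ.+ m) k))))
        (·-cong k {g = toSeries (pathCoeff (1 ℕ.+ m))} (λ i _ → 27σ i) (λ _ _ → refl)))
      (shifted k)
      where
      shifted : ∀ k → + (2 ℕ.* pathCoeff (2 ℕ.+ m) k) ℤ.+ ((+ 27) ×σ · toSeries (pathCoeff (1 ℕ.+ m))) k ≡ + pathCoeff (5 ℕ.+ m) k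
      shifted zero    = ℤₚ.+-identityʳ _
      shifted (suc k) = trans
        (cong (λ z → + (2 ℕ.* pathCoeff (2 ℕ.+ m) (suc k)) ℤ.+ z)
          (trans (×σ-· (+ 27) (toSeries (pathCoeff (1 ℕ.+ m))) k) (sym (ℤₚ.pos-* 27 (pathCoeff (1 ℕ.+ m) k)))))
        (sym (ℤₚ.pos-+ (2 ℕ.* pathCoeff (2 ℕ.+ m) (suc k)) _))

  -- The component at τ has to vanish, and only the coefficients that equality in `seriesRing 6` can
  -- see are constrained.
  NonNegative : Q.Carrier → Set
  NonNegative x = ∃[ f ] x Q.≈ embed f × (∀ k → k ℕ.≤ 6 → 0ℤ ℤ.≤ f k)

  *-nonNegative : ∀ {i j} → 0ℤ ℤ.≤ i → 0ℤ ℤ.≤ j → 0ℤ ℤ.≤ i ℤ.* j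
  *-nonNegative {+ m} {+ n} _ _ = subst (0ℤ ℤ.≤_) (ℤₚ.pos-* m n) (ℤ.+≤+ z≤n)

  ·-nonNegative : ∀ k {f g} → (∀ i → i ℕ.≤ k → 0ℤ ℤ.≤ f i) → (∀ i → i ℕ.≤ k → 0ℤ ℤ.≤ g i) → 0ℤ ℤ.≤ (f · g) k
  ·-nonNegative zero    f≥0 g≥0 = *-nonNegative (f≥0 0 z≤n) (g≥0 0 z≤n)
  ·-nonNegative (suc k) f≥0 g≥0 = ℤₚ.+-mono-≤ (*-nonNegative (f≥0 0 z≤n) (g≥0 (suc k) ℕₚ.≤-refl))
    (·-nonNegative k (λ i i≤k → f≥0 (suc i) (s≤s i≤k)) (λ i i≤k → g≥0 i (ℕₚ.m≤n⇒m≤1+n i≤k)))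

  nonNegative-cone : IsPositiveCone NonNegative
  nonNegative-cone = record
    { resp = λ x≈y (f , x≈f , f≥0) → f , Q.trans (Q.sym x≈y) x≈f , f≥0
    ; +-closed = λ (f , x≈f , f≥0) (g , y≈g , g≥0) → f ⊹ g ,
        Q.trans (Q.+-cong x≈f y≈g) (A.refl , A.+-identityˡ A.0#) ,
        λ k k≤6 → ℤₚ.+-mono-≤ (f≥0 k k≤6) (g≥0 k k≤6)
    ; *-closed = λ (f , x≈f , f≥0) (g , y≈g , g≥0) → f · g ,
        Q.trans (Q.*-cong x≈f y≈g) (embed-* f g) ,
        λ k k≤6 → ·-nonNegative k (λ i i≤k → f≥0 i (ℕₚ.≤-trans i≤k k≤6)) (λ i i≤k → g≥0 i (ℕₚ.≤-trans i≤k k≤6))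
    ; ι-closed = λ {c} c≥0 → const c , Q.refl , λ { zero _ → c≥0 ; (suc k) _ → ℤ.+≤+ z≤n }
    }

  EPositive⇒coefficients : ∀ a b → EPositive (X (spider (a ∷ b ∷ 2 ∷ []))) → ∀ k → k ℕ.≤ 6 →
    (toSeries (pathCoeff (1 ℕ.+ a)) · toSeries (pathCoeff (2 ℕ.+ b))) k ℤ.+
    (toSeries (pathCoeff (2 ℕ.+ a)) · toSeries (pathCoeff (1 ℕ.+ b))) k ℤ.≤ + pathCoeff (3 ℕ.+ (a ℕ.+ b)) k
  EPositive⇒coefficients a b positive k k≤6 =
    let f , x≈f , f≥0 = IsPositiveCone.resp nonNegative-cone (ev-X-spider-2 e₁≈0 e₂≈0 e₃≈1 a b)
          (ev-EPositive-closed nonNegative-cone rs elementary-closed _ positive (suc (sum (a ∷ b ∷ 2 ∷ []))))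
    in difference k (subst (0ℤ ℤ.≤_) (proj₁ (Q.trans (Q.sym x≈f) expansion) k k≤6) (f≥0 k k≤6))
    where
    c = λ m → toSeries (pathCoeff m)

    elementary-closed : ∀ k → NonNegative (elementary rs k)
    elementary-closed = elementary-rs nonNegative-cone
      (IsPositiveCone.resp nonNegative-cone (Q.sym e₁≈0) (IsPositiveCone.0-closed nonNegative-cone))
      (IsPositiveCone.resp nonNegative-cone (Q.sym e₂≈0) (IsPositiveCone.0-closed nonNegative-cone))
      (IsPositiveCone.resp nonNegative-cone (Q.sym e₃≈1) (IsPositiveCone.1-closed nonNegative-cone))
      ((+ 9) ×σ , e₄≈9σ , λ { zero _ → ℤ.+≤+ z≤n ; (suc zero) _ → ℤ.+≤+ z≤n ; (suc (suc k)) _ → ℤ.+≤+ z≤n })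

    expansion : path (3 ℕ.+ (a ℕ.+ b)) Q.- path (1 ℕ.+ a) Q.* path (2 ℕ.+ b) Q.- path (2 ℕ.+ a) Q.* path (1 ℕ.+ b) Q.≈
                embed (c (3 ℕ.+ (a ℕ.+ b)) A.- c (1 ℕ.+ a) · c (2 ℕ.+ b) A.- c (2 ℕ.+ a) · c (1 ℕ.+ b))
    expansion = Q.trans
      (Q.+-cong (Q.+-cong (path≈ (3 ℕ.+ (a ℕ.+ b))) (Q.-‿cong (product (1 ℕ.+ a) (2 ℕ.+ b)))) (Q.-‿cong (product (2 ℕ.+ a) (1 ℕ.+ b))))
      (A.refl , upTo6 refl refl refl refl refl refl refl)
      where
      product : ∀ m n → path m Q.* path n Q.≈ embed (c m · c n)
      product m n = Q.trans (Q.*-cong (path≈ m) (path≈ n)) (embed-* (c m) (c n))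

    difference : ∀ k → 0ℤ ℤ.≤ c (3 ℕ.+ (a ℕ.+ b)) k ℤ.- (c (1 ℕ.+ a) · c (2 ℕ.+ b)) k ℤ.- (c (2 ℕ.+ a) · c (1 ℕ.+ b)) k →
      (c (1 ℕ.+ a) · c (2 ℕ.+ b)) k ℤ.+ (c (2 ℕ.+ a) · c (1 ℕ.+ b)) k ℤ.≤ c (3 ℕ.+ (a ℕ.+ b)) k
    difference k 0≤ = ℤₚ.0≤i-j⇒j≤i (subst (0ℤ ℤ.≤_) (rearrange (c (3 ℕ.+ (a ℕ.+ b)) k) ((c (1 ℕ.+ a) · c (2 ℕ.+ b)) k) ((c (2 ℕ.+ a) · c (1 ℕ.+ b)) k)) 0≤)
      where
      rearrange : ∀ x y z → x ℤ.- y ℤ.- z ≡ x ℤ.- (y ℤ.+ z)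
      rearrange = ℤ-Tactic.solve-∀

open PathCoefficients using (pathCoeff; toSeries; *-nonNegative; EPositive⇒coefficients)

-- Inequalities between coefficients

module CoefficientBounds where
  open import Data.Nat using (_+_; _*_; _^_; _≤_; _!; NonZero)

  -- pathCoeff (3 L + k) k is the coefficient of σᵏ in (3 + 36σ)(2 + 27σ)^(L−1);
  -- γ k (L − 1) is what remains of it, up to 6 · k! · 2ᵏ, without the powers of
  -- 2 and 27.
  γ : ℕ → ℕ → ℕ
  γ zero          l       = 9
  γ (suc zero)    zero    = 8
  γ (suc (suc k)) zero    = 0
  γ (suc k)       (suc l) = γ (suc k) l + suc k * γ k l

  -- The base case l = 0 of `pathCoeff-closed` runs below the lengths 3l + 4k at which nonzero
  -- coefficients occur; this weak bound suffices there.
  pathCoeff-vanish : ∀ m k → m ≤ suc k → pathCoeff m (suc k) ≡ 0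
  pathCoeff-vanish 0 k _ = refl
  pathCoeff-vanish 1 k _ = refl
  pathCoeff-vanish 2 k _ = refl
  pathCoeff-vanish 3 k _ = refl
  pathCoeff-vanish 4 zero (s≤s ())
  pathCoeff-vanish 4 (suc k) _ = refl
  pathCoeff-vanish (suc (suc (suc (suc (suc m))))) zero (s≤s ())
  pathCoeff-vanish (suc (suc (suc (suc (suc m))))) (suc k) (s≤s (s≤s p))
    rewrite pathCoeff-vanish (suc (suc m)) (suc k) (ℕₚ.≤-trans (ℕₚ.n≤1+n _) (ℕₚ.≤-trans p (ℕₚ.m≤n+m k 2)))
          | pathCoeff-vanish (suc m) k (ℕₚ.≤-trans (ℕₚ.m≤n+m (suc m) 2) (ℕₚ.≤-trans p (ℕₚ.n≤1+n k))) = refl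

  -- The coefficient is 3 C(l,k) 2ˡ⁻ᵏ 27ᵏ + 36 C(l,k-1) 2ˡ⁻ᵏ⁺¹ 27ᵏ⁻¹. The factor k! 2ᵏ clears the
  -- binomials and the powers of 2 that depend on k, and 6 makes the remaining factors 3 · 6 / 2 = 9
  -- and 36 · 6 / 27 = 8 integral.
  pathCoeff-closed : ∀ k l → 6 * (k ! * 2 ^ k) * pathCoeff (suc l * 3 + k) k ≡ 2 ^ suc l * 27 ^ k * γ k l
  pathCoeff-closed zero          zero    = refl
  pathCoeff-closed (suc zero)    zero    = refl
  pathCoeff-closed (suc (suc k)) zero
    rewrite pathCoeff-vanish (suc (suc k)) (suc k) ℕₚ.≤-refl | pathCoeff-vanish (suc k) k ℕₚ.≤-refl
    = trans (ℕₚ.*-zeroʳ (6 * (suc (suc k) ! * 2 ^ suc (suc k)))) (sym (ℕₚ.*-zeroʳ (2 ^ 1 * 27 ^ suc (suc k))))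
  pathCoeff-closed zero (suc l) = begin
    6 * 1 * (2 * pathCoeff (suc l * 3 + 0) 0)   ≡⟨ double (pathCoeff (suc l * 3 + 0) 0) ⟩
    2 * (6 * 1 * pathCoeff (suc l * 3 + 0) 0)   ≡⟨ cong (2 *_) (pathCoeff-closed zero l) ⟩
    2 * (2 ^ suc l * 1 * 9)                     ≡⟨ assoc (2 ^ suc l) ⟩
    2 ^ suc (suc l) * 1 * 9                     ∎
    where
    open ≡.≡-Reasoning
    double : ∀ c → 6 * 1 * (2 * c) ≡ 2 * (6 * 1 * c)
    double = ℕ-Tactic.solve-∀
    assoc : ∀ t → 2 * (t * 1 * 9) ≡ 2 * t * 1 * 9
    assoc = ℕ-Tactic.solve-∀
  pathCoeff-closed (suc k) (suc l) rewrite ℕₚ.+-suc (l * 3) k = begin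
    6 * ((suc k) ! * 2 ^ suc k) * (2 * c₁ + 27 * c₀)
      ≡⟨ split k (k !) (2 ^ k) c₁ c₀ ⟩
    2 * (6 * ((suc k) ! * 2 ^ suc k) * c₁) + 54 * suc k * (6 * (k ! * 2 ^ k) * c₀)
      ≡⟨ cong₂ (λ x y → 2 * x + 54 * suc k * y)
           (subst (λ m → 6 * ((suc k) ! * 2 ^ suc k) * pathCoeff (3 + m) (suc k) ≡ 2 ^ suc l * 27 ^ suc k * γ (suc k) l)
             (ℕₚ.+-suc (l * 3) k) (pathCoeff-closed (suc k) l))
           (pathCoeff-closed k l) ⟩
    2 * (2 ^ suc l * 27 ^ suc k * γ (suc k) l) + 54 * suc k * (2 ^ suc l * 27 ^ k * γ k l)
      ≡⟨ join (suc k) (2 ^ suc l) (27 ^ k) (γ (suc k) l) (γ k l) ⟩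
    2 ^ suc (suc l) * 27 ^ suc k * (γ (suc k) l + suc k * γ k l)
      ≡⟨ cong (2 ^ suc (suc l) * 27 ^ suc k *_) (γ-suc k l) ⟩
    2 ^ suc (suc l) * 27 ^ suc k * γ (suc k) (suc l) ∎
    where
    open ≡.≡-Reasoning
    c₁ = pathCoeff (4 + (l * 3 + k)) (suc k)
    c₀ = pathCoeff (3 + (l * 3 + k)) k
    split : ∀ k f t c₁ c₀ → 6 * ((f + k * f) * (2 * t)) * (2 * c₁ + 27 * c₀) ≡
                            2 * (6 * ((f + k * f) * (2 * t)) * c₁) + 54 * (1 + k) * (6 * (f * t) * c₀)
    split = ℕ-Tactic.solve-∀
    join : ∀ k t s x y → 2 * (t * (27 * s) * x) + 54 * k * (t * s * y) ≡ 2 * t * (27 * s) * (x + k * y)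
    join = ℕ-Tactic.solve-∀
    γ-suc : ∀ k l → γ (suc k) l + suc k * γ k l ≡ γ (suc k) (suc l)
    γ-suc zero    l = refl
    γ-suc (suc k) l = refl

  convolution : (ℕ → ℕ) → (ℕ → ℕ) → ℕ → ℕ
  convolution f g zero    = f 0 * g 0
  convolution f g (suc n) = f 0 * g (suc n) + convolution (λ k → f (suc k)) g n

  toSeries-· : ∀ f g n → (SeriesLaws._·_ (toSeries f) (toSeries g)) n ≡ + convolution f g n
  toSeries-· f g zero    = sym (ℤₚ.pos-* (f 0) (g 0))
  toSeries-· f g (suc n) = cong₂ ℤ._+_ (sym (ℤₚ.pos-* (f 0) (g (suc n)))) (toSeries-· (λ k → f (suc k)) g n)

  -- The terms dropped here and in `two-terms` are natural numbers. Nothing is lost by it below: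
  -- `pathCoeff m k` can be nonzero only for k ≡ m (mod 3), and all such indices are kept.
  one-term : ∀ i j f g → f i * g j ≤ convolution f g (i + j)
  one-term zero    zero    f g = ℕₚ.≤-refl
  one-term zero    (suc j) f g = ℕₚ.m≤m+n _ _
  one-term (suc i) j       f g = ℕₚ.≤-trans (one-term i j (λ k → f (suc k)) g) (ℕₚ.m≤n+m _ _)

  two-terms : ∀ i d j f g → f i * g (suc d + j) + f (i + suc d) * g j ≤ convolution f g (i + (suc d + j))
  two-terms zero    d j f g = ℕₚ.+-monoʳ-≤ (f 0 * g (suc d + j)) (one-term d j (λ k → f (suc k)) g)
  two-terms (suc i) d j f g = ℕₚ.≤-trans (two-terms i d j (λ k → f (suc k)) g) (ℕₚ.m≤n+m _ _)

  -- The two factors of a product bring 6 each from `pathCoeff-closed`, hence 36. A single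
  -- coefficient brings only one 6, and the other reappears in front of its γ.
  scale : ℕ → ℕ
  scale j = 36 * (j ! * 2 ^ j)

  unit : ℕ → ℕ → ℕ
  unit M j = 2 ^ M * 27 ^ j

  unit-nonZero : ∀ M j → NonZero (unit M j)
  unit-nonZero M j = ℕₚ.m*n≢0 (2 ^ M) (27 ^ j) {{ℕₚ.m^n≢0 2 M}} {{ℕₚ.m^n≢0 27 j}}

  -- s is S times the fraction `unit M j` / `scale j`. In each of the bounds below M and j are the
  -- same for all terms, so the fraction cancels and an inequality between polynomials in the
  -- lengths remains.
  record Scaled (M j s S : ℕ) : Set where
    constructor scaled
    field
      scaling : scale j * s ≡ unit M j * S

  scaled-+ : ∀ {M j s S t T} → Scaled M j s S → Scaled M j t T → Scaled M j (s + t) (S + T)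
  scaled-+ {M} {j} {s} {S} {t} {T} (scaled p) (scaled q) = scaled (trans (ℕₚ.*-distribˡ-+ (scale j) s t)
    (trans (cong₂ _+_ p q) (sym (ℕₚ.*-distribˡ-+ (unit M j) S T))))

  scaled-≤ : ∀ {M j s S t T} → Scaled M j s S → Scaled M j t T → s ≤ t → S ≤ T
  scaled-≤ {M} {j} {s} {S} {t} {T} (scaled p) (scaled q) s≤t =
    ℕₚ.*-cancelˡ-≤ (unit M j) {{unit-nonZero M j}} (subst₂ _≤_ p q (ℕₚ.*-monoʳ-≤ (scale j) s≤t))

  Bounded : (ℕ → ℕ → ℕ) → ℕ → ℕ → Set
  Bounded c a b = ∀ k → k ≤ 6 →
    convolution (c (1 + a)) (c (2 + b)) k + convolution (c (2 + a)) (c (1 + b)) k ≤ c (3 + (a + b)) k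

  -- The parameter c stands for pathCoeff, which would be unfolded at great cost.
  module _ (c : ℕ → ℕ → ℕ) (c-closed : ∀ k l → 6 * (k ! * 2 ^ k) * c (suc l * 3 + k) k ≡ 2 ^ suc l * 27 ^ k * γ k l) where

    scaled-coeff : ∀ j l {m} → m ≡ suc l * 3 + j → Scaled (suc l) j (c m j) (6 * γ j l)
    scaled-coeff j l refl = scaled (begin
      36 * (j ! * 2 ^ j) * x       ≡⟨ regroup (j ! * 2 ^ j) x ⟩
      6 * (6 * (j ! * 2 ^ j) * x)  ≡⟨ cong (6 *_) (c-closed j l) ⟩
      6 * (unit (suc l) j * γ j l) ≡⟨ swap (unit (suc l) j) (γ j l) ⟩
      unit (suc l) j * (6 * γ j l) ∎)
      where
      open ≡.≡-Reasoning
      x = c (suc l * 3 + j) j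
      regroup : ∀ x c → 36 * x * c ≡ 6 * (6 * x * c)
      regroup = ℕ-Tactic.solve-∀
      swap : ∀ x c → 6 * (x * c) ≡ x * (6 * c)
      swap = ℕ-Tactic.solve-∀

    -- C is the binomial coefficient of k + k′ over k, which completes the two factorials to that of
    -- k + k′.
    scaled-product : ∀ C k k′ l l′ {M m m′} → suc l + suc l′ ≡ M → m ≡ suc l * 3 + k → m′ ≡ suc l′ * 3 + k′ →
      (k + k′) ! ≡ C * (k ! * k′ !) →
      Scaled M (k + k′) (c m k * c m′ k′) (C * (γ k l * γ k′ l′))
    scaled-product C k k′ l l′ refl refl refl fact = scaled (begin
      36 * ((k + k′) ! * 2 ^ (k + k′)) * (x * x′)
        ≡⟨ cong₂ (λ f t → 36 * (f * t) * (x * x′)) fact (ℕₚ.^-distribˡ-+-* 2 k k′) ⟩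
      36 * (C * (k ! * k′ !) * (2 ^ k * 2 ^ k′)) * (x * x′)
        ≡⟨ regroup C (k !) (k′ !) (2 ^ k) (2 ^ k′) x x′ ⟩
      C * ((6 * (k ! * 2 ^ k) * x) * (6 * (k′ ! * 2 ^ k′) * x′))
        ≡⟨ cong₂ (λ x y → C * (x * y)) (c-closed k l) (c-closed k′ l′) ⟩
      C * ((2 ^ suc l * 27 ^ k * γ k l) * (2 ^ suc l′ * 27 ^ k′ * γ k′ l′))
        ≡⟨ collect C (2 ^ suc l) (27 ^ k) (γ k l) (2 ^ suc l′) (27 ^ k′) (γ k′ l′) ⟩
      2 ^ suc l * 2 ^ suc l′ * (27 ^ k * 27 ^ k′) * (C * (γ k l * γ k′ l′))
        ≡⟨ cong₂ (λ x y → x * y * (C * (γ k l * γ k′ l′))) (ℕₚ.^-distribˡ-+-* 2 (suc l) (suc l′)) (ℕₚ.^-distribˡ-+-* 27 k k′) ⟨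
      unit (suc l + suc l′) (k + k′) * (C * (γ k l * γ k′ l′)) ∎)
      where
      open ≡.≡-Reasoning
      x = c (suc l * 3 + k) k
      x′ = c (suc l′ * 3 + k′) k′
      regroup : ∀ C f f′ t t′ c c′ → 36 * (C * (f * f′) * (t * t′)) * (c * c′) ≡ C * ((6 * (f * t) * c) * (6 * (f′ * t′) * c′))
      regroup = ℕ-Tactic.solve-∀
      collect : ∀ C t s x t′ s′ x′ → C * ((t * s * x) * (t′ * s′ * x′)) ≡ t * t′ * (s * s′) * (C * (x * x′))
      collect = ℕ-Tactic.solve-∀

    bound₂ : ∀ x y → Bounded c (2 + suc x * 3) (suc y * 3) →
      1 * (γ 0 (1 + x) * γ 2 y) + 2 * (γ 1 (1 + x) * γ 1 y) ≤ 6 * γ 2 (2 + (x + y))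
    bound₂ x y positive = scaled-≤
      (scaled-+
        (scaled-product 1 0 2 (1 + x) y (sums x y) (m₀ x) (ℕₚ.+-comm 2 (suc y * 3)) refl)
        (scaled-product 2 1 1 (1 + x) y (sums x y) (m₁ x) (ℕₚ.+-comm 1 (suc y * 3)) refl))
      (scaled-coeff 2 (2 + (x + y)) (n x y))
      (ℕₚ.≤-trans (ℕₚ.+-mono-≤ (one-term 0 2 (c (1 + a)) (c (2 + b))) (one-term 1 1 (c (2 + a)) (c (1 + b)))) (positive 2 (ℕₚ.m≤m+n 2 4)))
      where
      a = 2 + suc x * 3
      b = suc y * 3
      sums : ∀ x y → suc (1 + x) + suc y ≡ 3 + (x + y)
      sums = ℕ-Tactic.solve-∀
      m₀ : ∀ x → 1 + (2 + suc x * 3) ≡ suc (1 + x) * 3 + 0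
      m₀ = ℕ-Tactic.solve-∀
      m₁ : ∀ x → 2 + (2 + suc x * 3) ≡ suc (1 + x) * 3 + 1
      m₁ = ℕ-Tactic.solve-∀
      n : ∀ x y → 3 + (2 + suc x * 3 + suc y * 3) ≡ suc (2 + (x + y)) * 3 + 2
      n = ℕ-Tactic.solve-∀

    bound₃ : ∀ x y → Bounded c (suc x * 3) (suc y * 3) →
      3 * (γ 1 x * γ 2 y) + 3 * (γ 2 x * γ 1 y) ≤ 6 * γ 3 (1 + (x + y))
    bound₃ x y positive = scaled-≤
      (scaled-+
        (scaled-product 3 1 2 x y (sums x y) (ℕₚ.+-comm 1 (suc x * 3)) (ℕₚ.+-comm 2 (suc y * 3)) refl)
        (scaled-product 3 2 1 x y (sums x y) (ℕₚ.+-comm 2 (suc x * 3)) (ℕₚ.+-comm 1 (suc y * 3)) refl))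
      (scaled-coeff 3 (1 + (x + y)) (n x y))
      (ℕₚ.≤-trans (ℕₚ.+-mono-≤ (one-term 1 2 (c (1 + a)) (c (2 + b))) (one-term 2 1 (c (2 + a)) (c (1 + b)))) (positive 3 (ℕₚ.m≤m+n 3 3)))
      where
      a = suc x * 3
      b = suc y * 3
      sums : ∀ x y → suc x + suc y ≡ 2 + (x + y)
      sums = ℕ-Tactic.solve-∀
      n : ∀ x y → 3 + (suc x * 3 + suc y * 3) ≡ suc (1 + (x + y)) * 3 + 3
      n = ℕ-Tactic.solve-∀

    -- In m = 3 (l + 1) + k, raising k by 3 lowers l by 1. So for one path the indices 1 and 4 come
    -- with the arguments `1 + y` and y, and likewise 0 and 3 with `1 + x` and x.
    bound₄ : ∀ x y → Bounded c (1 + suc x * 3) ((2 + y) * 3) →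
      6 * (γ 2 x * γ 2 (1 + y)) + (1 * (γ 0 (1 + x) * γ 4 y) + 4 * (γ 3 x * γ 1 (1 + y))) ≤ 6 * γ 4 (2 + (x + y))
    bound₄ x y positive = scaled-≤
      (scaled-+
        (scaled-product 6 2 2 x (1 + y) (sums x y) (m₂ x) (ℕₚ.+-comm 2 ((2 + y) * 3)) refl)
        (scaled-+
          (scaled-product 1 0 4 (1 + x) y (sums′ x y) (m₀ x) (m₄ y) refl)
          (scaled-product 4 3 1 x (1 + y) (sums x y) (m₃ x) (ℕₚ.+-comm 1 ((2 + y) * 3)) refl)))
      (scaled-coeff 4 (2 + (x + y)) (n x y))
      (ℕₚ.≤-trans (ℕₚ.+-mono-≤ (one-term 2 2 (c (1 + a)) (c (2 + b))) (two-terms 0 2 1 (c (2 + a)) (c (1 + b)))) (positive 4 (ℕₚ.m≤m+n 4 2)))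
      where
      a = 1 + suc x * 3
      b = (2 + y) * 3
      sums : ∀ x y → suc x + suc (1 + y) ≡ 3 + (x + y)
      sums = ℕ-Tactic.solve-∀
      sums′ : ∀ x y → suc (1 + x) + suc y ≡ 3 + (x + y)
      sums′ = ℕ-Tactic.solve-∀
      m₀ : ∀ x → 2 + (1 + suc x * 3) ≡ suc (1 + x) * 3 + 0
      m₀ = ℕ-Tactic.solve-∀
      m₂ : ∀ x → 1 + (1 + suc x * 3) ≡ suc x * 3 + 2
      m₂ = ℕ-Tactic.solve-∀
      m₃ : ∀ x → 2 + (1 + suc x * 3) ≡ suc x * 3 + 3
      m₃ = ℕ-Tactic.solve-∀
      m₄ : ∀ y → 1 + (2 + y) * 3 ≡ suc y * 3 + 4
      m₄ = ℕ-Tactic.solve-∀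
      n : ∀ x y → 3 + (1 + suc x * 3 + (2 + y) * 3) ≡ suc (2 + (x + y)) * 3 + 4
      n = ℕ-Tactic.solve-∀

    bound₆ : ∀ x y → Bounded c ((2 + x) * 3) ((2 + y) * 3) →
      (6 * (γ 1 (1 + x) * γ 5 y) + 15 * (γ 4 x * γ 2 (1 + y))) + (15 * (γ 2 (1 + x) * γ 4 y) + 6 * (γ 5 x * γ 1 (1 + y)))
        ≤ 6 * γ 6 (2 + (x + y))
    bound₆ x y positive = scaled-≤
      (scaled-+
        (scaled-+
          (scaled-product 6 1 5 (1 + x) y (sums′ x y) (ℕₚ.+-comm 1 ((2 + x) * 3)) (m₅ y) refl)
          (scaled-product 15 4 2 x (1 + y) (sums x y) (m₄ x) (ℕₚ.+-comm 2 ((2 + y) * 3)) refl))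
        (scaled-+
          (scaled-product 15 2 4 (1 + x) y (sums′ x y) (ℕₚ.+-comm 2 ((2 + x) * 3)) (m₄ y) refl)
          (scaled-product 6 5 1 x (1 + y) (sums x y) (m₅ x) (ℕₚ.+-comm 1 ((2 + y) * 3)) refl)))
      (scaled-coeff 6 (2 + (x + y)) (n x y))
      (ℕₚ.≤-trans (ℕₚ.+-mono-≤ (two-terms 1 2 2 (c (1 + a)) (c (2 + b))) (two-terms 2 2 1 (c (2 + a)) (c (1 + b)))) (positive 6 ℕₚ.≤-refl))
      where
      a = (2 + x) * 3
      b = (2 + y) * 3
      sums : ∀ x y → suc x + suc (1 + y) ≡ 3 + (x + y)
      sums = ℕ-Tactic.solve-∀
      sums′ : ∀ x y → suc (1 + x) + suc y ≡ 3 + (x + y)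
      sums′ = ℕ-Tactic.solve-∀
      m₄ : ∀ x → 1 + (2 + x) * 3 ≡ suc x * 3 + 4
      m₄ = ℕ-Tactic.solve-∀
      m₅ : ∀ x → 2 + (2 + x) * 3 ≡ suc x * 3 + 5
      m₅ = ℕ-Tactic.solve-∀
      n : ∀ x y → 3 + ((2 + x) * 3 + (2 + y) * 3) ≡ suc (2 + (x + y)) * 3 + 6
      n = ℕ-Tactic.solve-∀

open CoefficientBounds

-- Polynomial inequalities and their certificates

module IntegerInequalities where
  open import Data.Integer using (_+_; _*_; _-_; _≤_; +≤+)
  open import Data.Integer.Solver using (module +-*-Solver)
  open +-*-Solver using (Polynomial; con; solve; _:=_; _:+_; _:*_; _:-_)

  fall : ℕ → ℤ → ℤ
  fall zero    x = 1ℤ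
  fall (suc k) x = fall k x * (x - + k)

  -- The closed form of γ: 9 times the k-th falling factorial plus 8k times the previous one, with
  -- their common factor taken out. The truncated subtraction is exact in the range used, where the
  -- index of Γ is at most 6.
  Γ : ℕ → ℤ → ℤ
  Γ zero    x = + 9
  Γ (suc k) x = fall k x * (+ 9 * x + + (8 ℕ.∸ k))

  fallₚ : ∀ {n} → ℕ → Polynomial n → Polynomial n
  fallₚ zero    x = con 1ℤ
  fallₚ (suc k) x = fallₚ k x :* (x :- con (+ k))

  Γₚ : ∀ {n} → ℕ → Polynomial n → Polynomial n
  Γₚ zero    x = con (+ 9)
  Γₚ (suc k) x = fallₚ k x :* (con (+ 9) :* x :+ con (+ (8 ℕ.∸ k)))

  -- The recursion of γ is a finite difference equation; `step` is that equation for the polynomials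
  -- Γ. It is left to the solver for each concrete k, since only then does `Γₚ` unfold.
  γ-step : ∀ k → (∀ l → + γ k l ≡ Γ k (+ l)) → + γ (suc k) 0 ≡ Γ (suc k) 0ℤ →
    (∀ x → Γ (suc k) x + + suc k * Γ k x ≡ Γ (suc k) (1ℤ + x)) → ∀ l → + γ (suc k) l ≡ Γ (suc k) (+ l)
  γ-step k γₖ base step zero    = base
  γ-step k γₖ base step (suc l) = trans (cong +_ (unfold k))
    (trans (cong₂ _+_ (γ-step k γₖ base step l) (trans (ℤₚ.pos-* (suc k) (γ k l)) (cong (λ z → + suc k * z) (γₖ l))))
      (step (+ l)))
    where
    unfold : ∀ k → γ (suc k) (suc l) ≡ γ (suc k) l ℕ.+ suc k ℕ.* γ k l
    unfold zero    = refl
    unfold (suc k) = refl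

  stepₚ : ℕ → Polynomial 1 → _
  stepₚ k x = Γₚ (suc k) x :+ con (+ suc k) :* Γₚ k x := Γₚ (suc k) (con 1ℤ :+ x)

  γ₀ : ∀ l → + γ 0 l ≡ Γ 0 (+ l)
  γ₀ l = refl
  γ₁ : ∀ l → + γ 1 l ≡ Γ 1 (+ l)
  γ₁ = γ-step 0 γ₀ refl (solve 1 (stepₚ 0) refl)
  γ₂ : ∀ l → + γ 2 l ≡ Γ 2 (+ l)
  γ₂ = γ-step 1 γ₁ refl (solve 1 (stepₚ 1) refl)
  γ₃ : ∀ l → + γ 3 l ≡ Γ 3 (+ l)
  γ₃ = γ-step 2 γ₂ refl (solve 1 (stepₚ 2) refl)
  γ₄ : ∀ l → + γ 4 l ≡ Γ 4 (+ l)
  γ₄ = γ-step 3 γ₃ refl (solve 1 (stepₚ 3) refl)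
  γ₅ : ∀ l → + γ 5 l ≡ Γ 5 (+ l)
  γ₅ = γ-step 4 γ₄ refl (solve 1 (stepₚ 4) refl)
  γ₆ : ∀ l → + γ 6 l ≡ Γ 6 (+ l)
  γ₆ = γ-step 5 γ₅ refl (solve 1 (stepₚ 5) refl)

  γγ : ∀ C {m n x y} → + m ≡ x → + n ≡ y → + (C ℕ.* (m ℕ.* n)) ≡ + C * (x * y)
  γγ C {m} {n} p q = trans (ℤₚ.pos-* C (m ℕ.* n)) (cong (λ z → + C * z) (trans (ℤₚ.pos-* m n) (cong₂ _*_ p q)))

  -- Natural coefficients make the value at natural arguments nonnegative by inspection. Such lists
  -- serve as positivity certificates once a region has been given coordinates ranging over all of
  -- ℕ.
  horner : List ℕ → ℤ → ℤ
  horner []       u = 0ℤ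
  horner (c ∷ cs) u = + c + u * horner cs u

  horner₂ : List (List ℕ) → ℤ → ℤ → ℤ
  horner₂ []         u v = 0ℤ
  horner₂ (cs ∷ css) u v = horner cs u + v * horner₂ css u v

  hornerₚ : ∀ {n} → List ℕ → Polynomial n → Polynomial n
  hornerₚ []       u = con 0ℤ
  hornerₚ (c ∷ cs) u = con (+ c) :+ u :* hornerₚ cs u

  horner₂ₚ : ∀ {n} → List (List ℕ) → Polynomial n → Polynomial n → Polynomial n
  horner₂ₚ []         u v = con 0ℤ
  horner₂ₚ (cs ∷ css) u v = hornerₚ cs u :+ v :* horner₂ₚ css u v

  horner-nonNegative : ∀ cs u → 0ℤ ≤ horner cs (+ u)
  horner-nonNegative []       u = +≤+ z≤n
  horner-nonNegative (c ∷ cs) u = ℤₚ.+-mono-≤ (+≤+ {n = c} z≤n) (*-nonNegative (+≤+ {n = u} z≤n) (horner-nonNegative cs u))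

  horner₂-nonNegative : ∀ css u v → 0ℤ ≤ horner₂ css (+ u) (+ v)
  horner₂-nonNegative []         u v = +≤+ z≤n
  horner₂-nonNegative (cs ∷ css) u v = ℤₚ.+-mono-≤ (horner-nonNegative cs u)
    (*-nonNegative (+≤+ {n = v} z≤n) (horner₂-nonNegative css u v))

  exceeds : ∀ {i j} css u v → i ≡ j + (1ℤ + horner₂ css (+ u) (+ v)) → ¬ i ≤ j
  exceeds {i} {j} css u v eq i≤j = ℤₚ.≤⇒≯ i≤j (subst (λ k → j ℤ.< k) (sym eq)
    (subst (λ k → k ℤ.< j + (1ℤ + horner₂ css (+ u) (+ v))) (ℤₚ.+-identityʳ j)
      (ℤₚ.+-monoʳ-< j (ℤₚ.<-≤-trans (ℤ.+<+ (ℕ.s≤s z≤n)) (ℤₚ.+-monoʳ-≤ 1ℤ (horner₂-nonNegative css u v))))))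

  -- Coordinates on the cone y ≤ x ≤ 2y - k: u = x - y and v = 2y - k - x measure the distances from
  -- its two sides.
  between : ∀ k {x y} → y ℕ.≤ x → k ℕ.+ x ℕ.≤ 2 ℕ.* y → ∃[ u ] ∃[ v ] x ≡ k ℕ.+ u ℕ.+ v ℕ.+ u × y ≡ k ℕ.+ u ℕ.+ v
  between k {x} {y} y≤x k+x≤2y =
    let u , y+u≡x = ℕₚ.m≤n⇒∃[o]m+o≡n y≤x
        v , eq = ℕₚ.m≤n⇒∃[o]m+o≡n k+x≤2y
        y≡ = ℕₚ.+-cancelˡ-≡ y y (k ℕ.+ u ℕ.+ v) (trans (double y)
               (trans (sym eq) (trans (cong (λ z → k ℕ.+ z ℕ.+ v) (sym y+u≡x)) (rearrange k y u v))))
    in u , v , trans (sym y+u≡x) (cong (ℕ._+ u) y≡) , y≡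
    where
    double : ∀ y → y ℕ.+ y ≡ 2 ℕ.* y
    double = ℕ-Tactic.solve-∀
    rearrange : ∀ k y u v → k ℕ.+ (y ℕ.+ u) ℕ.+ v ≡ y ℕ.+ (k ℕ.+ u ℕ.+ v)
    rearrange = ℕ-Tactic.solve-∀

  module _ (c : ℕ → ℕ → ℕ)
           (c-closed : ∀ k l → 6 ℕ.* (k ℕ.! ℕ.* 2 ℕ.^ k) ℕ.* c (suc l ℕ.* 3 ℕ.+ k) k ≡ 2 ℕ.^ suc l ℕ.* 27 ℕ.^ k ℕ.* γ k l) where

    Γ-bound₂ : ∀ x y → Bounded c (2 ℕ.+ suc x ℕ.* 3) (suc y ℕ.* 3) →
      + 1 * (Γ 0 (1ℤ + + x) * Γ 2 (+ y)) + + 2 * (Γ 1 (1ℤ + + x) * Γ 1 (+ y)) ≤ + 6 * Γ 2 (+ 2 + (+ x + + y))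
    Γ-bound₂ x y bounded = subst₂ _≤_ (cong₂ _+_ (γγ 1 (γ₀ (1 ℕ.+ x)) (γ₂ y)) (γγ 2 (γ₁ (1 ℕ.+ x)) (γ₁ y)))
      (trans (ℤₚ.pos-* 6 (γ 2 (2 ℕ.+ (x ℕ.+ y)))) (cong (λ z → + 6 * z) (γ₂ (2 ℕ.+ (x ℕ.+ y)))))
      (+≤+ (bound₂ c c-closed x y bounded))

    Γ-bound₃ : ∀ x y → Bounded c (suc x ℕ.* 3) (suc y ℕ.* 3) →
      + 3 * (Γ 1 (+ x) * Γ 2 (+ y)) + + 3 * (Γ 2 (+ x) * Γ 1 (+ y)) ≤ + 6 * Γ 3 (1ℤ + (+ x + + y))
    Γ-bound₃ x y bounded = subst₂ _≤_ (cong₂ _+_ (γγ 3 (γ₁ x) (γ₂ y)) (γγ 3 (γ₂ x) (γ₁ y)))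
      (trans (ℤₚ.pos-* 6 (γ 3 (1 ℕ.+ (x ℕ.+ y)))) (cong (λ z → + 6 * z) (γ₃ (1 ℕ.+ (x ℕ.+ y)))))
      (+≤+ (bound₃ c c-closed x y bounded))

    Γ-bound₄ : ∀ x y → Bounded c (1 ℕ.+ suc x ℕ.* 3) ((2 ℕ.+ y) ℕ.* 3) →
      + 6 * (Γ 2 (+ x) * Γ 2 (1ℤ + + y)) + (+ 1 * (Γ 0 (1ℤ + + x) * Γ 4 (+ y)) + + 4 * (Γ 3 (+ x) * Γ 1 (1ℤ + + y)))
        ≤ + 6 * Γ 4 (+ 2 + (+ x + + y))
    Γ-bound₄ x y bounded = subst₂ _≤_
      (cong₂ _+_ (γγ 6 (γ₂ x) (γ₂ (1 ℕ.+ y))) (cong₂ _+_ (γγ 1 (γ₀ (1 ℕ.+ x)) (γ₄ y)) (γγ 4 (γ₃ x) (γ₁ (1 ℕ.+ y)))))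
      (trans (ℤₚ.pos-* 6 (γ 4 (2 ℕ.+ (x ℕ.+ y)))) (cong (λ z → + 6 * z) (γ₄ (2 ℕ.+ (x ℕ.+ y)))))
      (+≤+ (bound₄ c c-closed x y bounded))

    Γ-bound₆ : ∀ x y → Bounded c ((2 ℕ.+ x) ℕ.* 3) ((2 ℕ.+ y) ℕ.* 3) →
      (+ 6 * (Γ 1 (1ℤ + + x) * Γ 5 (+ y)) + + 15 * (Γ 4 (+ x) * Γ 2 (1ℤ + + y)))
        + (+ 15 * (Γ 2 (1ℤ + + x) * Γ 4 (+ y)) + + 6 * (Γ 5 (+ x) * Γ 1 (1ℤ + + y)))
        ≤ + 6 * Γ 6 (+ 2 + (+ x + + y))
    Γ-bound₆ x y bounded = subst₂ _≤_
      (cong₂ _+_ (cong₂ _+_ (γγ 6 (γ₁ (1 ℕ.+ x)) (γ₅ y)) (γγ 15 (γ₄ x) (γ₂ (1 ℕ.+ y))))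
                 (cong₂ _+_ (γγ 15 (γ₂ (1 ℕ.+ x)) (γ₄ y)) (γγ 6 (γ₅ x) (γ₁ (1 ℕ.+ y)))))
      (trans (ℤₚ.pos-* 6 (γ 6 (2 ℕ.+ (x ℕ.+ y)))) (cong (λ z → + 6 * z) (γ₆ (2 ℕ.+ (x ℕ.+ y)))))
      (+≤+ (bound₆ c c-closed x y bounded))

    private
      lhs₃ rhs₃ lhs₄ rhs₄ lhs₆ rhs₆ : ∀ {n} → Polynomial n → Polynomial n → Polynomial n
      lhs₃ x y = con (+ 3) :* (Γₚ 1 x :* Γₚ 2 y) :+ con (+ 3) :* (Γₚ 2 x :* Γₚ 1 y)
      rhs₃ x y = con (+ 6) :* Γₚ 3 (con 1ℤ :+ (x :+ y))
      lhs₄ x y = con (+ 6) :* (Γₚ 2 x :* Γₚ 2 (con 1ℤ :+ y))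
        :+ (con (+ 1) :* (Γₚ 0 (con 1ℤ :+ x) :* Γₚ 4 y) :+ con (+ 4) :* (Γₚ 3 x :* Γₚ 1 (con 1ℤ :+ y)))
      rhs₄ x y = con (+ 6) :* Γₚ 4 (con (+ 2) :+ (x :+ y))
      lhs₆ x y = (con (+ 6) :* (Γₚ 1 (con 1ℤ :+ x) :* Γₚ 5 y) :+ con (+ 15) :* (Γₚ 4 x :* Γₚ 2 (con 1ℤ :+ y)))
        :+ (con (+ 15) :* (Γₚ 2 (con 1ℤ :+ x) :* Γₚ 4 y) :+ con (+ 6) :* (Γₚ 5 x :* Γₚ 1 (con 1ℤ :+ y)))
      rhs₆ x y = con (+ 6) :* Γₚ 6 (con (+ 2) :+ (x :+ y))

    -- In each of the following lemmas css lists the coefficients, by powers of v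
    -- and then of u, of the amount by which the bound fails, minus 1.

    ¬bounded₃-2y-1 : ∀ u → ¬ Bounded c (suc (u ℕ.+ u ℕ.+ 6) ℕ.* 3) (suc (u ℕ.+ 3) ℕ.* 3)
    ¬bounded₃-2y-1 u bounded = exceeds css u 0
      (solve 1 (λ u → let x = u :+ u :+ con (+ 6); y = u :+ con (+ 3) in lhs₃ x y := rhs₃ x y :+ (con 1ℤ :+ horner₂ₚ css u (con 0ℤ))) refl (+ u))
      (Γ-bound₃ (u ℕ.+ u ℕ.+ 6) (u ℕ.+ 3) bounded)
      where
      css : List (List ℕ)
      css = (5561 ∷ 3474 ∷ 540 ∷ []) ∷ []

    ¬bounded₃-2y : ∀ u → ¬ Bounded c (suc (u ℕ.+ u ℕ.+ 7) ℕ.* 3) (suc (u ℕ.+ 3) ℕ.* 3)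
    ¬bounded₃-2y u bounded = exceeds css u 0
      (solve 1 (λ u → let x = u :+ u :+ con (+ 7); y = u :+ con (+ 3) in lhs₃ x y := rhs₃ x y :+ (con 1ℤ :+ horner₂ₚ css u (con 0ℤ))) refl (+ u))
      (Γ-bound₃ (u ℕ.+ u ℕ.+ 7) (u ℕ.+ 3) bounded)
      where
      css : List (List ℕ)
      css = (3875 ∷ 2151 ∷ 297 ∷ []) ∷ []

    ¬bounded₃-2y+1 : ∀ u → ¬ Bounded c (suc (u ℕ.+ u ℕ.+ 8) ℕ.* 3) (suc (u ℕ.+ 3) ℕ.* 3)
    ¬bounded₃-2y+1 u bounded = exceeds css u 0
      (solve 1 (λ u → let x = u :+ u :+ con (+ 8); y = u :+ con (+ 3) in lhs₃ x y := rhs₃ x y :+ (con 1ℤ :+ horner₂ₚ css u (con 0ℤ))) refl (+ u))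
      (Γ-bound₃ (u ℕ.+ u ℕ.+ 8) (u ℕ.+ 3) bounded)
      where
      css : List (List ℕ)
      css = (551 ∷ 342 ∷ 54 ∷ []) ∷ []

    ¬bounded₃-≤2y-2 : ∀ u v → ¬ Bounded c (suc (u ℕ.+ u ℕ.+ v ℕ.+ 1) ℕ.* 3) (suc (u ℕ.+ v ℕ.+ 1) ℕ.* 3)
    ¬bounded₃-≤2y-2 u v bounded = exceeds css u v
      (solve 2 (λ u v → let x = u :+ u :+ v :+ con (+ 1); y = u :+ v :+ con (+ 1) in lhs₃ x y := rhs₃ x y :+ (con 1ℤ :+ horner₂ₚ css u v)) refl (+ u) (+ v))
      (Γ-bound₃ (u ℕ.+ u ℕ.+ v ℕ.+ 1) (u ℕ.+ v ℕ.+ 1) bounded)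
      where
      css : List (List ℕ)
      css = (443 ∷ 1179 ∷ 783 ∷ []) ∷ (786 ∷ 1188 ∷ 243 ∷ []) ∷ (396 ∷ 243 ∷ []) ∷ (54 ∷ []) ∷ []

    -- The first point of the line x = 2y + 2 is treated alone: expanded around y = 4, the excess
    -- has a negative cubic coefficient, so the certificate for this line starts at y = 5.
    ¬bounded₆-y≡4 : ¬ Bounded c ((2 ℕ.+ (8)) ℕ.* 3) ((2 ℕ.+ (2)) ℕ.* 3)
    ¬bounded₆-y≡4 bounded = exceeds css 0 0
      (solve 0 (let x = con (+ 8); y = con (+ 2) in lhs₆ x y := rhs₆ x y :+ (con 1ℤ :+ horner₂ₚ css (con 0ℤ) (con 0ℤ))) refl)
      (Γ-bound₆ (8) (2) bounded)
      where
      css : List (List ℕ)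
      css = (3100319 ∷ []) ∷ []

    ¬bounded₆-2y+2 : ∀ u → ¬ Bounded c ((2 ℕ.+ (u ℕ.+ u ℕ.+ 10)) ℕ.* 3) ((2 ℕ.+ (u ℕ.+ 3)) ℕ.* 3)
    ¬bounded₆-2y+2 u bounded = exceeds css u 0
      (solve 1 (λ u → let x = u :+ u :+ con (+ 10); y = u :+ con (+ 3) in lhs₆ x y := rhs₆ x y :+ (con 1ℤ :+ horner₂ₚ css u (con 0ℤ))) refl (+ u))
      (Γ-bound₆ (u ℕ.+ u ℕ.+ 10) (u ℕ.+ 3) bounded)
      where
      css : List (List ℕ)
      css = (6524639 ∷ 4046184 ∷ 680292 ∷ 122130 ∷ 82170 ∷ 19926 ∷ 1458 ∷ []) ∷ []

    -- With x = a / 3 and y = b / 3, the coordinates are u = x - 2y - 3 and v = 3y - x.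
    ¬bounded₆-≥2y+3 : ∀ u v → ¬ Bounded c ((2 ℕ.+ (u ℕ.+ u ℕ.+ u ℕ.+ v ℕ.+ v ℕ.+ 7)) ℕ.* 3) ((2 ℕ.+ (u ℕ.+ v ℕ.+ 1)) ℕ.* 3)
    ¬bounded₆-≥2y+3 u v bounded = exceeds css u v
      (solve 2 (λ u v → let x = u :+ u :+ u :+ v :+ v :+ con (+ 7); y = u :+ v :+ con (+ 1) in lhs₆ x y := rhs₆ x y :+ (con 1ℤ :+ horner₂ₚ css u v)) refl (+ u) (+ v))
      (Γ-bound₆ (u ℕ.+ u ℕ.+ u ℕ.+ v ℕ.+ v ℕ.+ 7) (u ℕ.+ v ℕ.+ 1) bounded)
      where
      css : List (List ℕ)
      css = 
        (2615759 ∷ 6186780 ∷ 5793198 ∷ 2759940 ∷ 725160 ∷ 107280 ∷ 7722 ∷ []) ∷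
        (3991896 ∷ 7301016 ∷ 5180355 ∷ 1901700 ∷ 404595 ∷ 42282 ∷ []) ∷
        (2070432 ∷ 2839185 ∷ 1644930 ∷ 552690 ∷ 86265 ∷ []) ∷
        (389340 ∷ 499140 ∷ 339390 ∷ 87480 ∷ []) ∷ (22230 ∷ 89505 ∷ 47385 ∷ []) ∷ (6804 ∷ 13122 ∷ []) ∷ (1458 ∷ []) ∷ []

    ¬bounded₄-≤2y-4 : ∀ u v → ¬ Bounded c (1 ℕ.+ suc (u ℕ.+ u ℕ.+ v ℕ.+ 3) ℕ.* 3) ((2 ℕ.+ (u ℕ.+ v ℕ.+ 2)) ℕ.* 3)
    ¬bounded₄-≤2y-4 u v bounded = exceeds css u v
      (solve 2 (λ u v → let x = u :+ u :+ v :+ con (+ 3); y = u :+ v :+ con (+ 2) in lhs₄ x y := rhs₄ x y :+ (con 1ℤ :+ horner₂ₚ css u v)) refl (+ u) (+ v))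
      (Γ-bound₄ (u ℕ.+ u ℕ.+ v ℕ.+ 3) (u ℕ.+ v ℕ.+ 2) bounded)
      where
      css : List (List ℕ)
      css = (4463 ∷ 15870 ∷ 14325 ∷ 4266 ∷ 243 ∷ []) ∷ (2874 ∷ 11460 ∷ 7236 ∷ 972 ∷ []) ∷ (441 ∷ 2916 ∷ 972 ∷ []) ∷ (66 ∷ 324 ∷ []) ∷ (27 ∷ []) ∷ []

    -- Here a = 3x and b = 3y. The region y ≤ x ≤ 3y is cut into cones and lines on each of which
    -- the excess has nonnegative coefficients in suitable coordinates: j = 3 serves up to x = 2y +
    -- 1, and j = 6 beyond.
    bounded⇒3y<x : ∀ x y → 4 ℕ.≤ y → y ℕ.≤ x → Bounded c (x ℕ.* 3) (y ℕ.* 3) → ¬ x ℕ.≤ 3 ℕ.* y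
    bounded⇒3y<x x y 4≤y y≤x bounded x≤3y with ℕₚ.≤-<-connex (2 ℕ.+ x) (2 ℕ.* y)
    ... | inj₁ 2+x≤2y =
      let u , v , x≡′ , y≡′ = between 2 y≤x 2+x≤2y
      in ¬bounded₃-≤2y-2 u v (subst₂ (λ m n → Bounded c (m ℕ.* 3) (n ℕ.* 3)) (trans x≡′ (x≡ u v)) (trans y≡′ (y≡ u v)) bounded)
      where
      x≡ : ∀ u v → 2 ℕ.+ u ℕ.+ v ℕ.+ u ≡ suc (u ℕ.+ u ℕ.+ v ℕ.+ 1)
      x≡ = ℕ-Tactic.solve-∀
      y≡ : ∀ u v → 2 ℕ.+ u ℕ.+ v ≡ suc (u ℕ.+ v ℕ.+ 1)
      y≡ = ℕ-Tactic.solve-∀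
    -- From here on t = x + 1 - 2y: the values 0, 1, 2 are the lines for j = 3, and 3 is the line x
    -- = 2y + 2.
    ... | inj₂ (ℕ.s≤s 2y≤1+x) =
      let t , eq = ℕₚ.m≤n⇒∃[o]m+o≡n 2y≤1+x
      in remaining t (ℕₚ.+-cancelˡ-≡ 1 x (w ℕ.+ w ℕ.+ 7 ℕ.+ t) (trans (sym eq) (trans (cong (λ y → 2 ℕ.* y ℕ.+ t) (sym 4+w≡y)) (rearrange w t))))
      where
      w = proj₁ (ℕₚ.m≤n⇒∃[o]m+o≡n 4≤y)
      4+w≡y = proj₂ (ℕₚ.m≤n⇒∃[o]m+o≡n 4≤y)
      rearrange : ∀ w t → 2 ℕ.* (4 ℕ.+ w) ℕ.+ t ≡ 1 ℕ.+ (w ℕ.+ w ℕ.+ 7 ℕ.+ t)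
      rearrange = ℕ-Tactic.solve-∀
      y≡ : ∀ w → 4 ℕ.+ w ≡ suc (w ℕ.+ 3)
      y≡ = ℕ-Tactic.solve-∀
      at : ∀ {m n} → x ≡ m → 4 ℕ.+ w ≡ n → Bounded c (m ℕ.* 3) (n ℕ.* 3)
      at p q = subst₂ (λ m n → Bounded c (m ℕ.* 3) (n ℕ.* 3)) p (trans (sym 4+w≡y) q) bounded
      remaining : ∀ t → x ≡ w ℕ.+ w ℕ.+ 7 ℕ.+ t → ⊥
      remaining 0 eq = ¬bounded₃-2y-1 w (at (trans eq (x≡ w)) (y≡ w))
        where
        x≡ : ∀ w → w ℕ.+ w ℕ.+ 7 ℕ.+ 0 ≡ suc (w ℕ.+ w ℕ.+ 6)
        x≡ = ℕ-Tactic.solve-∀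
      remaining 1 eq = ¬bounded₃-2y w (at (trans eq (x≡ w)) (y≡ w))
        where
        x≡ : ∀ w → w ℕ.+ w ℕ.+ 7 ℕ.+ 1 ≡ suc (w ℕ.+ w ℕ.+ 7)
        x≡ = ℕ-Tactic.solve-∀
      remaining 2 eq = ¬bounded₃-2y+1 w (at (trans eq (x≡ w)) (y≡ w))
        where
        x≡ : ∀ w → w ℕ.+ w ℕ.+ 7 ℕ.+ 2 ≡ suc (w ℕ.+ w ℕ.+ 8)
        x≡ = ℕ-Tactic.solve-∀
      remaining 3 eq = go w eq 4+w≡y
        where
        x≡ : ∀ w → suc w ℕ.+ suc w ℕ.+ 7 ℕ.+ 3 ≡ 2 ℕ.+ (w ℕ.+ w ℕ.+ 10)
        x≡ = ℕ-Tactic.solve-∀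
        y≡′ : ∀ w → 4 ℕ.+ suc w ≡ 2 ℕ.+ (w ℕ.+ 3)
        y≡′ = ℕ-Tactic.solve-∀
        go : ∀ w → x ≡ w ℕ.+ w ℕ.+ 7 ℕ.+ 3 → 4 ℕ.+ w ≡ y → ⊥
        go zero     eq refl = ¬bounded₆-y≡4 (subst (λ m → Bounded c (m ℕ.* 3) 12) eq bounded)
        go (suc w′) eq 4+w≡y = ¬bounded₆-2y+2 w′ (subst₂ (λ m n → Bounded c (m ℕ.* 3) (n ℕ.* 3))
          (trans eq (x≡ w′)) (trans (sym 4+w≡y) (y≡′ w′)) bounded)
      -- Now u = x - 2y - 3, and `x≤3y` provides v = 3y - x.
      remaining (suc (suc (suc (suc u)))) eq
        = let v , u+v≡1+w = ℕₚ.m≤n⇒∃[o]m+o≡n (ℕₚ.+-cancelˡ-≤ (w ℕ.+ w ℕ.+ 11) u (suc w)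
                              (subst₂ ℕ._≤_ (trans eq (x≡ w u)) (trans (cong (3 ℕ.*_) (sym 4+w≡y)) (3y≡ w)) x≤3y))
          in ¬bounded₆-≥2y+3 u v (at
               (trans eq (trans (x≡′ w u) (trans (cong (λ s → s ℕ.+ s ℕ.+ u ℕ.+ 9) (sym u+v≡1+w)) (x≡″ u v))))
               (trans (cong (3 ℕ.+_) (sym u+v≡1+w)) (y≡′ u v)))
        where
        x≡ : ∀ w u → w ℕ.+ w ℕ.+ 7 ℕ.+ (4 ℕ.+ u) ≡ w ℕ.+ w ℕ.+ 11 ℕ.+ u
        x≡ = ℕ-Tactic.solve-∀
        3y≡ : ∀ w → 3 ℕ.* (4 ℕ.+ w) ≡ w ℕ.+ w ℕ.+ 11 ℕ.+ suc w
        3y≡ = ℕ-Tactic.solve-∀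
        x≡′ : ∀ w u → w ℕ.+ w ℕ.+ 7 ℕ.+ (4 ℕ.+ u) ≡ suc w ℕ.+ suc w ℕ.+ u ℕ.+ 9
        x≡′ = ℕ-Tactic.solve-∀
        x≡″ : ∀ u v → u ℕ.+ v ℕ.+ (u ℕ.+ v) ℕ.+ u ℕ.+ 9 ≡ 2 ℕ.+ (u ℕ.+ u ℕ.+ u ℕ.+ v ℕ.+ v ℕ.+ 7)
        x≡″ = ℕ-Tactic.solve-∀
        y≡′ : ∀ u v → 3 ℕ.+ (u ℕ.+ v) ≡ 2 ℕ.+ (u ℕ.+ v ℕ.+ 1)
        y≡′ = ℕ-Tactic.solve-∀

    bounded⇒2y<4+x : ∀ x y → y ℕ.≤ x → Bounded c (1 ℕ.+ x ℕ.* 3) (y ℕ.* 3) → ¬ 4 ℕ.+ x ℕ.≤ 2 ℕ.* y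
    bounded⇒2y<4+x x y y≤x bounded 4+x≤2y =
      let u , v , x≡′ , y≡′ = between 4 y≤x 4+x≤2y
      in ¬bounded₄-≤2y-4 u v (subst₂ (λ m n → Bounded c (1 ℕ.+ m ℕ.* 3) (n ℕ.* 3)) (trans x≡′ (x≡ u v)) (trans y≡′ (y≡ u v)) bounded)
      where
      x≡ : ∀ u v → 4 ℕ.+ u ℕ.+ v ℕ.+ u ≡ suc (u ℕ.+ u ℕ.+ v ℕ.+ 3)
      x≡ = ℕ-Tactic.solve-∀
      y≡ : ∀ u v → 4 ℕ.+ u ℕ.+ v ≡ 2 ℕ.+ (u ℕ.+ v ℕ.+ 2)
      y≡ = ℕ-Tactic.solve-∀

open IntegerInequalities

-- Real bounds

module Cuts where
  open import Data.Rational using (ℚ; _+_; _*_; _<_; _≤_; _/_; Positive; NonNegative; toℚᵘ)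
  open import Data.Rational.Solver using (module +-*-Solver)
  open import Data.Rational.Unnormalised using (_≃_; mkℚᵘ; *≡*; *≤*)

  ↑ : ℤ → ℚ
  ↑ z = z / 1

  -- The division in `↑ z` normalises by a gcd, which is stuck for a variable z; the laws of `↑` are
  -- therefore proved among unnormalised rationals.
  ↑-unnormalised : ∀ z → toℚᵘ (↑ z) ≃ mkℚᵘ z 0
  ↑-unnormalised z = ℚₚ.toℚᵘ-fromℚᵘ (mkℚᵘ z 0)

  ↑-+ : ∀ x y → ↑ (x ℤ.+ y) ≡ ↑ x + ↑ y
  ↑-+ x y = ℚₚ.toℚᵘ-injective (ℚᵘₚ.≃-trans (↑-unnormalised (x ℤ.+ y)) (ℚᵘₚ.≃-trans (*≡* (identity x y))
    (ℚᵘₚ.≃-sym (ℚᵘₚ.≃-trans (ℚₚ.toℚᵘ-homo-+ (↑ x) (↑ y)) (ℚᵘₚ.+-cong (↑-unnormalised x) (↑-unnormalised y))))))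
    where
    identity : ∀ x y → (x ℤ.+ y) ℤ.* (+ 1 ℤ.* + 1) ≡ (x ℤ.* + 1 ℤ.+ y ℤ.* + 1) ℤ.* + 1
    identity = ℤ-Tactic.solve-∀

  ↑-* : ∀ x y → ↑ (x ℤ.* y) ≡ ↑ x * ↑ y
  ↑-* x y = ℚₚ.toℚᵘ-injective (ℚᵘₚ.≃-trans (↑-unnormalised (x ℤ.* y)) (ℚᵘₚ.≃-trans (*≡* (identity x y))
    (ℚᵘₚ.≃-sym (ℚᵘₚ.≃-trans (ℚₚ.toℚᵘ-homo-* (↑ x) (↑ y)) (ℚᵘₚ.*-cong (↑-unnormalised x) (↑-unnormalised y))))))
    where
    identity : ∀ x y → x ℤ.* y ℤ.* (+ 1 ℤ.* + 1) ≡ x ℤ.* y ℤ.* + 1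
    identity = ℤ-Tactic.solve-∀

  ↑-mono-≤ : ∀ {x y} → x ℤ.≤ y → ↑ x ≤ ↑ y
  ↑-mono-≤ {x} {y} x≤y = ℚₚ.toℚᵘ-cancel-≤ (ℚᵘₚ.≤-respˡ-≃ (ℚᵘₚ.≃-sym (↑-unnormalised x))
    (ℚᵘₚ.≤-respʳ-≃ (ℚᵘₚ.≃-sym (↑-unnormalised y)) (*≤* (ℤₚ.*-monoʳ-≤-nonNeg (+ 1) x≤y))))

  ↑-nonNegative : ∀ n → NonNegative (↑ (+ n))
  ↑-nonNegative n = ℚ.nonNegative (↑-mono-≤ {0ℤ} {+ n} (ℤ.+≤+ z≤n))

  ↑-positive : ∀ n → Positive (↑ (+ suc n))
  ↑-positive n = ℚ.positive (ℚₚ.<-≤-trans (ℚ.*<* (ℤ.+<+ (s≤s z≤n))) (↑-mono-≤ {+ 1} {+ suc n} (ℤ.+≤+ (s≤s z≤n))))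

  square-<⇒< : ∀ {x} n → x * x < ↑ (+ n) * ↑ (+ n) → x < ↑ (+ n)
  square-<⇒< {x} n x²<n² = ℚₚ.≰⇒> λ n≤x → ℚₚ.<-irrefl refl (ℚₚ.<-≤-trans x²<n²
    (ℚₚ.≤-trans (ℚₚ.*-monoˡ-≤-nonNeg (↑ (+ n)) {{↑-nonNegative n}} n≤x)
      (ℚₚ.*-monoʳ-≤-nonNeg x {{ℚ.nonNegative (ℚₚ.≤-trans (↑-mono-≤ {0ℤ} {+ n} (ℤ.+≤+ z≤n)) n≤x)}} n≤x)))

  √-< : ∀ {d x} n → d ℤ.≤ + n ℤ.* + n → (√ d) x → x < ↑ (+ n)
  √-< n d≤n² (inj₁ x<0) = ℚₚ.<-≤-trans x<0 (↑-mono-≤ {0ℤ} {+ n} (ℤ.+≤+ z≤n))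
  √-< {d} n d≤n² (inj₂ x²<d) = square-<⇒< n (ℚₚ.<-≤-trans x²<d (subst (λ z → ↑ d ≤ z) (↑-* (+ n) (+ n)) (↑-mono-≤ d≤n²)))

  -- Multiplying p/m + c/n + √d/k by the common denominator k = α m = β n.
  cut-bound : ∀ (a p c d : ℤ) (m n k α β s : ℕ) .{{_ : ℕ.NonZero m}} .{{_ : ℕ.NonZero n}} .{{_ : ℕ.NonZero k}} →
    k ≡ suc α ℕ.* m → k ≡ suc β ℕ.* n → d ℤ.≤ + s ℤ.* + s →
    + suc α ℤ.* p ℤ.+ + suc β ℤ.* c ℤ.+ + s ℤ.≤ + k ℤ.* a →
    ‵ a ≥ᴿ ‵ p ÷ m +ᴿ ‵ c ÷ n +ᴿ (√ d) ÷ k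
  cut-bound a p c d m n k@(suc k′) α β s k≡αm k≡βn d≤s² bound q (t , u , (t₁ , t₂ , t₁<p , t₂<c , refl) , √d∋u , refl) =
    ℚₚ.*-cancelˡ-<-nonNeg (↑ (+ k)) {{↑-nonNegative k}} (begin-strict
      ↑ (+ k) * (t₁ + t₂ + u)
        ≡⟨ distribute (↑ (+ k)) t₁ t₂ u ⟩
      ↑ (+ k) * t₁ + ↑ (+ k) * t₂ + u * ↑ (+ k)
        ≡⟨ cong₂ (λ x y → x * t₁ + y * t₂ + u * ↑ (+ k)) (factor α m k≡αm) (factor β n k≡βn) ⟩
      ↑ (+ suc α) * ↑ (+ m) * t₁ + ↑ (+ suc β) * ↑ (+ n) * t₂ + u * ↑ (+ k)
        ≡⟨ regroup (↑ (+ suc α)) (↑ (+ m)) t₁ (↑ (+ suc β)) (↑ (+ n)) t₂ (u * ↑ (+ k)) ⟩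
      ↑ (+ suc α) * (t₁ * ↑ (+ m)) + ↑ (+ suc β) * (t₂ * ↑ (+ n)) + u * ↑ (+ k)
        <⟨ ℚₚ.+-mono-< (ℚₚ.+-mono-< (ℚₚ.*-monoʳ-<-pos (↑ (+ suc α)) {{↑-positive α}} t₁<p)
                                     (ℚₚ.*-monoʳ-<-pos (↑ (+ suc β)) {{↑-positive β}} t₂<c))
                       (√-< s d≤s² √d∋u) ⟩
      ↑ (+ suc α) * ↑ p + ↑ (+ suc β) * ↑ c + ↑ (+ s)
        ≡⟨ cong₂ (λ x y → x + y + ↑ (+ s)) (↑-* (+ suc α) p) (↑-* (+ suc β) c) ⟨
      ↑ (+ suc α ℤ.* p) + ↑ (+ suc β ℤ.* c) + ↑ (+ s)
        ≡⟨ cong (_+ ↑ (+ s)) (↑-+ (+ suc α ℤ.* p) (+ suc β ℤ.* c)) ⟨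
      ↑ (+ suc α ℤ.* p ℤ.+ + suc β ℤ.* c) + ↑ (+ s)
        ≡⟨ ↑-+ (+ suc α ℤ.* p ℤ.+ + suc β ℤ.* c) (+ s) ⟨
      ↑ (+ suc α ℤ.* p ℤ.+ + suc β ℤ.* c ℤ.+ + s)
        ≤⟨ ↑-mono-≤ bound ⟩
      ↑ (+ k ℤ.* a)
        ≡⟨ ↑-* (+ k) a ⟩
      ↑ (+ k) * ↑ a ∎)
    where
    open ℚₚ.≤-Reasoning
    open +-*-Solver
    factor : ∀ {k} γ m → k ≡ suc γ ℕ.* m → ↑ (+ k) ≡ ↑ (+ suc γ) * ↑ (+ m)
    factor γ m refl = trans (cong ↑ (ℤₚ.pos-* (suc γ) m)) (↑-* (+ suc γ) (+ m))
    distribute : ∀ k x y u → k * (x + y + u) ≡ k * x + k * y + u * k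
    distribute = solve 4 (λ k x y u → k :* (x :+ y :+ u) := k :* x :+ k :* y :+ u :* k) refl
    regroup : ∀ α m x β n y z → α * m * x + β * n * y + z ≡ α * (x * m) + β * (y * n) + z
    regroup = solve 7 (λ α m x β n y z → α :* m :* x :+ β :* n :* y :+ z := α :* (x :* m) :+ β :* (y :* n) :+ z) refl

open Cuts using (cut-bound)

-- The three residue classes of a modulo 3

open import Data.Integer using (ℤ; +_) renaming (_+_ to _+ᶻ_; _-_ to _-ᶻ_; _*_ to _*ᶻ_; _^_ to _^ᶻ_)
open import Data.Integer using () renaming (_≤_ to _≤ᶻ_)
open import Data.Integer.Solver using (module +-*-Solver)
open +-*-Solver using (con; solve; _:=_; _:+_; _:*_; _:-_)
open import Data.Nat using (ℕ; _+_; _*_; _≤_; _<_; _≥_; _%_; _/_)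
open import Data.Nat.Divisibility using (_∣_; divides)
open import Data.Nat.DivMod using (m≡m%n+[m/n]*n)

EPositive⇒Bounded : ∀ a b → EPositive (X (spider (a ∷ b ∷ 2 ∷ []))) → Bounded pathCoeff a b
EPositive⇒Bounded a b positive k k≤6 = ℤₚ.drop‿+≤+ (subst (_≤ᶻ + pathCoeff (3 + (a + b)) k)
  (cong₂ _+ᶻ_ (toSeries-· (pathCoeff (1 + a)) (pathCoeff (2 + b)) k) (toSeries-· (pathCoeff (2 + a)) (pathCoeff (1 + b)) k))
  (EPositive⇒coefficients a b positive k k≤6))

pos-affine : ∀ c m x n y → + (c + m * x + n * y) ≡ + c +ᶻ + m *ᶻ + x +ᶻ + n *ᶻ + y
pos-affine c m x n y = cong₂ (λ i j → + c +ᶻ i +ᶻ j) (ℤₚ.pos-* m x) (ℤₚ.pos-* n y)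

by-excess : ∀ {i j} k → i +ᶻ k ≡ j → 0ℤ ≤ᶻ k → i ≤ᶻ j
by-excess {i} k refl 0≤k = subst (_≤ᶻ i +ᶻ k) (ℤₚ.+-identityʳ i) (ℤₚ.+-monoʳ-≤ i 0≤k)

quotient-≤ : ∀ r x y → r < 3 → y * 3 ≤ r + x * 3 → y ≤ x
quotient-≤ r x y r<3 3y≤r+3x = ℕₚ.≮⇒≥ λ x<y → ℕₚ.<⇒≱ r<3
  (ℕₚ.+-cancelʳ-≤ (x * 3) 3 r (ℕₚ.≤-trans (ℕₚ.*-monoˡ-≤ 3 x<y) 3y≤r+3x))

residue-0 : ∀ x y → 4 ≤ y → y * 3 ≤ x * 3 → Bounded pathCoeff (x * 3) (y * 3) → x * 3 ≥ 3 * (y * 3) + 3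
residue-0 x y 4≤y 3y≤3x bounded = subst (_≤ x * 3) (rearrange y) (ℕₚ.*-monoˡ-≤ 3
  (ℕₚ.≰⇒> (bounded⇒3y<x pathCoeff pathCoeff-closed x y 4≤y (quotient-≤ 0 x y (s≤s z≤n) 3y≤3x) bounded)))
  where
  rearrange : ∀ y → suc (3 * y) * 3 ≡ 3 * (y * 3) + 3
  rearrange = ℕ-Tactic.solve-∀

-- Here 4 a − 2 b − 9 = 31 + 18 w + 12 t.
real-bound-1 : ∀ w t {a b} → a ≡ 16 + 6 * w + 3 * t → b ≡ 12 + 3 * w + 0 * t →
  ‵ (+ a) ≥ᴿ ‵ (+ b) ÷ 2 +ᴿ ‵ (+ 9) ÷ 4 +ᴿ (√ (+ 12 *ᶻ (+ b) ^ᶻ 2 -ᶻ + 180 *ᶻ + b +ᶻ + 565)) ÷ 4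
real-bound-1 w t {a} {b} refl refl = cut-bound (+ a) (+ b) (+ 9) _ 2 4 4 1 0 (31 + 18 * w + 12 * t) refl refl
  (subst₂ (λ B S → + 12 *ᶻ B ^ᶻ 2 -ᶻ + 180 *ᶻ B +ᶻ + 565 ≤ᶻ S *ᶻ S) (sym +b≡) (sym +s≡)
    (by-excess _ (solve 2 (λ w t → let B = con (+ 12) :+ con (+ 3) :* w :+ con (+ 0) :* t
                                       S = con (+ 31) :+ con (+ 18) :* w :+ con (+ 12) :* t in
        con (+ 12) :* (B :* (B :* con 1ℤ)) :- con (+ 180) :* B :+ con (+ 565) :+ horner₂ₚ excess w t := S :* S) refl (+ w) (+ t))
      (horner₂-nonNegative excess w t)))
  (subst₂ _≤ᶻ_ (cong₂ (λ B S → + 2 *ᶻ B +ᶻ + 1 *ᶻ + 9 +ᶻ S) (sym +b≡) (sym +s≡)) (cong (λ A → + 4 *ᶻ A) (sym +a≡))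
    (ℤₚ.≤-reflexive (solve 2 (λ w t →
      con (+ 2) :* (con (+ 12) :+ con (+ 3) :* w :+ con (+ 0) :* t) :+ con (+ 1) :* con (+ 9)
        :+ (con (+ 31) :+ con (+ 18) :* w :+ con (+ 12) :* t) :=
      con (+ 4) :* (con (+ 16) :+ con (+ 6) :* w :+ con (+ 3) :* t)) refl (+ w) (+ t))))
  where
  -- The coefficients of (4a - 2b - 9)² minus the radicand, by powers of t and then of w.
  excess : List (List ℕ)
  excess = (828 ∷ 792 ∷ 216 ∷ []) ∷ (744 ∷ 432 ∷ []) ∷ (144 ∷ []) ∷ []
  +a≡ = pos-affine 16 6 w 3 t
  +b≡ = pos-affine 12 3 w 0 t
  +s≡ = pos-affine 31 18 w 12 t

-- `bounded⇒2y<4+x` gives a > 2b - 11, hence a ≥ 2b - 8 by the residues modulo 3, which implies the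
-- asserted bound. The slack is t = (a - 2b + 8) / 3, and w = b / 3 - 4.
residue-1 : ∀ x y → 4 ≤ y → y * 3 ≤ 1 + x * 3 → Bounded pathCoeff (1 + x * 3) (y * 3) →
  let a = 1 + x * 3; b = y * 3 in
  ‵ (+ a) ≥ᴿ ‵ (+ b) ÷ 2 +ᴿ ‵ (+ 9) ÷ 4 +ᴿ (√ (+ 12 *ᶻ (+ b) ^ᶻ 2 -ᶻ + 180 *ᶻ + b +ᶻ + 565)) ÷ 4
residue-1 x y 4≤y 3y≤a bounded =
  let w , 4+w≡y = ℕₚ.m≤n⇒∃[o]m+o≡n 4≤y
      t , 2y+t≡3+x = ℕₚ.m≤n⇒∃[o]m+o≡n (ℕₚ.≤-pred (ℕₚ.≰⇒>
        (bounded⇒2y<4+x pathCoeff pathCoeff-closed x y (quotient-≤ 1 x y (s≤s (s≤s z≤n)) 3y≤a) bounded)))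
      x≡ = ℕₚ.+-cancelˡ-≡ 3 x (5 + w + w + t) (trans (sym 2y+t≡3+x) (trans (cong (λ y → 2 * y + t) (sym 4+w≡y)) (double w t)))
  in real-bound-1 w t (trans (cong (λ x → 1 + x * 3) x≡) (triple-x w t)) (trans (cong (_* 3) (sym 4+w≡y)) (triple-y w t))
  where
  double : ∀ w t → 2 * (4 + w) + t ≡ 3 + (5 + w + w + t)
  double = ℕ-Tactic.solve-∀
  triple-x : ∀ w t → 1 + (5 + w + w + t) * 3 ≡ 16 + 6 * w + 3 * t
  triple-x = ℕ-Tactic.solve-∀
  triple-y : ∀ w t → (4 + w) * 3 ≡ 12 + 3 * w + 0 * t
  triple-y = ℕ-Tactic.solve-∀

-- Here 6 a − 3 b − 2 = 19 + 9 y + 18 u, and the square of this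
-- exceeds the radicand by 6 times the difference of the two sides of Γ-bound₂.
real-bound-2 : ∀ y u {a b} → a ≡ 5 + 3 * y + 3 * u → b ≡ 3 + 3 * y + 0 * u →
  Bounded pathCoeff (2 + suc (y + u) * 3) (suc y * 3) →
  ‵ (+ a) ≥ᴿ ‵ (+ b) ÷ 2 +ᴿ ‵ (+ 1) ÷ 3 +ᴿ (√ (+ 27 *ᶻ (+ b) ^ᶻ 2 -ᶻ + 54 *ᶻ + b +ᶻ + 112)) ÷ 6
real-bound-2 y u {a} {b} refl refl bounded = cut-bound (+ a) (+ b) (+ 1) _ 2 3 6 2 1 (19 + 9 * y + 18 * u) refl refl
  (subst₂ (λ B S → + 27 *ᶻ B ^ᶻ 2 -ᶻ + 54 *ᶻ B +ᶻ + 112 ≤ᶻ S *ᶻ S) (sym +b≡) (sym +s≡)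
    (by-excess _ (solve 2 (λ y u → let B = con (+ 3) :+ con (+ 3) :* y :+ con (+ 0) :* u
                                       S = con (+ 19) :+ con (+ 9) :* y :+ con (+ 18) :* u
                                       x = y :+ u in
        con (+ 27) :* (B :* (B :* con 1ℤ)) :- con (+ 54) :* B :+ con (+ 112)
          :+ con (+ 6) :* (con (+ 6) :* Γₚ 2 (con (+ 2) :+ (x :+ y))
            :- (con (+ 1) :* (Γₚ 0 (con 1ℤ :+ x) :* Γₚ 2 y) :+ con (+ 2) :* (Γₚ 1 (con 1ℤ :+ x) :* Γₚ 1 y)))
        := S :* S) refl (+ y) (+ u))
      (*-nonNegative {+ 6} (ℤ.+≤+ z≤n) (ℤₚ.i≤j⇒0≤j-i (Γ-bound₂ pathCoeff pathCoeff-closed (y + u) y bounded)))))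
  (subst₂ _≤ᶻ_ (cong₂ (λ B S → + 3 *ᶻ B +ᶻ + 2 *ᶻ + 1 +ᶻ S) (sym +b≡) (sym +s≡)) (cong (λ A → + 6 *ᶻ A) (sym +a≡))
    (ℤₚ.≤-reflexive (solve 2 (λ y u →
      con (+ 3) :* (con (+ 3) :+ con (+ 3) :* y :+ con (+ 0) :* u) :+ con (+ 2) :* con (+ 1)
        :+ (con (+ 19) :+ con (+ 9) :* y :+ con (+ 18) :* u) :=
      con (+ 6) :* (con (+ 5) :+ con (+ 3) :* y :+ con (+ 3) :* u)) refl (+ y) (+ u))))
  where
  +a≡ = pos-affine 5 3 y 3 u
  +b≡ = pos-affine 3 3 y 0 u
  +s≡ = pos-affine 19 9 y 18 u

residue-2 : ∀ x y → 4 ≤ y → y * 3 ≤ 2 + x * 3 → Bounded pathCoeff (2 + x * 3) (y * 3) →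
  let a = 2 + x * 3; b = y * 3 in
  ‵ (+ a) ≥ᴿ ‵ (+ b) ÷ 2 +ᴿ ‵ (+ 1) ÷ 3 +ᴿ (√ (+ 27 *ᶻ (+ b) ^ᶻ 2 -ᶻ + 54 *ᶻ + b +ᶻ + 112)) ÷ 6
residue-2 x (suc y) 4≤y 3y≤a bounded
  with u , refl ← ℕₚ.m≤n⇒∃[o]m+o≡n (quotient-≤ 2 x (suc y) ℕₚ.≤-refl 3y≤a)
  = real-bound-2 y u (triple-x y u) (triple-y y u) bounded
  where
  triple-x : ∀ y u → 2 + (suc y + u) * 3 ≡ 5 + 3 * y + 3 * u
  triple-x = ℕ-Tactic.solve-∀
  triple-y : ∀ y u → suc y * 3 ≡ 3 + 3 * y + 0 * u
  triple-y = ℕ-Tactic.solve-∀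

theorem4p5 : (a b : ℕ) → a ≥ b → b ≥ 12 → 3 ∣ b →
    EPositive (X (spider (a ∷ b ∷ 2 ∷ []))) →
    (a % 3 ≡ 0 → a ≥ 3 * b + 3) ×
    (a % 3 ≡ 1 → ‵ (+ a) ≥ᴿ ‵ (+ b) ÷ 2 +ᴿ ‵ (+ 9) ÷ 4 +ᴿ (√ (+ 12 *ᶻ (+ b) ^ᶻ 2 -ᶻ + 180 *ᶻ + b +ᶻ + 565)) ÷ 4) ×
    (a % 3 ≡ 2 → ‵ (+ a) ≥ᴿ ‵ (+ b) ÷ 2 +ᴿ ‵ (+ 1) ÷ 3 +ᴿ (√ (+ 27 *ᶻ (+ b) ^ᶻ 2 -ᶻ + 54 *ᶻ + b +ᶻ + 112)) ÷ 6)
theorem4p5 a b a≥b b≥12 (divides y refl) positive =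
  (λ eq → at (_≥ 3 * b + 3) eq (residue-0 x y 4≤y (within eq) (bounds eq))) ,
  -- The right-hand cut depends on b only. Once a rational q in it is given, just the membership of
  -- q in the cut of a has to be transported along the division by 3.
  (λ eq q r → at (λ a → (‵ (+ a)) q) eq (residue-1 x y 4≤y (within eq) (bounds eq) q r)) ,
  (λ eq q r → at (λ a → (‵ (+ a)) q) eq (residue-2 x y 4≤y (within eq) (bounds eq) q r))
  where
  x = a / 3
  4≤y : 4 ≤ y
  4≤y = ℕₚ.*-cancelʳ-≤ 4 y 3 b≥12
  a≡ : ∀ {r} → a % 3 ≡ r → a ≡ r + x * 3
  a≡ refl = m≡m%n+[m/n]*n a 3
  at : ∀ {ℓ} (P : ℕ → Set ℓ) {r} → a % 3 ≡ r → P (r + x * 3) → P a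
  at P eq = subst P (sym (a≡ eq))
  within : ∀ {r} → a % 3 ≡ r → y * 3 ≤ r + x * 3
  within eq = subst (b ≤_) (a≡ eq) a≥b
  bounds : ∀ {r} → a % 3 ≡ r → Bounded pathCoeff (r + x * 3) (y * 3)
  bounds eq = subst (λ a → Bounded pathCoeff a b) (a≡ eq) (EPositive⇒Bounded a b positive)
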